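{- Let $P$ be a connected naturally labeled poset on $n$ elements such that $\check{P}$ is ranked, and let $$\mathcal{G}_{\mathrm{Ldes}}(P,z) = g_0(P) + g_1(P) z + \cdots + g_{n-1}(P) z^{n-1} = \sum_{\tau \in \mathrm{DC}(P)} z^{\mathrm{Ldes}_P(\tau)} .$$ Then $g_i(P) = g_{n-1-i}(P)$ for all $0 \le i \le n-1$, and $g_i(P) \le g_{i+1}(P)$ for all $0 \le i < \lfloor \tfrac{n-1}{2} \rfloor$.
   Context: All posets are finite. For a poset $(P,\preceq)$, $a \lessdot b$ denotes a cover relation, and $\check{P} = P \cup \{\hat 0\}$ is $P$ with a new minimum $\hat 0$ adjoined (even if $P$ already has a minimum). A poset is connected if its Hasse diagram is connected. A poset is ranked if for all elements $a,b$ all maximal chains in the interval $[a,b]$ have the same length. $P$ is naturally labeled if its ground set is $\{1,\dots,n\}$, $n = |P|$, and $a \prec b$ implies $a < b$ as integers; one sets $\hat 0 := 0$. For $\tau \in \mathfrak{S}_n$ set $\tau(0) := 0$. For a saturated chain $C = \{\hat 0 = c_1 \lessdot \cdots \lessdot c_k = a\}$ in $\check{P}$ let $\mathrm{des}(\tau|_C)$ be the number of $1 \le j < k$ with $\tau(c_j) > \tau(c_{j+1})$. The permutation $\tau$ is descent-compatible with $P$ if for every $a \in P$ the number $\mathrm{des}(\tau|_C)$ is the same for all saturated chains $C$ in $\check{P}$ from $\hat 0$ to $a$; then $\mathrm{des}_{P,\tau}(a)$ denotes this common number, and $\mathrm{des}_{P,\tau}(\hat 0) := 0$. $\mathrm{DC}(P)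 \subseteq \mathfrak{S}_n$ is the set of descent-compatible permutations. For $\tau \in \mathrm{DC}(P)$, $\mathrm{Ldes}_P(\tau)$ is the number of pairs $(a,b) \in \check{P} \times \check{P}$ with $\tau(a) = \tau(b) - 1$ such that either $\mathrm{des}_{P,\tau}(a) < \mathrm{des}_{P,\tau}(b)$, or $\mathrm{des}_{P,\tau}(a) = \mathrm{des}_{P,\tau}(b)$ and $a > b$ (as integers). -}

module Defs where

open import Data.Bool.Base using (if_then_else_)
open import Data.Fin.Base as Fin using (Fin; toℕ)
import Data.Fin.Properties as Fin
open import Data.Fin.Permutation as Perm using (Permutation′; _⟨$⟩ʳ_)
open import Data.List.Base
  using (List; []; _∷_; [_]; map; length; filter; allFin; cartesianProduct; cartesianProductWith)
open import Data.List.Membership.Propositional using (_∈_)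
open import Data.List.Relation.Unary.All using (All)
open import Data.List.Relation.Unary.AllPairs using (AllPairs)
open import Data.Nat.Base using (ℕ; zero; suc; _+_; _<_; _>_; _≤_; z≤n; s≤s; s≤s⁻¹)
open import Data.Nat.Properties
  using (_≟_; _<?_; ≤-refl; ≤-trans; <-≤-trans; <-irrefl;
         +-monoʳ-≤; +-suc; +-identityʳ)
open import Data.Product.Base using (_×_; _,_; proj₁; ∃)
open import Data.Sum.Base using (_⊎_)
open import Level using (0ℓ)
open import Relation.Binary.Core using (Rel)
open import Relation.Binary.Definitions using (Decidable)
open import Relation.Binary.PropositionalEquality
  using (_≡_; refl; sym; trans; subst)
open import Relation.Binary.Structures using (IsDecPartialOrder)
import Relation.Binary.Construct.Add.Infimum.NonStrict as AddInfimum
import Relation.Binary.Construct.NonStrictToStrict as ToStrict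
open import Relation.Binary.Construct.Closure.Equivalence using (EqClosure)
open import Relation.Binary.Construct.Closure.ReflexiveTransitive
  using (Star; ε; _◅_; _◅◅_)
open import Relation.Nullary using (¬_; Dec; yes; no; contradiction)
open import Relation.Nullary.Construct.Add.Infimum
  using (_₋; ⊥₋) renaming ([_] to [_]₋)
open import Relation.Nullary.Decidable
  using (does; map′; _×-dec_; _⊎-dec_; _→-dec_; ¬?)
open import Relation.Unary using (Pred) renaming (Decidable to Decidable₁)

module Order {A : Set} (_≼_ : Rel A 0ℓ) where

  open ToStrict _≡_ _≼_ public using () renaming (_<_ to _≺_)

  infix 4 _⋖_

  _⋖_ : Rel A 0ℓ
  a ⋖ b = a ≺ b × (∀ c → ¬ (a ≺ c × c ≺ b))

  SaturatedChain : Rel A 0ℓ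
  SaturatedChain = Star _⋖_

  Connected : Set
  Connected = ∀ a b → EqClosure _⋖_ a b

  -- A finite chain is represented by the strictly increasing list of its
  -- elements.
  record IsMaximalChain (a b : A) (cs : List A) : Set where
    field
      increasing : AllPairs _≺_ cs
      inInterval : All (λ c → a ≼ c × c ≼ b) cs
      maximal    : ∀ x → a ≼ x → x ≼ b → All (λ c → x ≼ c ⊎ c ≼ x) cs → x ∈ cs

  Ranked : Set
  Ranked = ∀ a b cs ds → IsMaximalChain a b cs → IsMaximalChain a b ds →
           length cs ≡ length ds

-- The element i : Fin n stands for the integer 1 + toℕ i.
record NaturallyLabeledPoset (n : ℕ) : Set₁ where
  infix 4 _≼_
  field
    _≼_               : Rel (Fin n) 0ℓ
    isDecPartialOrder : IsDecPartialOrder _≡_ _≼_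

  module P = Order _≼_

  field
    natural : ∀ {a b} → a P.≺ b → a Fin.< b

-- Every permutation of Fin (suc n) arises exactly once, from its value j
-- at zero and the permutation π of Fin n left after removing zero and j.
permutations : ∀ n → List (Permutation′ n)
permutations zero    = [ Perm.id ]
permutations (suc n) =
  cartesianProductWith (Perm.insert Fin.zero) (allFin (suc n)) (permutations n)

module _ {n : ℕ} (P : NaturallyLabeledPoset n) where

  open NaturallyLabeledPoset P using (_≼_; isDecPartialOrder; natural)

  P̌ : Set
  P̌ = Fin n ₋

  _≼̌_ : Rel P̌ 0ℓ
  _≼̌_ = AddInfimum._≤₋_ _≼_

  open Order _≼̌_ using (_≺_; _⋖_; SaturatedChain)

  elements : List P̌
  elements = ⊥₋ ∷ map [_]₋ (allFin n)

  label : P̌ → ℕ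
  label ⊥₋     = 0
  label [ a ]₋ = suc (toℕ a)

  value : Permutation′ n → P̌ → ℕ
  value τ ⊥₋     = 0
  value τ [ a ]₋ = suc (toℕ (τ ⟨$⟩ʳ a))

  descent : Permutation′ n → P̌ → P̌ → ℕ
  descent τ a b = if does (value τ b <? value τ a) then 1 else 0

  des : ∀ {a b} → Permutation′ n → SaturatedChain a b → ℕ
  des τ ε                   = 0
  des τ (_◅_ {a} {b} a⋖b C) = descent τ a b + des τ C

  DescentCompatible : Permutation′ n → Set
  DescentCompatible τ =
    ∀ (a : Fin n) (C D : SaturatedChain ⊥₋ [ a ]₋) → des τ C ≡ des τ D

  module DPO = IsDecPartialOrder (AddInfimum.≤₋-isDecPartialOrder-≡ _≼_ isDecPartialOrder)

  ∀? : {Q : Pred P̌ 0ℓ} → Decidable₁ Q → Dec (∀ x → Q x)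
  ∀? Q? = map′ (λ { (q , qs) ⊥₋ → q ; (q , qs) [ a ]₋ → qs a })
               (λ f → f ⊥₋ , λ a → f [ a ]₋)
               (Q? ⊥₋ ×-dec Fin.all? (λ a → Q? [ a ]₋))

  ∃? : {Q : Pred P̌ 0ℓ} → Decidable₁ Q → Dec (∃ Q)
  ∃? Q? with Q? ⊥₋ | Fin.any? (λ a → Q? [ a ]₋)
  ... | yes q | _           = yes (⊥₋ , q)
  ... | no ¬q | yes (a , q) = yes ([ a ]₋ , q)
  ... | no ¬q | no ¬qs      =
    no λ { (⊥₋ , q) → ¬q q ; ([ a ]₋ , q) → ¬qs (a , q) }

  _≺?_ : Decidable _≺_
  _≺?_ = ToStrict.<-decidable _≡_ _≼̌_ DPO._≟_ DPO._≤?_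

  _⋖?_ : Decidable _⋖_
  a ⋖? b = a ≺? b ×-dec ∀? (λ c → ¬? (a ≺? c ×-dec c ≺? b))

  label-mono : ∀ {a b} → a ≺ b → label a < label b
  label-mono {⊥₋}     {⊥₋}     (_ , ≢)   = contradiction refl ≢
  label-mono {⊥₋}     {[ b ]₋} _         = s≤s z≤n
  label-mono {[ a ]₋} {[ b ]₋} (AddInfimum.[ a≼b ] , ≢) =
    s≤s (natural (a≼b , λ { refl → ≢ refl }))

  label≤n : ∀ a → label a ≤ n
  label≤n ⊥₋     = z≤n
  label≤n [ a ]₋ = Fin.toℕ<n a

  refine : ∀ k {a b} → label b ≤ k + label a → a ≺ b → SaturatedChain a b
  refine zero    b≤a   a≺b = contradiction (<-≤-trans (label-mono a≺b) b≤a) (<-irrefl refl)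
  refine (suc k) {a} {b} b≤k+a a≺b with ∃? (λ c → a ≺? c ×-dec c ≺? b)
  ... | no ¬c               = (a≺b , λ c q → ¬c (c , q)) ◅ ε
  ... | yes (c , a≺c , c≺b) =
    refine k (s≤s⁻¹ (≤-trans (label-mono c≺b) b≤k+a)) a≺c ◅◅
    refine k (≤-trans b≤k+a (subst (_≤ k + label c) (+-suc k (label a))
                              (+-monoʳ-≤ k (label-mono a≺c)))) c≺b

  allChains? : ∀ k τ {a b} → n ≤ k + label a → {Q : Pred ℕ 0ℓ} → Decidable₁ Q →
               Dec (∀ (C : SaturatedChain a b) → Q (des τ C))
  allChains? k τ {a} {b} n≤ {Q} Q? =
    map′ (λ { (q , _) ε → q refl ; (_ , qs) (a⋖c ◅ C) → qs _ a⋖c C })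
         (λ f → (λ { refl → f ε }) , λ c a⋖c C → f (a⋖c ◅ C))
         ((a DPO.≟ b →-dec Q? 0) ×-dec ∀? (step k n≤))
    where
    step : ∀ k → n ≤ k + label a → ∀ c →
           Dec (∀ (a⋖c : a ⋖ c) (C : SaturatedChain c b) → Q (descent τ a c + des τ C))
    step k n≤ c with a ⋖? c
    ... | no ¬a⋖c = yes λ a⋖c → contradiction a⋖c ¬a⋖c
    step zero    n≤ c | yes (a≺c , _) =
      contradiction (<-≤-trans (label-mono a≺c) (≤-trans (label≤n c) n≤)) (<-irrefl refl)
    step (suc k) n≤ c | yes a⋖c =
      map′ (λ f _ → f) (λ f → f a⋖c)
        (allChains? k τ
          (≤-trans n≤ (subst (_≤ k + label c) (+-suc k (label a))
                        (+-monoʳ-≤ k (label-mono (proj₁ a⋖c)))))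
          (λ m → Q? (descent τ a c + m)))

  someChain : ∀ a → SaturatedChain ⊥₋ a
  someChain ⊥₋     = ε
  someChain [ a ]₋ =
    refine n (≤-trans (label≤n [ a ]₋) (subst (n ≤_) (sym (+-identityʳ n)) ≤-refl))
             (AddInfimum.⊥₋≤ [ a ]₋ , λ ())

  descentCompatible? : Decidable₁ DescentCompatible
  descentCompatible? τ =
    map′ (λ f a C D → trans (f a C) (sym (f a D)))
         (λ f a C → f a C (someChain [ a ]₋))
         (Fin.all? λ a → allChains? n τ (subst (n ≤_) (sym (+-identityʳ n)) ≤-refl)
                           (λ m → m ≟ des τ (someChain [ a ]₋)))

  DC : List (Permutation′ n)
  DC = filter descentCompatible? (permutations n)

  -- For τ descent-compatible, the choice of chain is irrelevant.
  desAt : Permutation′ n → P̌ → ℕ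
  desAt τ a = des τ (someChain a)

  -- The condition τ(a) = τ(b) - 1 is written additively, so that no
  -- truncated subtraction occurs.
  LipschitzDescent : Permutation′ n → P̌ × P̌ → Set
  LipschitzDescent τ (a , b) =
    suc (value τ a) ≡ value τ b ×
    (desAt τ a < desAt τ b ⊎ (desAt τ a ≡ desAt τ b × label a > label b))

  lipschitzDescent? : ∀ τ → Decidable₁ (LipschitzDescent τ)
  lipschitzDescent? τ (a , b) =
    suc (value τ a) ≟ value τ b ×-dec
    (desAt τ a <? desAt τ b ⊎-dec (desAt τ a ≟ desAt τ b ×-dec label b <? label a))

  Ldes : Permutation′ n → ℕ
  Ldes τ = length (filter (lipschitzDescent? τ) (cartesianProduct elements elements))

  -- The coefficient of z^i in the sum of z^(Ldes τ) over all τ in DC.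
  g : ℕ → ℕ
  g i = length (filter (λ τ → Ldes τ ≟ i) DC)

{-# OPTIONS --safe #-}

-- Fix k and consider the integer functions F on P̌ with F(0̂) = 0 and F(a) ≤ F(b) ≤ F(a) + k
-- along every cover a ⋖ b.  Dividing by k and sorting the remainders, F determines a unique
-- τ ∈ DC(P) and F = k · des + c, where c takes values in {0,…,k} and increases along the word
-- 0̂, τ⁻¹(1), …, τ⁻¹(n), strictly at the Lipschitz descents of τ.  As P̌ is ranked, the translate
-- F + ⌊rank/2⌋ has a similar expression (k + 1) · des + c, but now c increases strictly at the
-- descents of the word with respect to the order in which elements of even rank precede those
-- of odd rank and ties are broken by labels.  The number of admissible c depends only on k and
-- on the number of strict increases, so comparing the counts for all k shows that Ldes has the
-- same distribution on DC(P) as the number of descents of the second kind.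
--
-- Covers join ranks of opposite parity, so whether τ is descent-compatible depends only on the
-- cyclic word up to permutations inside its maximal runs of letters of equal parity.  The words
-- of DC(P) thus split into products of symmetric groups, one factor for each run, and the
-- descent polynomial of such a product is a power of X times a product of Eulerian polynomials.
-- These are γ-positive, hence palindromic and unimodal, and since the runs alternate between
-- the parities around the cycle, all the products have the same centre (n - 1)/2.

module Submission where

open import Defs
open import Data.Bool using (Bool; true; false; not; if_then_else_)
open import Data.Bool.Properties using () renaming (_≟_ to _≟ᵇ_)
open import Data.Fin.Base as Fin using (Fin; zero; suc; toℕ; fromℕ<; punchIn; punchOut)
import Data.Fin.Properties as Fin
open import Data.Fin.Permutation as Perm using (Permutation′; _⟨$⟩ʳ_; _⟨$⟩ˡ_; permutation; insert; remove; inverseˡ; inverseʳ; insert-punchIn; punchIn-permute)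
open import Data.List as List using (List; []; _∷_; [_]; _++_; map; length; filter; concat; concatMap; replicate; allFin; cartesianProduct; cartesianProductWith)
open import Data.List.Properties as List using (filter-++; length-++; filter-accept; filter-reject; filter-notAll; map-++; map-∘; map-cong; map-id; map-replicate; map-tabulate; length-map; length-tabulate; tabulate-lookup; ++-identityʳ; ++-assoc; ++-cancelˡ; concatMap-++; concatMap-map; map-concatMap; ∷-injectiveˡ; ∷-injectiveʳ; ≡-dec)
open import Data.List.Membership.Propositional using (_∈_; _∉_; find; lose)
open import Data.List.Membership.Propositional.Properties using (∈-map⁻; ∈-map⁺; ∈-++⁻; ∈-++⁺ˡ; ∈-++⁺ʳ; ∈-∃++; ∈-filter⁺; ∈-filter⁻; ∈-concatMap⁺; ∈-concatMap⁻; ∈-allFin; ∈-cartesianProduct⁺; ∈-cartesianProductWith⁺; ∈-cartesianProductWith⁻; ∈-tabulate⁺; ∈-tabulate⁻)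
open import Data.List.Membership.Propositional.Properties.WithK using (unique∧set⇒bag)
import Data.List.Membership.DecPropositional as DecMembership
open import Data.List.Relation.Binary.BagAndSetEquality using (∼bag⇒↭)
open import Data.List.Relation.Binary.Permutation.Propositional using (_↭_; prep; swap; ↭-refl; ↭-sym; ↭-trans; ↭-reflexive; ↭⇒↭ₛ; module PermutationReasoning)
open import Data.List.Relation.Binary.Permutation.Propositional.Properties using (All-resp-↭; ∈-resp-↭; drop-mid; filter-↭; ↭-length; ↭-map-inv; ↭-empty-inv; ¬x∷xs↭[]; shift; shifts; ++⁺; ++⁺ˡ; ++-comm) renaming (map⁺ to ↭-map)
import Data.List.Relation.Binary.Permutation.Setoid.Properties as SetoidPermutation
open import Data.List.Relation.Binary.Pointwise as Pointwise using (Pointwise; []; _∷_)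
open import Data.List.Relation.Unary.All as All using (All; []; _∷_)
import Data.List.Relation.Unary.All.Properties as All
open import Data.List.Relation.Unary.AllPairs as AllPairs using (AllPairs; []; _∷_)
import Data.List.Relation.Unary.AllPairs.Properties as AllPairs
open import Data.List.Relation.Unary.Any as Any using (here; there)
open import Data.List.Relation.Unary.Unique.Propositional using (Unique)
import Data.List.Relation.Unary.Unique.Propositional.Properties as Unique
open import Data.Nat using (ℕ; zero; suc; _+_; _*_; _∸_; _/_; _%_; _≤_; _<_; _>_; z≤n; s≤s; s≤s⁻¹; _<?_; ⌊_/2⌋)
open import Data.Nat.DivMod using (m≡m%n+[m/n]*n; m%n<n; m/n*n≤m)
open import Data.Nat.ListAction using (sum)
open import Data.Nat.Properties
open import Data.Product using (_×_; _,_; proj₁; proj₂; ∃)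
open import Data.Sum using (_⊎_; inj₁; inj₂)
open import Data.Unit using (⊤; tt)
open import Data.Vec using (Vec; []; _∷_; lookup; tabulate; toList)
open import Data.Vec.Properties as Vec using (tabulate∘lookup; lookup∘tabulate)
open import Function using (_∘_; mk⇔)
open import Relation.Binary using (DecidableEquality; Tri; tri<; tri≈; tri>)
open import Relation.Binary.Construct.Closure.ReflexiveTransitive using (ε; _◅_; _◅◅_)
open import Relation.Binary.PropositionalEquality using (_≡_; _≢_; refl; sym; trans; cong; cong₂; subst; subst₂; setoid; module ≡-Reasoning)
open import Relation.Nullary using (¬_; yes; no; contradiction; does)
open import Relation.Nullary.Construct.Add.Infimum using (⊥₋) renaming ([_] to [_]₋)
open import Relation.Nullary.Decidable using (¬?; dec-true; dec-false)
open import Relation.Unary using (Decidable)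

-- The keys behind `Ldes` involve levels, and these depend on τ, so rearranging a word disturbs
-- them. `colourKey` depends on the poset alone, which makes the descents of different words
-- comparable. The price is that no map between permutations is exhibited: the two statistics are
-- compared only through numbers of lattice points, for all k together.
--
-- The translation is chosen so that the increment along a cover ranges over 0,...,k from an even
-- rank and over 1,...,k+1 from an odd one. Either way it runs once through the residues modulo k+1,
-- so the remainders at the two ends tell whether the quotient rises. Without translation and with
-- modulus k, the increments 0 and k have the same residue; the level must settle this ambiguity,
-- and so it enters the key.
--
-- The common centre comes from a count. If the cyclic word of n+1 letters has r even and r odd
-- runs, the Eulerian factors have total degree n+1-2r. Cutting it before an even run leaves r-1
-- passages from odd to even, each a forced descent, that is a factor X, which raises the degree of
-- symmetry by 2. The sum is n-1.

private variable
  m n : ℕ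
  xs ys : List ℕ
  A B : Set

-- γ-positivity

count : ℕ → List ℕ → ℕ
count i xs = length (filter (_≟ i) xs)

-- The list of the exponents, with multiplicity, of a nonnegative combination of the polynomials
-- Xⁱ (1 + X)ᵐ⁻²ⁱ.
data GammaPositive : ℕ → List ℕ → Set where
  none  : GammaPositive m []
  one   : GammaPositive 0 [ 0 ]
  add   : GammaPositive m xs → GammaPositive m ys → GammaPositive m (xs ++ ys)
  timesX : GammaPositive m xs → GammaPositive (2 + m) (map suc xs)
  times1+X : GammaPositive m xs → GammaPositive (1 + m) (xs ++ map suc xs)
  perm  : GammaPositive m xs → xs ↭ ys → GammaPositive m ys

count-++ : ∀ i xs ys → count i (xs ++ ys) ≡ count i xs + count i ys
count-++ i xs ys = trans (cong length (filter-++ (_≟ i) xs ys)) (length-++ (filter (_≟ i) xs))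

count-↭ : ∀ i → xs ↭ ys → count i xs ≡ count i ys
count-↭ i xs↭ys = ↭-length (filter-↭ (_≟ i) xs↭ys)

count-zero-suc : ∀ xs → count 0 (map suc xs) ≡ 0
count-zero-suc []       = refl
count-zero-suc (x ∷ xs) = count-zero-suc xs

count-suc-suc : ∀ i xs → count (suc i) (map suc xs) ≡ count i xs
count-suc-suc i []       = refl
count-suc-suc i (x ∷ xs) with x ≟ i
... | yes refl rewrite filter-accept (_≟ suc i) {xs = map suc xs} (refl {x = suc x}) | filter-accept (_≟ i)
    {xs = xs} (refl {x = x}) = cong suc (count-suc-suc i xs)
... | no x≢i rewrite filter-reject (_≟ suc i) {xs = map suc xs} (x≢i ∘ suc-injective) | filter-reject (_≟ i)
    {xs = xs} x≢i = count-suc-suc i xs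

bounded : GammaPositive m xs → All (_≤ m) xs
bounded none         = []
bounded one          = z≤n ∷ []
bounded (add p q)    = All.++⁺ (bounded p) (bounded q)
bounded (timesX p)   = All.map⁺ (All.map (m≤n⇒m≤1+n ∘ s≤s) (bounded p))
bounded (times1+X p) = All.++⁺ (All.map m≤n⇒m≤1+n (bounded p)) (All.map⁺ (All.map s≤s (bounded p)))
bounded (perm p σ)   = All-resp-↭ σ (bounded p)

count-beyond : ∀ {i} → All (_≤ m) xs → m < i → count i xs ≡ 0
count-beyond []                   m<i = refl
count-beyond {i = i} (_∷_ {x} {xs} x≤m ps) m<i
  rewrite filter-reject (_≟ i) {xs = xs} (<⇒≢ (≤-<-trans x≤m m<i)) = count-beyond ps m<i

palindromic : GammaPositive m xs → ∀ i j → i + j ≡ m → count i xs ≡ count j xs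
palindromic none i j e = refl
palindromic one zero zero e = refl
palindromic (add {xs = xs} {ys = ys} p q) i j e
  rewrite count-++ i xs ys | count-++ j xs ys = cong₂ _+_ (palindromic p i j e) (palindromic q i j e)
palindromic (timesX {xs = xs} p) zero (suc j) refl
  rewrite count-zero-suc xs | count-suc-suc j xs = sym (count-beyond (bounded p) ≤-refl)
palindromic (timesX {xs = xs} p) (suc i) zero e
  rewrite count-zero-suc xs | count-suc-suc i xs
  = count-beyond (bounded p) (≤-reflexive (sym (trans (sym (+-identityʳ i)) (suc-injective e))))
palindromic (timesX {xs = xs} p) (suc i) (suc j) e
  rewrite count-suc-suc i xs | count-suc-suc j xs
  = palindromic p i j (suc-injective (trans (sym (+-suc i j)) (suc-injective e)))
palindromic (times1+X {xs = xs} p) zero (suc j) refl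
  rewrite count-++ 0 xs (map suc xs) | count-++ (suc j) xs (map suc xs) | count-zero-suc xs | count-suc-suc j xs
        | count-beyond (bounded p) (≤-refl {suc j}) = trans (+-identityʳ _) (palindromic p 0 j refl)
palindromic (times1+X {m = m} {xs = xs} p) (suc i) zero e
  rewrite trans (sym (+-identityʳ i)) (suc-injective e)
        | count-++ 0 xs (map suc xs) | count-++ (suc m) xs (map suc xs) | count-zero-suc xs | count-suc-suc m xs
        | count-beyond (bounded p) (≤-refl {suc m}) = trans (palindromic p m 0 (+-identityʳ m))
            (sym (+-identityʳ _))
palindromic (times1+X {m = m} {xs = xs} p) (suc i) (suc j) e
  rewrite count-++ (suc i) xs (map suc xs) | count-++ (suc j) xs (map suc xs) | count-suc-suc i xs |
      count-suc-suc j xs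
  = trans (cong₂ _+_ (palindromic p (suc i) j (trans (sym (+-suc i j)) (suc-injective e)))
      (palindromic p i (suc j) (suc-injective e)))
            (+-comm (count j xs) _)
palindromic (perm p σ) i j e = trans (sym (count-↭ i σ)) (trans (palindromic p i j e) (count-↭ j σ))

unimodal : GammaPositive m xs → ∀ i → i + suc i ≤ m → count i xs ≤ count (suc i) xs
unimodal none i h = z≤n
unimodal one i h = contradiction (≤-trans (≤-reflexive (sym (+-suc i i))) h) λ ()
unimodal (add {xs = xs} {ys = ys} p q) i h
  rewrite count-++ i xs ys | count-++ (suc i) xs ys = +-mono-≤ (unimodal p i h) (unimodal q i h)
unimodal (timesX {xs = xs} p) zero h rewrite count-zero-suc xs = z≤n
unimodal (timesX {xs = xs} p) (suc i) h
  rewrite count-suc-suc i xs | count-suc-suc (suc i) xs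
  = unimodal p i (s≤s⁻¹ (≤-trans (≤-reflexive (sym (+-suc i (suc i)))) (s≤s⁻¹ h)))
unimodal (times1+X {xs = xs} p) zero h
  rewrite count-++ 0 xs (map suc xs) | count-++ 1 xs (map suc xs) | count-zero-suc xs | count-suc-suc 0 xs
        | +-identityʳ (count 0 xs) = m≤n+m (count 0 xs) (count 1 xs)
unimodal (times1+X {m = m} {xs = xs} p) (suc i) h
  rewrite count-++ (suc i) xs (map suc xs) | count-++ (2 + i) xs (map suc xs) | count-suc-suc i xs |
      count-suc-suc (suc i) xs
        | +-comm (count (suc i) xs) (count i xs)
  = +-monoˡ-≤ (count (suc i) xs) middle
  where
  i+2+i≤m : i + suc (suc i) ≤ m
  i+2+i≤m = s≤s⁻¹ h
  -- The coefficient at `suc i` is common to both sides. What remains are mirror images if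
  -- `i + (2 + i)` equals `m`; otherwise both single steps from `i` to `2 + i` lie in the rising
  -- half.
  middle : count i xs ≤ count (2 + i) xs
  middle with i + suc (suc i) ≟ m
  ... | yes e = ≤-reflexive (palindromic p i (2 + i) e)
  ... | no ne = ≤-trans (unimodal p i (≤-trans (+-monoʳ-≤ i (n≤1+n _)) i+2+i≤m))
      (unimodal p (suc i) (≤∧≢⇒< i+2+i≤m ne))
unimodal (perm p σ) i h rewrite sym (count-↭ i σ) | sym (count-↭ (suc i) σ) = unimodal p i h

infixl 7 _⊗_
-- Multiplication of polynomials that are given by their exponents with multiplicity.
_⊗_ : List ℕ → List ℕ → List ℕ
xs ⊗ ys = concatMap (λ x → map (x +_) ys) xs

concatMap-↭ : ∀ {A B : Set} (f : A → List B) {xs ys} → xs ↭ ys → concatMap f xs ↭ concatMap f ys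
concatMap-↭ f _↭_.refl        = ↭-refl
concatMap-↭ f (prep x p)      = ++⁺ˡ (f x) (concatMap-↭ f p)
concatMap-↭ f (swap x y p) =
  ↭-trans (shifts (f x) (f y)) (++⁺ˡ (f y) (++⁺ˡ (f x) (concatMap-↭ f p)))
concatMap-↭ f (_↭_.trans p q) = ↭-trans (concatMap-↭ f p) (concatMap-↭ f q)

suc-⊗ : ∀ xs ys → map suc xs ⊗ ys ≡ map suc (xs ⊗ ys)
suc-⊗ [] ys = refl
suc-⊗ (x ∷ xs) ys = trans (cong₂ _++_ (map-∘ ys) (suc-⊗ xs ys)) (sym (map-++ suc (map (x +_) ys) (xs ⊗ ys)))

-- Multiplication by a fixed right factor commutes with X and with 1 + X, so a derivation for the
-- left factor carries over rule by rule.
⊗-gammaPositive : GammaPositive m xs → GammaPositive n ys → GammaPositive (m + n) (xs ⊗ ys)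
⊗-gammaPositive none q = none
⊗-gammaPositive {ys = ys} one q = perm q (↭-reflexive (sym (trans (++-identityʳ _) (map-id ys))))
⊗-gammaPositive {ys = ys} (add {xs = xs} {ys = xs′} p p′) q =
  perm (add (⊗-gammaPositive p q) (⊗-gammaPositive p′ q)) (↭-reflexive (sym (concatMap-++ _ xs xs′)))
⊗-gammaPositive {ys = ys} (timesX {xs = xs} p) q =
  perm (timesX (⊗-gammaPositive p q)) (↭-reflexive (sym (suc-⊗ xs ys)))
⊗-gammaPositive {ys = ys} (times1+X {xs = xs} p) q =
  perm (times1+X (⊗-gammaPositive p q))
       (↭-reflexive (sym (trans (concatMap-++ _ xs (map suc xs)) (cong (xs ⊗ ys ++_) (suc-⊗ xs ys)))))
⊗-gammaPositive (perm p σ) q = perm (⊗-gammaPositive p q) (concatMap-↭ _ σ)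

-- The numbers of descents that arise when a new minimum is inserted at each of the m + 2 places of
-- a word of m + 1 letters with d descents.
insertMin : ℕ → ℕ → List ℕ
insertMin m d = replicate (suc d) d ++ replicate (suc (m ∸ d)) (suc d)

map-insertMin : ∀ m d → map suc (insertMin m d) ≡ replicate (suc d) (suc d) ++ replicate (suc (m ∸ d)) (2 + d)
map-insertMin m d = trans (map-++ suc (replicate (suc d) d) _)
    (cong₂ _++_ (map-replicate suc (suc d) d) (map-replicate suc (suc (m ∸ d)) (suc d)))

insertMin-suc : ∀ {m d} → d ≤ m → insertMin (2 + m) (suc d) ↭ map suc (insertMin m d) ++ (suc d ∷ [ 2 + d ])
insertMin-suc {m} {d} d≤m rewrite +-∸-assoc 1 d≤m = begin
  suc d ∷ r ++ 2 + d ∷ s             ↭⟨ prep _ (++⁺ˡ r (++-comm [ 2 + d ] s)) ⟩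
  suc d ∷ (r ++ (s ++ [ 2 + d ]))    ≡⟨ cong (suc d ∷_) (sym (++-assoc r s _)) ⟩
  suc d ∷ ((r ++ s) ++ [ 2 + d ])    ↭⟨ shift (suc d) (r ++ s) [ 2 + d ] ⟨
  (r ++ s) ++ suc d ∷ [ 2 + d ]      ≡⟨ cong (_++ suc d ∷ [ 2 + d ]) (sym (map-insertMin m d)) ⟩
  map suc (insertMin m d) ++ suc d ∷ [ 2 + d ] ∎
  where
  open PermutationReasoning
  r = replicate (suc d) (suc d)
  s = replicate (suc (m ∸ d)) (2 + d)

insertMin-low : ∀ {m d} → d ≤ m → insertMin (1 + m) d ↭ insertMin m d ++ [ suc d ]
insertMin-low {m} {d} d≤m rewrite +-∸-assoc 1 d≤m =
  ↭-trans (++⁺ˡ r (++-comm [ suc d ] s)) (↭-reflexive (sym (++-assoc r s [ suc d ])))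
  where
  r = replicate (suc d) d
  s = replicate (suc (m ∸ d)) (suc d)

insertMin-high : ∀ {m d} → d ≤ m → insertMin (1 + m) (suc d) ↭ map suc (insertMin m d) ++ [ suc d ]
insertMin-high {m} {d} d≤m =
  ↭-trans (↭-reflexive (cong (suc d ∷_) (sym (map-insertMin m d))))
      (++-comm [ suc d ] (map suc (insertMin m d)))

concatMap-split : ∀ {A : Set} {f g h : A → List ℕ} {xs} →
  All (λ x → f x ↭ g x ++ h x) xs → concatMap f xs ↭ concatMap g xs ++ concatMap h xs
concatMap-split [] = ↭-refl
concatMap-split {f = f} {g} {h} {x ∷ xs} (p ∷ ps) = begin
  f x ++ concatMap f xs                          ↭⟨ ++⁺ p (concatMap-split ps) ⟩
  (g x ++ h x) ++ (G ++ H)                       ≡⟨ ++-assoc (g x) (h x) (G ++ H) ⟩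
  g x ++ (h x ++ (G ++ H))                       ↭⟨ ++⁺ˡ (g x) (shifts (h x) G) ⟩
  g x ++ (G ++ (h x ++ H))                       ≡⟨ ++-assoc (g x) G _ ⟨
  (g x ++ G) ++ (h x ++ H) ∎
  where
  open PermutationReasoning
  G = concatMap g xs
  H = concatMap h xs

concatMap-singleton : ∀ (xs : List ℕ) → concatMap (λ d → [ suc d ]) xs ≡ map suc xs
concatMap-singleton []       = refl
concatMap-singleton (x ∷ xs) = cong (suc x ∷_) (concatMap-singleton xs)

-- Let T be the linear operator that `insertMin m` defines in degree m. Then T(Xp) = X T(p) + X(1 +
-- X)p and T((1 + X)p) = (1 + X)T(p) + 2Xp, where T is taken in the degree of its argument. All
-- terms on the right are γ-positive of the required degree by induction.
eulerian-step : GammaPositive m xs → GammaPositive (1 + m) (concatMap (insertMin m) xs)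
eulerian-step none = none
eulerian-step one = times1+X one
eulerian-step (add {xs = xs} {ys = ys} p q) =
  perm (add (eulerian-step p) (eulerian-step q)) (↭-reflexive (sym (concatMap-++ _ xs ys)))
eulerian-step (timesX {m = m} {xs = xs} p) =
  perm (add (timesX (eulerian-step p)) (timesX (times1+X p))) (↭-sym (begin
    concatMap (insertMin (2 + m)) (map suc xs)
      ≡⟨ concatMap-map (insertMin (2 + m)) suc xs ⟩
    concatMap (insertMin (2 + m) ∘ suc) xs
      ↭⟨ concatMap-split (All.map insertMin-suc (bounded p)) ⟩
    concatMap (map suc ∘ insertMin m) xs ++ concatMap (λ d → suc d ∷ [ 2 + d ]) xs
      ↭⟨ ++⁺ (↭-reflexive (sym (map-concatMap suc (insertMin m) xs)))
             (concatMap-split {g = λ d → [ suc d ]} {h = λ d → [ 2 + d ]} (All.universal (λ _ → ↭-refl) xs)) ⟩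
    map suc (concatMap (insertMin m) xs) ++ (concatMap (λ d → [ suc d ]) xs ++ concatMap (λ d → [ 2 + d ]) xs)
      ≡⟨ cong (λ l → map suc (concatMap (insertMin m) xs) ++ l)
           (cong₂ _++_ (concatMap-singleton xs)
             (trans (trans (sym (concatMap-map (λ d → [ suc d ]) suc xs)) (concatMap-singleton (map suc xs)))
                 refl)) ⟩
    map suc (concatMap (insertMin m) xs) ++ (map suc xs ++ map suc (map suc xs))
      ≡⟨ cong (map suc (concatMap (insertMin m) xs) ++_) (sym (map-++ suc xs (map suc xs))) ⟩
    map suc (concatMap (insertMin m) xs) ++ map suc (xs ++ map suc xs) ∎))
  where open PermutationReasoning
eulerian-step (times1+X {m = m} {xs = xs} p) =
  perm (add (times1+X (eulerian-step p)) (add (timesX p) (timesX p))) (↭-sym (begin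
    concatMap (insertMin (1 + m)) (xs ++ map suc xs)
      ≡⟨ concatMap-++ (insertMin (1 + m)) xs (map suc xs) ⟩
    concatMap (insertMin (1 + m)) xs ++ concatMap (insertMin (1 + m)) (map suc xs)
      ≡⟨ cong (concatMap (insertMin (1 + m)) xs ++_) (concatMap-map (insertMin (1 + m)) suc xs) ⟩
    concatMap (insertMin (1 + m)) xs ++ concatMap (insertMin (1 + m) ∘ suc) xs
      ↭⟨ ++⁺ (concatMap-split (All.map insertMin-low (bounded p)))
          (concatMap-split (All.map insertMin-high (bounded p))) ⟩
    (concatMap (insertMin m) xs ++ S) ++ (concatMap (map suc ∘ insertMin m) xs ++ S)
      ≡⟨ cong₂ (λ s t → (C ++ s) ++ (t ++ s)) (concatMap-singleton xs)
          (sym (map-concatMap suc (insertMin m) xs)) ⟩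
    (C ++ map suc xs) ++ (map suc C ++ map suc xs)
      ≡⟨ ++-assoc C (map suc xs) _ ⟩
    C ++ (map suc xs ++ (map suc C ++ map suc xs))
      ↭⟨ ++⁺ˡ C (shifts (map suc xs) (map suc C)) ⟩
    C ++ (map suc C ++ (map suc xs ++ map suc xs))
      ≡⟨ ++-assoc C (map suc C) _ ⟨
    (C ++ map suc C) ++ (map suc xs ++ map suc xs) ∎))
  where
  open PermutationReasoning
  C = concatMap (insertMin m) xs
  S = concatMap (λ d → [ suc d ]) xs
eulerian-step (perm p σ) = perm (eulerian-step p) (concatMap-↭ _ σ)

-- Permutations of a list

concatMap-unique : ∀ (f : A → List B) {xs} →
  (∀ {x} → x ∈ xs → Unique (f x)) →
  (∀ {x y w} → x ∈ xs → y ∈ xs → w ∈ f x → w ∈ f y → x ≡ y) →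
  Unique xs → Unique (concatMap f xs)
concatMap-unique f uf inj [] = []
concatMap-unique f {x ∷ xs} uf inj (x∉ ∷ u) =
  Unique.++⁺ (uf (here refl)) (concatMap-unique f (uf ∘ there) (λ p q → inj (there p) (there q)) u) disjoint
  where
  disjoint : ∀ {w} → ¬ (w ∈ f x × w ∈ concatMap f xs)
  disjoint (p , q) with find (∈-concatMap⁻ f {xs = xs} q)
  ... | y , y∈ , w∈ = All.lookup x∉ y∈ (inj (here refl) (there y∈) p w∈)

unique∧⇔⇒↭ : ∀ {xs ys : List A} → Unique xs → Unique ys →
  (∀ {x} → x ∈ xs → x ∈ ys) → (∀ {x} → x ∈ ys → x ∈ xs) → xs ↭ ys
unique∧⇔⇒↭ u v f g = ∼bag⇒↭ (unique∧set⇒bag u v (mk⇔ f g))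

Unique-resp-↭ : ∀ {xs ys : List A} → xs ↭ ys → Unique xs → Unique ys
Unique-resp-↭ {A = A} σ = SetoidPermutation.Unique-resp-↭ (setoid A) (↭⇒↭ₛ σ)

insertAll : A → List A → List (List A)
insertAll x []       = [ [ x ] ]
insertAll x (y ∷ ys) = (x ∷ y ∷ ys) ∷ map (y ∷_) (insertAll x ys)

-- The head is inserted last, so on a sorted list every insertion is that of a new minimum, as the
-- Eulerian recurrence requires.
perms : List A → List (List A)
perms []       = [ [] ]
perms (x ∷ xs) = concatMap (insertAll x) (perms xs)

insertAll-↭ : ∀ (x : A) ys {w} → w ∈ insertAll x ys → w ↭ x ∷ ys
insertAll-↭ x [] (here refl) = ↭-refl
insertAll-↭ x (y ∷ ys) (here refl) = ↭-refl
insertAll-↭ x (y ∷ ys) (there p) with ∈-map⁻ (y ∷_) p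
... | w , w∈ , refl = ↭-trans (prep y (insertAll-↭ x ys w∈)) (swap y x ↭-refl)

∈-insertAll : ∀ (x : A) p q → p ++ x ∷ q ∈ insertAll x (p ++ q)
∈-insertAll x [] []      = here refl
∈-insertAll x [] (y ∷ q) = here refl
∈-insertAll x (y ∷ p) q  = there (∈-map⁺ (y ∷_) (∈-insertAll x p q))

-- Deleting the fresh letter recovers the shorter word.
insertAll-injective : ∀ {x : A} {ys zs w} → x ∉ ys → x ∉ zs → w ∈ insertAll x ys → w ∈ insertAll x zs → ys ≡ zs
insertAll-injective {ys = []} {[]} _ _ _ _ = refl
insertAll-injective {ys = []} {z ∷ zs} _ x∉ (here refl) (there q) with ∈-map⁻ (z ∷_) q
... | _ , _ , refl = contradiction (here refl) x∉
insertAll-injective {ys = y ∷ ys} {[]} x∉ _ (there p) (here refl) with ∈-map⁻ (y ∷_) p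
... | _ , _ , refl = contradiction (here refl) x∉
insertAll-injective {ys = y ∷ ys} {z ∷ zs} _ _ (here refl) (here refl) = refl
insertAll-injective {ys = y ∷ ys} {z ∷ zs} _ x∉ (here refl) (there q) with ∈-map⁻ (z ∷_) q
... | _ , _ , refl = contradiction (here refl) x∉
insertAll-injective {ys = y ∷ ys} {z ∷ zs} x∉ _ (there p) (here refl) with ∈-map⁻ (y ∷_) p
... | _ , _ , refl = contradiction (here refl) x∉
insertAll-injective {ys = y ∷ ys} {z ∷ zs} x∉ x∉′ (there p) (there q) with ∈-map⁻ (y ∷_) p | ∈-map⁻ (z ∷_) q
... | _ , p′ , refl | _ , q′ , refl = cong (y ∷_) (insertAll-injective (x∉ ∘ there) (x∉′ ∘ there) p′ q′)

insertAll-unique : ∀ {x : A} {ys} → x ∉ ys → Unique (insertAll x ys)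
insertAll-unique {ys = []} _ = [] ∷ []
insertAll-unique {x = x} {ys = y ∷ ys} x∉ =
  All.¬Any⇒All¬ _ (λ p → x∉ (here (starts-with p)))
  ∷ Unique.map⁺ ∷-injectiveʳ (insertAll-unique (x∉ ∘ there))
  where
  starts-with : (x ∷ y ∷ ys) ∈ map (y ∷_) (insertAll x ys) → x ≡ y
  starts-with p with ∈-map⁻ (y ∷_) p
  ... | _ , _ , refl = refl

∈-perms⇒↭ : ∀ (xs : List A) {w} → w ∈ perms xs → w ↭ xs
∈-perms⇒↭ [] (here refl) = ↭-refl
∈-perms⇒↭ (x ∷ xs) p with find (∈-concatMap⁻ (insertAll x) {xs = perms xs} p)
... | v , v∈ , w∈ = ↭-trans (insertAll-↭ x v w∈) (prep x (∈-perms⇒↭ xs v∈))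

↭⇒∈-perms : ∀ (xs : List A) {w} → w ↭ xs → w ∈ perms xs
↭⇒∈-perms [] σ = here (↭-empty-inv σ)
↭⇒∈-perms (x ∷ xs) σ with ∈-∃++ (∈-resp-↭ (↭-sym σ) (here refl))
... | p , q , refl =
  ∈-concatMap⁺ (insertAll x) (lose (↭⇒∈-perms xs (drop-mid p [] σ)) (∈-insertAll x p q))

perms-unique : ∀ {xs : List A} → Unique xs → Unique (perms xs)
perms-unique [] = [] ∷ []
perms-unique {xs = x ∷ xs} (x∉ ∷ u) =
  concatMap-unique (insertAll x) (insertAll-unique ∘ fresh)
    (λ v∈ v∈′ → insertAll-injective (fresh v∈) (fresh v∈′)) (perms-unique u)
  where
  fresh : ∀ {v} → v ∈ perms xs → x ∉ v
  fresh v∈ x∈ = All.lookup x∉ (∈-resp-↭ (∈-perms⇒↭ xs v∈) x∈) refl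

-- Descents of words and Eulerian polynomials

module Descents {A : Set} (κ : A → ℕ) where

  step : A → A → ℕ
  step x y = if does (κ y <? κ x) then 1 else 0

  step-down : ∀ {x y} → κ y < κ x → step x y ≡ 1
  step-down {x} {y} y<x rewrite dec-true (κ y <? κ x) y<x = refl

  step-up : ∀ {x y} → κ x ≤ κ y → step x y ≡ 0
  step-up {x} {y} x≤y rewrite dec-false (κ y <? κ x) (≤⇒≯ x≤y) = refl

  step≤1 : ∀ x y → step x y ≤ 1
  step≤1 x y with does (κ y <? κ x)
  ... | true  = ≤-refl
  ... | false = z≤n

  desFrom : A → List A → ℕ
  desFrom x []       = 0
  desFrom x (y ∷ ys) = step x y + desFrom y ys

  descents : List A → ℕ
  descents []       = 0
  descents (x ∷ xs) = desFrom x xs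

  desFrom≤length : ∀ x ys → desFrom x ys ≤ length ys
  desFrom≤length x []       = z≤n
  desFrom≤length x (y ∷ ys) = +-mono-≤ (step≤1 x y) (desFrom≤length y ys)

  -- A new minimum between two letters creates a descent followed by an ascent. So the number is
  -- kept at the old descents and grows by one at the ascents and at the end. The place in front of
  -- `y` is left to `map-des-insertAll`.
  map-desFrom-insertAll : ∀ {x} y w → All (λ z → κ x < κ z) (y ∷ w) →
    map (desFrom y) (insertAll x w) ↭
    replicate (desFrom y w) (desFrom y w) ++ replicate (suc (length w ∸ desFrom y w)) (suc (desFrom y w))
  map-desFrom-insertAll {x} y [] (x<y ∷ []) rewrite step-down x<y = ↭-refl
  map-desFrom-insertAll {x} y (z ∷ w) (x<y ∷ ps@(x<z ∷ _))
    rewrite step-down x<y | step-up (<⇒≤ x<z)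
          | sym (map-∘ {g = desFrom y} {f = z ∷_} (insertAll x w))
          | map-∘ {g = step y z +_} {f = desFrom z} (insertAll x w)
    with step y z | step≤1 y z
  ... | suc (suc _) | s≤s ()
  ... | 1 | _ = prep _ (↭-trans (↭-map suc (map-desFrom-insertAll z w ps))
                (↭-reflexive (trans (map-++ suc (replicate d d) _)
                   (cong₂ _++_ (map-replicate suc d d) (map-replicate suc (suc (length w ∸ d)) (suc d))))))
    where d = desFrom z w
  ... | 0 | _ rewrite +-∸-assoc 1 (desFrom≤length z w) =
    ↭-trans (prep (suc d) (↭-trans (↭-reflexive (map-id _)) (map-desFrom-insertAll z w ps)))
            (↭-sym (shift (suc d) (replicate d d) _))
    where d = desFrom z w

  map-des-insertAll : ∀ {x} w {m} → length w ≡ suc m → All (λ z → κ x < κ z) w →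
    map descents (insertAll x w) ↭ insertMin m (descents w)
  map-des-insertAll {x} (y ∷ w) refl ps@(x<y ∷ _)
    rewrite step-up (<⇒≤ x<y) | sym (map-∘ {g = descents} {f = y ∷_} (insertAll x w))
    = prep _ (map-desFrom-insertAll y w ps)

  map-des-concatMap : ∀ {f : List A → List (List A)} {h : ℕ → List ℕ} {ws} →
    (∀ {w} → w ∈ ws → map descents (f w) ↭ h (descents w)) →
    map descents (concatMap f ws) ↭ concatMap h (map descents ws)
  map-des-concatMap {ws = []} p = ↭-refl
  map-des-concatMap {f} {h} {w ∷ ws} p =
    ↭-trans (↭-reflexive (map-++ descents (f w) (concatMap f ws)))
            (++⁺ (p (here refl)) (map-des-concatMap (p ∘ there)))

  Sorted : List A → Set
  Sorted = AllPairs (λ x y → κ x < κ y)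

  perms-gammaPositive : ∀ x xs → Sorted (x ∷ xs) → GammaPositive (length xs) (map descents (perms (x ∷ xs)))
  perms-gammaPositive x [] _ = one
  perms-gammaPositive x (y ∷ xs) (x< ∷ s) =
    perm (eulerian-step (perms-gammaPositive y xs s)) (↭-sym (map-des-concatMap λ {w} w∈ →
      map-des-insertAll w (↭-length (∈-perms⇒↭ (y ∷ xs) w∈)) (All-resp-↭ (↭-sym (∈-perms⇒↭ (y ∷ xs) w∈)) x<)))

  insertSorted : ∀ x {ys} → Sorted ys → All (λ y → κ x ≢ κ y) ys → ∃ λ zs → Sorted zs × zs ↭ x ∷ ys
  insertSorted x [] _ = [ x ] , [] ∷ [] , ↭-refl
  insertSorted x {y ∷ ys} (y< ∷ s) (x≢y ∷ x≢) with <-cmp (κ x) (κ y)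
  ... | tri< x<y _ _ = x ∷ y ∷ ys , (x<y ∷ All.map (<-trans x<y) y<) ∷ y< ∷ s , ↭-refl
  ... | tri≈ _ x≡y _ = contradiction x≡y x≢y
  ... | tri> _ _ y<x with insertSorted x s x≢
  ... | zs , s′ , σ = y ∷ zs , All-resp-↭ (↭-sym σ) (y<x ∷ y<) ∷ s′ , ↭-trans (prep y σ) (swap y x ↭-refl)

  sort : ∀ xs → AllPairs (λ x y → κ x ≢ κ y) xs → ∃ λ zs → Sorted zs × zs ↭ xs
  sort [] [] = [] , [] , ↭-refl
  sort (x ∷ xs) (x≢ ∷ u) with sort xs u
  ... | zs , s , σ with insertSorted x s (All-resp-↭ (↭-sym σ) x≢)
  ... | ws , s′ , σ′ = ws , s′ , ↭-trans σ′ (prep x σ)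

-- Runs of letters of equal colour

-- All that descent-compatibility sees of a word is, for each cover, which of its ends comes first.
data Before {A : Set} (x y : A) : List A → Set where
  here  : ∀ {zs} → y ∈ zs → Before x y (x ∷ zs)
  there : ∀ {z zs} → Before x y zs → Before x y (z ∷ zs)

module _ {A : Set} where

  Unique-++⁻ : ∀ (xs : List A) {ys} → Unique (xs ++ ys) → Unique xs × Unique ys
  Unique-++⁻ []       u       = [] , u
  Unique-++⁻ (x ∷ xs) (p ∷ u) with Unique-++⁻ xs u
  ... | v , w = (All.++⁻ˡ xs p ∷ v) , w

  ++-injective : ∀ (xs xs′ : List A) {ys ys′} → length xs ≡ length xs′ → xs ++ ys ≡ xs′ ++ ys′ → xs ≡ xs′ ×
      ys ≡ ys′
  ++-injective [] [] _ e = refl , e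
  ++-injective (x ∷ xs) (x′ ∷ xs′) l e with ++-injective xs xs′ (suc-injective l) (∷-injectiveʳ e) |
      ∷-injectiveˡ e
  ... | refl , e′ | refl = refl , e′

  concat-↭ : ∀ {bs cs : List (List A)} → Pointwise _↭_ bs cs → concat bs ↭ concat cs
  concat-↭ []       = ↭-refl
  concat-↭ (σ ∷ ps) = ++⁺ σ (concat-↭ ps)

  Before-∈ : ∀ {x y : A} {zs} → Before x y zs → x ∈ zs × y ∈ zs
  Before-∈ (here y∈)  = here refl , there y∈
  Before-∈ (there p)  = there (proj₁ (Before-∈ p)) , there (proj₂ (Before-∈ p))

  Before-++⁺ˡ : ∀ {x y : A} {bs} rs → Before x y bs → Before x y (bs ++ rs)
  Before-++⁺ˡ rs (here y∈)  = here (∈-++⁺ˡ y∈)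
  Before-++⁺ˡ rs (there p)  = there (Before-++⁺ˡ rs p)

  Before-++⁺ʳ : ∀ {x y : A} bs {rs} → Before x y rs → Before x y (bs ++ rs)
  Before-++⁺ʳ []       p = p
  Before-++⁺ʳ (_ ∷ bs) p = there (Before-++⁺ʳ bs p)

  Before-across : ∀ {x y : A} {bs rs} → x ∈ bs → y ∈ rs → Before x y (bs ++ rs)
  Before-across {bs = _ ∷ bs} (here refl) y∈ = here (∈-++⁺ʳ bs y∈)
  Before-across (there x∈) y∈ = there (Before-across x∈ y∈)

  Before-++⁻ : ∀ {x y : A} bs {rs} → Before x y (bs ++ rs) → Before x y bs ⊎ (x ∈ bs × y ∈ rs) ⊎ Before x y rs
  Before-++⁻ [] p = inj₂ (inj₂ p)
  Before-++⁻ (b ∷ bs) (here y∈) with ∈-++⁻ bs y∈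
  ... | inj₁ y∈bs = inj₁ (here y∈bs)
  ... | inj₂ y∈rs = inj₂ (inj₁ (here refl , y∈rs))
  Before-++⁻ (b ∷ bs) (there p) with Before-++⁻ bs p
  ... | inj₁ q = inj₁ (there q)
  ... | inj₂ (inj₁ (x∈ , y∈)) = inj₂ (inj₁ (there x∈ , y∈))
  ... | inj₂ (inj₂ q) = inj₂ (inj₂ q)

module Runs {A : Set} (_≟_ : DecidableEquality A) (κ : A → ℕ) (κ-injective : ∀ {x y} → κ x ≡ κ y → x ≡ y)
            (colour : A → Bool) (κ-colour : ∀ {x y} → colour x ≡ false → colour y ≡ true → κ x < κ y) where

  open Descents κ

  -- The last run is required to have colour `true` because cyclic words will be cut between a
  -- `true` run and the `false` run that follows it.
  data Alternating : Bool → List (List A) → Set where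
    last : ∀ {x b} → All (λ y → colour y ≡ true) (x ∷ b) → Alternating true ((x ∷ b) ∷ [])
    next : ∀ {γ x b bs} → All (λ y → colour y ≡ γ) (x ∷ b) → Alternating (not γ) bs → Alternating γ
        ((x ∷ b) ∷ bs)

  data EndsHigh : List A → Set where
    here  : ∀ {x} → colour x ≡ true → EndsHigh (x ∷ [])
    there : ∀ {x xs} → EndsHigh xs → EndsHigh (x ∷ xs)

  runs : ∀ {x w} → EndsHigh (x ∷ w) → ∃ λ bs → Alternating (colour x) bs × concat bs ≡ x ∷ w
  runs {x} (here c) = ((x ∷ []) ∷ []) , subst (λ γ → Alternating γ _) (sym c) (last (c ∷ [])) , refl
  runs {x} {y ∷ w} (there e) with runs e | colour x ≟ᵇ colour y
  ... | (b ∷ bs) , p , q | no ne = ((x ∷ []) ∷ b ∷ bs) , next (refl ∷ [])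
      (subst (λ γ → Alternating γ (b ∷ bs)) (flip-≢ ne) p) , cong (x ∷_) q
    where
    flip-≢ : ∀ {γ δ} → γ ≢ δ → δ ≡ not γ
    flip-≢ {false} {false} ne = contradiction refl ne
    flip-≢ {false} {true}  ne = refl
    flip-≢ {true}  {false} ne = refl
    flip-≢ {true}  {true}  ne = contradiction refl ne
  ... | bs , p , q | yes e with extend (sym e) p
    where
    extend : ∀ {γ bs} → γ ≡ colour x → Alternating γ bs → ∃ λ cs → Alternating (colour x) cs × concat cs ≡ x
        ∷ concat bs
    extend e (last ps) = (_ ∷ []) , subst (λ γ → Alternating γ _) e (last (sym e ∷ ps)) , refl
    extend refl (next ps r) = (_ ∷ _) , next (refl ∷ ps) r , refl
  ... | cs , p′ , q′ = cs , p′ , trans q′ (cong (x ∷_) q)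

  data NotStarting (γ : Bool) : List A → Set where
    []  : NotStarting γ []
    ≢∷_ : ∀ {x xs} → colour x ≢ γ → NotStarting γ (x ∷ xs)

  not-≢ : ∀ γ → not γ ≢ γ
  not-≢ true  ()
  not-≢ false ()

  alternating-head : ∀ {γ bs} → Alternating γ bs → ∃ λ x → ∃ λ xs → concat bs ≡ x ∷ xs × colour x ≡ γ
  alternating-head (last (c ∷ _))   = _ , _ , refl , c
  alternating-head (next (c ∷ _) _) = _ , _ , refl , c

  alternating-notStarting : ∀ {γ bs} → Alternating (not γ) bs → NotStarting γ (concat bs)
  alternating-notStarting {γ} p with alternating-head p
  ... | x , xs , e , c = subst (NotStarting γ) (sym e) (≢∷ λ c′ → not-≢ γ (trans (sym c) c′))

  split-unique : ∀ {γ b b′ r r′} → All (λ y → colour y ≡ γ) b → All (λ y → colour y ≡ γ) b′ →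
    NotStarting γ r → NotStarting γ r′ → b ++ r ≡ b′ ++ r′ → b ≡ b′ × r ≡ r′
  split-unique [] [] _ _ e = refl , e
  split-unique [] (c ∷ _) (≢∷ ne) _ refl = contradiction c ne
  split-unique (c ∷ _) [] _ (≢∷ ne) refl = contradiction c ne
  split-unique (_ ∷ ps) (_ ∷ ps′) n n′ e with split-unique ps ps′ n n′ (∷-injectiveʳ e) | ∷-injectiveˡ e
  ... | refl , e′ | refl = refl , e′

  -- A run stops exactly where the colour changes, so the word determines its blocks. Hence a word
  -- belongs to only one run class.
  alternating-unique : ∀ {γ δ bs cs} → Alternating γ bs → Alternating δ cs → concat bs ≡ concat cs → bs ≡ cs
  alternating-unique {γ} {δ} p q e with alternating-head p | alternating-head q
  ... | _ , _ , f , c | _ , _ , f′ , c′ with ∷-injectiveˡ (trans (sym f) (trans e f′))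
  ... | refl with trans (sym c) c′
  ... | refl = go p q e
    where
    go : ∀ {γ bs cs} → Alternating γ bs → Alternating γ cs → concat bs ≡ concat cs → bs ≡ cs
    go (last ps) (last ps′) e = cong (_∷ []) (proj₁ (split-unique ps ps′ [] [] e))
    go (last ps) (next ps′ q) e with split-unique ps ps′ [] (alternating-notStarting q) e | alternating-head q
    ... | _ , e′ | _ , _ , f , _ with trans e′ f
    ... | ()
    go (next ps p) (last ps′) e with split-unique ps ps′ (alternating-notStarting p) [] e | alternating-head p
    ... | _ , e′ | _ , _ , f , _ with trans (sym e′) f
    ... | ()
    go (next ps p) (next ps′ q) e with split-unique ps ps′ (alternating-notStarting p)
        (alternating-notStarting q) e
    ... | refl , e′ = cong (_ ∷_) (go p q e′)

  alternating-resp : ∀ {γ bs cs} → Alternating γ bs → Pointwise _↭_ bs cs → Alternating γ cs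
  alternating-resp (last ps) (_∷_ {y = []} σ []) = contradiction σ ¬x∷xs↭[]
  alternating-resp (last ps) (_∷_ {y = _ ∷ _} σ []) = last (All-resp-↭ σ ps)
  alternating-resp (next ps p) (_∷_ {y = []} σ σs) = contradiction σ ¬x∷xs↭[]
  alternating-resp (next ps p) (_∷_ {y = _ ∷ _} σ σs) = next (All-resp-↭ σ ps) (alternating-resp p σs)

  -- Letters of different colours lie in different runs, and the order of the runs is left alone.
  Before-resp : ∀ {γ bs cs x y} → Alternating γ bs → Pointwise _↭_ bs cs → colour x ≢ colour y →
    Before x y (concat bs) → Before x y (concat cs)
  Before-resp {x = x} {y} p σs ne = go p σs
    where
    block : ∀ {γ b c r s} → All (λ z → colour z ≡ γ) b → b ↭ c → r ↭ s → (Before x y r → Before x y s) →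
      Before x y (b ++ r) → Before x y (c ++ s)
    block {b = b} {c} ps σ τ f q with Before-++⁻ b q
    ... | inj₁ q′ = contradiction (trans (All.lookup ps (proj₁ (Before-∈ q′)))
        (sym (All.lookup ps (proj₂ (Before-∈ q′))))) ne
    ... | inj₂ (inj₁ (x∈ , y∈)) = Before-across (∈-resp-↭ σ x∈) (∈-resp-↭ τ y∈)
    ... | inj₂ (inj₂ q′) = Before-++⁺ʳ c (f q′)
    go : ∀ {γ bs cs} → Alternating γ bs → Pointwise _↭_ bs cs → Before x y (concat bs) → Before x y (concat cs)
    go (last ps) (σ ∷ []) = block ps σ ↭-refl λ ()
    go (next ps p) (σ ∷ σs) = block ps σ (concat-↭ σs) (go p σs)

  -- The difference between the length of a word and the degree of its class: one for each run, less
  -- two for each junction from `true` to `false`. As the runs alternate and the last is `true`, the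
  -- balance depends only on the first colour.
  excess : Bool → ℕ
  excess true  = 1
  excess false = 2

  junction : Bool → ℕ
  junction true  = 1
  junction false = 0

  -- Every `false` key lies below every `true` key, so the contribution of a junction does not
  -- depend on the arrangement of the letters inside the two runs. This is why the descent
  -- polynomial of a class factors.
  des-++ : ∀ {γ x} b {y r} → All (λ z → colour z ≡ γ) (x ∷ b) → colour y ≡ not γ →
    descents ((x ∷ b) ++ y ∷ r) ≡ descents (x ∷ b) + (junction γ + descents (y ∷ r))
  des-++ {γ} {x} [] {y} {r} (c ∷ []) c′ = cong (_+ desFrom y r) (crossing γ c c′)
    where
    crossing : ∀ γ → colour x ≡ γ → colour y ≡ not γ → step x y ≡ junction γ
    crossing true  c c′ = step-down (κ-colour c′ c)
    crossing false c c′ = step-up (<⇒≤ (κ-colour c c′))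
  des-++ {x = x} (z ∷ b) (_ ∷ ps) c′ = trans (cong (step x z +_) (des-++ b ps c′))
      (sym (+-assoc (step x z) _ _))

  -- The field `size` ties the degree to the length of the word and the first colour alone, so that
  -- classes with different numbers of runs get the same centre.
  record Class (γ : Bool) (bs : List (List A)) : Set where
    field
      words    : List (List A)
      unique   : Unique words
      sound    : ∀ {v} → v ∈ words → ∃ λ cs → Pointwise _↭_ bs cs × v ≡ concat cs
      complete : ∀ {cs} → Pointwise _↭_ bs cs → concat cs ∈ words
      degree   : ℕ
      size     : length (concat bs) ≡ excess γ + degree
      gammaPositive : GammaPositive degree (map descents words)

  module _ {x : A} {b : List A} (u : Unique (x ∷ b)) where
    private
      sorted = sort (x ∷ b) (AllPairs.map (λ x≢y e → x≢y (κ-injective e)) u)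

      sortedGamma : ∀ ys → Sorted ys → ys ↭ x ∷ b → GammaPositive (length b) (map descents (perms ys))
      sortedGamma [] _ σ = contradiction (↭-sym σ) ¬x∷xs↭[]
      sortedGamma (y ∷ ys) s σ = subst (λ m → GammaPositive m _) (suc-injective (↭-length σ))
          (perms-gammaPositive y ys s)

    -- Built from the sorted block, because `perms-gammaPositive` needs the letters in increasing
    -- order of their keys.
    blockPerms : List (List A)
    blockPerms = perms (proj₁ sorted)

    blockPerms-unique : Unique blockPerms
    blockPerms-unique = perms-unique (Unique-resp-↭ (↭-sym (proj₂ (proj₂ sorted))) u)

    ∈-blockPerms⇒↭ : ∀ {p} → p ∈ blockPerms → x ∷ b ↭ p
    ∈-blockPerms⇒↭ p∈ = ↭-sym (↭-trans (∈-perms⇒↭ _ p∈) (proj₂ (proj₂ sorted)))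

    ↭⇒∈-blockPerms : ∀ {p} → x ∷ b ↭ p → p ∈ blockPerms
    ↭⇒∈-blockPerms σ = ↭⇒∈-perms _ (↭-trans (↭-sym σ) (↭-sym (proj₂ (proj₂ sorted))))

    blockPerms-gammaPositive : GammaPositive (length b) (map descents blockPerms)
    blockPerms-gammaPositive = sortedGamma _ (proj₁ (proj₂ sorted)) (proj₂ (proj₂ sorted))

  map-des-products : ∀ {f} ps vs →
      (∀ {p v} → p ∈ ps → v ∈ vs → descents (p ++ v) ≡ descents p + f (descents v)) →
    map descents (concatMap (λ p → map (p ++_) vs) ps) ≡ map descents ps ⊗ map f (map descents vs)
  map-des-products [] vs h = refl
  map-des-products {f} (p ∷ ps) vs h = trans (map-++ descents (map (p ++_) vs) _)
    (cong₂ _++_ (row vs (h (here refl))) (map-des-products ps vs (h ∘ there)))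
    where
    row : ∀ vs → (∀ {v} → v ∈ vs → descents (p ++ v) ≡ descents p + f (descents v)) →
      map descents (map (p ++_) vs) ≡ map (descents p +_) (map f (map descents vs))
    row [] h = refl
    row (v ∷ vs) h = cong₂ _∷_ (h (here refl)) (row vs (h ∘ there))

  class : ∀ {γ bs} → Alternating γ bs → Unique (concat bs) → Class γ bs
  class (last {x} {b} ps) u = record
    { words    = blockPerms u′
    ; unique   = blockPerms-unique u′
    ; sound    = λ {v} v∈ → (v ∷ []) , (∈-blockPerms⇒↭ u′ v∈ ∷ []) , sym (++-identityʳ v)
    ; complete = λ { {c ∷ []} (σ ∷ []) → subst (_∈ blockPerms u′) (sym (++-identityʳ c)) (↭⇒∈-blockPerms u′ σ) }
    ; degree   = length b
    ; size     = cong (suc ∘ length) (++-identityʳ b)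
    ; gammaPositive = blockPerms-gammaPositive u′
    }
    where u′ = proj₁ (Unique-++⁻ (x ∷ b) u)
  class {γ} (next {x = x} {b = b} {bs = bs} ps p) u = record
    { words    = concatMap (λ q → map (q ++_) R.words) blockWords
    ; unique   = concatMap-unique _ (λ _ → Unique.map⁺ (++-cancelˡ _ _ _) R.unique) disjoint
        (blockPerms-unique u′)
    ; sound    = sound
    ; complete = λ { {c ∷ cs} (σ ∷ σs) → ∈-concatMap⁺ _
        (lose (↭⇒∈-blockPerms u′ σ) (∈-map⁺ (c ++_) (R.complete σs))) }
    ; degree   = length b + (bonus γ + R.degree)
    ; size     = trans (length-++ (x ∷ b)) (trans (cong (suc (length b) +_) R.size) (sizes γ))
    ; gammaPositive = subst (GammaPositive _) (sym (map-des-products blockWords R.words des-product))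
        (⊗-gammaPositive (blockPerms-gammaPositive u′) (shifted γ R.gammaPositive))
    }
    where
    u′ = proj₁ (Unique-++⁻ (x ∷ b) u)
    blockWords = blockPerms u′
    module R = Class (class p (proj₂ (Unique-++⁻ (x ∷ b) u)))
    -- The descent at a junction from `true` to `false` is a factor X. It moves the centre of
    -- symmetry by one and so counts as 2 in the degree.
    bonus : Bool → ℕ
    bonus true  = 2
    bonus false = 0
    sizes : ∀ γ → suc (length b) + (excess (not γ) + R.degree) ≡ excess γ + (length b + (bonus γ + R.degree))
    sizes true  = refl
    sizes false = cong suc (+-suc (length b) R.degree)
    shifted : ∀ γ {m ds} → GammaPositive m ds → GammaPositive (bonus γ + m) (map (junction γ +_) ds)
    shifted true  g = timesX g
    shifted false {ds = ds} g = perm g (↭-reflexive (sym (map-id ds)))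
    disjoint : ∀ {q q′ w} → q ∈ blockWords → q′ ∈ blockWords → w ∈ map (q ++_) R.words → w ∈ map (q′ ++_)
        R.words → q ≡ q′
    disjoint {q} {q′} q∈ q′∈ w∈ w∈′ with ∈-map⁻ (q ++_) w∈ | ∈-map⁻ (q′ ++_) w∈′
    ... | _ , _ , refl | _ , _ , e =
      proj₁ (++-injective q q′ (trans (sym (↭-length (∈-blockPerms⇒↭ u′ q∈)))
          (↭-length (∈-blockPerms⇒↭ u′ q′∈))) e)
    sound : ∀ {v} → v ∈ concatMap (λ q → map (q ++_) R.words) blockWords → ∃ λ cs → Pointwise _↭_
        ((x ∷ b) ∷ bs) cs × v ≡ concat cs
    sound v∈ with find (∈-concatMap⁻ (λ q → map (q ++_) R.words) {xs = blockWords} v∈)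
    ... | q , q∈ , v∈′ with ∈-map⁻ (q ++_) v∈′
    ... | r , r∈ , refl with R.sound r∈
    ... | cs , σs , refl = (q ∷ cs) , (∈-blockPerms⇒↭ u′ q∈ ∷ σs) , refl
    des-product : ∀ {q v} → q ∈ blockWords → v ∈ R.words → descents (q ++ v) ≡ descents q +
        (junction γ + descents v)
    des-product {q} q∈ v∈ with R.sound v∈ | ∈-blockPerms⇒↭ u′ q∈
    ... | cs , σs , refl | σ with alternating-head (alternating-resp p σs) | q
    ... | _ , _ , _ , _ | [] = contradiction σ ¬x∷xs↭[]
    ... | y , r , e , c | z ∷ q′ rewrite e = des-++ q′ (All-resp-↭ σ ps) c

  RunClosed : List (List A) → Set
  RunClosed S = ∀ {γ bs cs} → Alternating γ bs → Pointwise _↭_ bs cs → concat bs ∈ S → concat cs ∈ S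

  open DecMembership (≡-dec _≟_) using (_∈?_)

  -- S is exhausted one run class at a time.
  runClosed-gammaPositive : ∀ {m} k S → length S ≤ k → Unique S → RunClosed S →
    (∀ {u} → u ∈ S → ∃ λ bs → Alternating false bs × concat bs ≡ u × Unique u × length u ≡ 2 + m) →
    GammaPositive m (map descents S)
  runClosed-gammaPositive k [] _ _ _ _ = none
  runClosed-gammaPositive {m} (suc k) S@(u ∷ S₀) (s≤s |S₀|≤k) uS closed wf with wf (here refl)
  ... | bs , p , refl , uu , l = perm
      (add (subst (λ d → GammaPositive d _) degree≡m C.gammaPositive)
           (runClosed-gammaPositive k S′ |S′|≤k (Unique.filter⁺ rest? uS) closed′
               (wf ∘ proj₁ ∘ ∈-filter⁻ rest?)))
      (↭-trans (↭-reflexive (sym (map-++ descents C.words S′))) (↭-map descents (↭-sym S↭)))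
    where
    module C = Class (class p uu)
    rest? = λ w → ¬? (w ∈? C.words)
    S′ = filter rest? S
    degree≡m : C.degree ≡ m
    degree≡m = suc-injective (suc-injective (trans (sym C.size) l))
    C⊆S : ∀ {v} → v ∈ C.words → v ∈ S
    C⊆S v∈ with C.sound v∈
    ... | cs , σs , refl = closed p σs (here refl)
    to : ∀ {v} → v ∈ S → v ∈ C.words ++ S′
    to {v} v∈ with v ∈? C.words
    ... | yes q = ∈-++⁺ˡ q
    ... | no  q = ∈-++⁺ʳ C.words (∈-filter⁺ rest? v∈ q)
    from : ∀ {v} → v ∈ C.words ++ S′ → v ∈ S
    from v∈ with ∈-++⁻ C.words v∈
    ... | inj₁ q = C⊆S q
    ... | inj₂ q = proj₁ (∈-filter⁻ rest? q)
    S↭ : S ↭ C.words ++ S′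
    S↭ = unique∧⇔⇒↭ uS (Unique.++⁺ C.unique (Unique.filter⁺ rest? uS) λ (q , r) → proj₂
        (∈-filter⁻ rest? {xs = S} r) q) to from
    u∈C : concat bs ∈ C.words
    u∈C = C.complete (Pointwise.refl ↭-refl)
    |S′|≤k : length S′ ≤ k
    |S′|≤k = ≤-trans (s≤s⁻¹ (filter-notAll rest? S (here λ q → q u∈C))) |S₀|≤k
    closed′ : RunClosed S′
    closed′ {bs = bs′} {cs} p′ σs v∈ with ∈-filter⁻ rest? {xs = S} v∈
    ... | v∈S , v∉C = ∈-filter⁺ rest? (closed p′ σs v∈S) λ w∈C → v∉C (back w∈C)
      where
      -- Rearrangements can be undone: uniqueness of runs aligns the blocks of `concat cs` with
      -- those found in the class, and the way back stays inside it.
      back : concat cs ∈ C.words → concat bs′ ∈ C.words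
      back w∈C with C.sound w∈C
      ... | ds , τs , e with alternating-unique (alternating-resp p′ σs) (alternating-resp p τs) e
      ... | refl = C.complete (Pointwise.transitive ↭-trans τs (Pointwise.symmetric ↭-sym σs))

-- Permutations of Fin n

-- A `Permutation′` carries an inverse and proofs besides its values, so permutations are compared
-- by their values only.
_≈_ : ∀ {n} → Permutation′ n → Permutation′ n → Set
σ ≈ τ = ∀ a → σ ⟨$⟩ʳ a ≡ τ ⟨$⟩ʳ a

permute-injective : ∀ {n} (τ : Permutation′ n) {a b} → τ ⟨$⟩ʳ a ≡ τ ⟨$⟩ʳ b → a ≡ b
permute-injective τ e = trans (sym (inverseˡ τ)) (trans (cong (τ ⟨$⟩ˡ_) e) (inverseˡ τ))

-- By the pigeonhole principle: if `f` missed a value, punching it out would embed `Fin (suc n)`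
-- into `Fin n`.
injective⇒permutation : ∀ {n} (f : Fin n → Fin n) → (∀ {a b} → f a ≡ f b → a ≡ b) →
  ∃ λ (τ : Permutation′ n) → ∀ a → τ ⟨$⟩ʳ a ≡ f a
injective⇒permutation {zero} f inj = permutation f f (λ ()) (λ ()) , λ ()
injective⇒permutation {suc n} f inj = permutation f (proj₁ ∘ preimage) (proj₂ ∘ preimage)
    (λ a → inj (proj₂ (preimage (f a)))) , λ _ → refl
  where
  preimage : ∀ i → ∃ λ a → f a ≡ i
  preimage i with Fin.any? (λ a → f a Fin.≟ i)
  ... | yes p = p
  ... | no ∄a = contradiction (Fin.injective⇒≤ {f = λ a → punchOut (avoids a)}
      (inj ∘ Fin.punchOut-injective (avoids _) (avoids _))) 1+n≰n
    where
    avoids : ∀ a → i ≢ f a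
    avoids a e = ∄a (a , sym e)

insert-injective : ∀ {n} {j k} {π ρ : Permutation′ n} → insert zero j π ≈ insert zero k ρ → j ≡ k × π ≈ ρ
insert-injective {j = j} {π = π} {ρ} e with e zero
... | refl = refl , λ a → Fin.punchIn-injective j _ _
  (trans (sym (insert-punchIn zero j π a)) (trans (e (suc a)) (insert-punchIn zero j ρ a)))

permutations-distinct : ∀ n → AllPairs (λ σ τ → ¬ σ ≈ τ) (permutations n)
permutations-distinct zero    = [] ∷ []
permutations-distinct (suc n) = go (Unique.allFin⁺ (suc n))
  where
  go : ∀ {js} → Unique js → AllPairs (λ σ τ → ¬ σ ≈ τ) (cartesianProductWith (insert zero) js (permutations n))
  go [] = []
  go {j ∷ js} (j∉ ∷ u) = AllPairs.++⁺
    (AllPairs.map⁺ (AllPairs.map (λ ne e → ne (proj₂ (insert-injective {j = j} e))) (permutations-distinct n)))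
    (go u) (All.tabulate λ {σ} σ∈ → All.tabulate λ {τ} τ∈ → apart σ∈ τ∈)
    where
    apart : ∀ {σ τ} → σ ∈ map (insert zero j) (permutations n) → τ ∈ cartesianProductWith (insert zero) js
        (permutations n) → ¬ σ ≈ τ
    apart σ∈ τ∈ e with ∈-map⁻ (insert zero j) σ∈ | ∈-cartesianProductWith⁻ (insert zero) js (permutations n) τ∈
    ... | _ , _ , refl | k , _ , k∈ , _ , refl = All.lookup j∉ k∈ (proj₁ (insert-injective e))

permutations-complete : ∀ {n} (π : Permutation′ n) → ∃ λ σ → σ ∈ permutations n × σ ≈ π
permutations-complete {zero} π = Perm.id , here refl , λ ()
permutations-complete {suc n} π with permutations-complete (remove zero π)
... | σ , σ∈ , e = insert zero j σ , ∈-cartesianProductWith⁺ (insert zero) (∈-allFin j) σ∈ , agree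
  where
  j = π ⟨$⟩ʳ zero
  agree : insert zero j σ ≈ π
  agree zero    = refl
  agree (suc a) = trans (insert-punchIn zero j σ a)
      (trans (cong (punchIn j) (e a)) (sym (punchIn-permute π zero a)))

length-filter-mono : ∀ {A : Set} {P Q : A → Set} (P? : Decidable P) (Q? : Decidable Q) → (∀ {x} → P x → Q x) →
  ∀ xs → length (filter P? xs) ≤ length (filter Q? xs)
length-filter-mono P? Q? P⇒Q [] = z≤n
length-filter-mono P? Q? P⇒Q (x ∷ xs) with P? x | Q? x
... | yes _ | yes _ = s≤s (length-filter-mono P? Q? P⇒Q xs)
... | yes p | no ¬q = contradiction (P⇒Q p) ¬q
... | no _  | yes _ = m≤n⇒m≤1+n (length-filter-mono P? Q? P⇒Q xs)
... | no _  | no _  = length-filter-mono P? Q? P⇒Q xs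

length-filter-strict : ∀ {A : Set} {P Q : A → Set} (P? : Decidable P) (Q? : Decidable Q) → (∀ {x} → P x → Q x) →
  ∀ {x xs} → x ∈ xs → ¬ P x → Q x → length (filter P? xs) < length (filter Q? xs)
length-filter-strict P? Q? P⇒Q {xs = y ∷ ys} (here refl) ¬p q with P? y | Q? y
... | yes p | _     = contradiction p ¬p
... | no _  | yes _ = s≤s (length-filter-mono P? Q? P⇒Q ys)
... | no _  | no ¬q = contradiction q ¬q
length-filter-strict P? Q? P⇒Q {xs = y ∷ ys} (there x∈) ¬p q with P? y | Q? y
... | yes _ | yes _  = s≤s (length-filter-strict P? Q? P⇒Q x∈ ¬p q)
... | yes p | no ¬q′ = contradiction (P⇒Q p) ¬q′
... | no _  | yes _  = m≤n⇒m≤1+n (length-filter-strict P? Q? P⇒Q x∈ ¬p q)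
... | no _  | no _   = length-filter-strict P? Q? P⇒Q x∈ ¬p q

module _ {n : ℕ} (key : Fin n → ℕ) (key-injective : ∀ {a b} → key a ≡ key b → a ≡ b) where

  private
    below : Fin n → ℕ
    below a = length (filter (λ b → key b <? key a) (allFin n))

    below<n : ∀ a → below a < n
    below<n a = subst (below a <_) (length-tabulate (λ i → i))
      (filter-notAll (λ b → key b <? key a) (allFin n) (Any.map (λ { refl → n≮n (key a) }) (∈-allFin a)))

    below-mono : ∀ {a b} → key a < key b → below a < below b
    below-mono {a} {b} a<b = length-filter-strict (λ c → key c <? key a) (λ c → key c <? key b)
      (λ c<a → <-trans c<a a<b) (∈-allFin a) (n≮n (key a)) a<b

    below-injective : ∀ {a b} → below a ≡ below b → a ≡ b
    below-injective {a} {b} e with <-cmp (key a) (key b)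
    ... | tri< a<b _ _ = contradiction e (<⇒≢ (below-mono a<b))
    ... | tri≈ _ a≡b _ = key-injective a≡b
    ... | tri> _ _ b<a = contradiction (sym e) (<⇒≢ (below-mono b<a))

  -- Each element is sent to the number of elements with a smaller key.
  sortingPermutation : ∃ λ σ → σ ∈ permutations n × (∀ {a b} → key a < key b → σ ⟨$⟩ʳ a Fin.< σ ⟨$⟩ʳ b)
  sortingPermutation with injective⇒permutation (λ a → fromℕ< (below<n a))
      (below-injective ∘ Fin.fromℕ<-injective _ _ _ _)
  ... | π , e with permutations-complete π
  ... | σ , σ∈ , e′ = σ , σ∈ , λ {a} {b} a<b → subst₂ _<_ (position a) (position b) (below-mono a<b)
    where
    position : ∀ a → below a ≡ toℕ (σ ⟨$⟩ʳ a)
    position a = trans (sym (Fin.toℕ-fromℕ< (below<n a))) (cong toℕ (sym (trans (e′ a) (e a))))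

monotone⇒inflationary : ∀ {n} (f : Fin n → Fin n) → (∀ {a b} → a Fin.< b → f a Fin.< f b) → ∀ a → toℕ a ≤ toℕ
    (f a)
monotone⇒inflationary f mono a = go (toℕ a) a refl
  where
  go : ∀ k a → toℕ a ≡ k → k ≤ toℕ (f a)
  go zero    a       e = z≤n
  go (suc k) (suc a) e = ≤-<-trans (go k (Fin.inject₁ a) (trans (Fin.toℕ-inject₁ a) (suc-injective e)))
                                   (mono (s≤s (≤-reflexive (Fin.toℕ-inject₁ a))))

-- One permutation composed with the inverse of the other is strictly increasing on `Fin n`, hence
-- nowhere below the identity. Exchanging the two gives the opposite inequality.
sameOrder⇒≈ : ∀ {n} (σ τ : Permutation′ n) →
  (∀ {a b} → τ ⟨$⟩ʳ a Fin.< τ ⟨$⟩ʳ b → σ ⟨$⟩ʳ a Fin.< σ ⟨$⟩ʳ b) → σ ≈ τ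
sameOrder⇒≈ σ τ τ⇒σ a = Fin.toℕ-injective (≤-antisym (below τ σ σ⇒τ a) (below σ τ τ⇒σ a))
  where
  below : ∀ ρ π → (∀ {a b} → π ⟨$⟩ʳ a Fin.< π ⟨$⟩ʳ b → ρ ⟨$⟩ʳ a Fin.< ρ ⟨$⟩ʳ b) → ∀ a → toℕ (π ⟨$⟩ʳ a) ≤ toℕ
      (ρ ⟨$⟩ʳ a)
  below ρ π π⇒ρ a = subst (λ b → toℕ (π ⟨$⟩ʳ a) ≤ toℕ (ρ ⟨$⟩ʳ b)) (inverseˡ π)
    (monotone⇒inflationary (λ i → ρ ⟨$⟩ʳ (π ⟨$⟩ˡ i))
      (λ {i} {j} i<j → π⇒ρ (subst₂ Fin._<_ (sym (inverseʳ π)) (sym (inverseʳ π)) i<j)) (π ⟨$⟩ʳ a))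
  σ⇒τ : ∀ {a b} → σ ⟨$⟩ʳ a Fin.< σ ⟨$⟩ʳ b → τ ⟨$⟩ʳ a Fin.< τ ⟨$⟩ʳ b
  σ⇒τ {a} {b} lt with Fin.<-cmp (τ ⟨$⟩ʳ a) (τ ⟨$⟩ʳ b)
  ... | tri< p _ _ = p
  ... | tri≈ _ e _ = contradiction (cong (λ c → toℕ (σ ⟨$⟩ʳ c)) (permute-injective τ e)) (<⇒≢ lt)
  ... | tri> _ _ p = contradiction lt (<-asym (τ⇒σ p))

-- Sequences with prescribed strict increases

-- weakly n r counts the weakly increasing sequences of length n in an interval of r + 1 integers.
weakly : ℕ → ℕ → ℕ
weakly zero    r       = 1
weakly (suc n) zero    = weakly n zero
weakly (suc n) (suc r) = weakly n (suc r) + weakly (suc n) r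

weakly-zero : ∀ n → weakly n 0 ≡ 1
weakly-zero zero    = refl
weakly-zero (suc n) = weakly-zero n

-- ... of which i prescribed increments have to be strict.
strictly : ℕ → ℕ → ℕ → ℕ
strictly n r       zero    = weakly n r
strictly n zero    (suc i) = 0
strictly n (suc r) (suc i) = strictly n r i

-- A strict increment costs one unit of room, so `strictly n r i` is the binomial coefficient of n +
-- r - i over n, and 0 for i > r. This is Pascal's rule for it.
strictly-pascal : ∀ n r i → strictly n (suc r) i + strictly (suc n) r i ≡ strictly (suc n) (suc r) i
strictly-pascal n r       zero    = refl
strictly-pascal n zero    (suc zero)    = +-identityʳ _
strictly-pascal n zero    (suc (suc i)) = refl
strictly-pascal n (suc r) (suc i) = strictly-pascal n r i

predecessors : List ℕ → List ℕ
predecessors []           = []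
predecessors (zero ∷ xs)  = predecessors xs
predecessors (suc x ∷ xs) = x ∷ predecessors xs

count-predecessors : ∀ i xs → count (suc i) xs ≡ count i (predecessors xs)
count-predecessors i []           = refl
count-predecessors i (zero ∷ xs)  = count-predecessors i xs
count-predecessors i (suc x ∷ xs) with x ≟ i
... | yes refl rewrite filter-accept (_≟ suc x) {xs = xs} (refl {x = suc x}) | filter-accept (_≟ x)
    {xs = predecessors xs} (refl {x = x})
    = cong suc (count-predecessors i xs)
... | no  x≢i  rewrite filter-reject (_≟ suc i) {xs = xs} (x≢i ∘ suc-injective) | filter-reject (_≟ i)
    {xs = predecessors xs} x≢i
    = count-predecessors i xs

sum-strictly-zero : ∀ n xs → sum (map (strictly n 0) xs) ≡ count 0 xs
sum-strictly-zero n []           = refl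
sum-strictly-zero n (zero ∷ xs)  = cong₂ _+_ (weakly-zero n) (sum-strictly-zero n xs)
sum-strictly-zero n (suc x ∷ xs) = sum-strictly-zero n xs

sum-strictly-suc : ∀ n r xs → sum (map (strictly n (suc r)) xs) ≡ count 0 xs * weakly n (suc r) + sum
    (map (strictly n r) (predecessors xs))
sum-strictly-suc n r []           = refl
sum-strictly-suc n r (zero ∷ xs)  = trans (cong (weakly n (suc r) +_) (sum-strictly-suc n r xs))
    (sym (+-assoc (weakly n (suc r)) _ _))
sum-strictly-suc n r (suc x ∷ xs) = begin
  strictly n r x + sum (map (strictly n (suc r)) xs)  ≡⟨ cong (strictly n r x +_) (sum-strictly-suc n r xs) ⟩
  strictly n r x + (z + s)                            ≡⟨ +-assoc (strictly n r x) z s ⟨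
  strictly n r x + z + s                              ≡⟨ cong (_+ s) (+-comm (strictly n r x) z) ⟩
  z + strictly n r x + s                              ≡⟨ +-assoc z (strictly n r x) s ⟩
  z + (strictly n r x + s)                            ∎
  where
  open ≡-Reasoning
  z = count 0 xs * weakly n (suc r)
  s = sum (map (strictly n r) (predecessors xs))

-- The matrix `strictly n r i` in r and i is triangular with ones on the diagonal. The equation for
-- r = 0 gives the number of zeros; once these are cancelled, the equations for `suc r` become those
-- of the lists of predecessors.
sums-determine-counts : ∀ n xs ys → (∀ r → sum (map (strictly n r) xs) ≡ sum (map (strictly n r) ys)) →
  ∀ i → count i xs ≡ count i ys
sums-determine-counts n xs ys h i = go i xs ys h
  where
  zeros : ∀ xs ys → (∀ r → sum (map (strictly n r) xs) ≡ sum (map (strictly n r) ys)) → count 0 xs ≡ count 0 ys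
  zeros xs ys h = trans (sym (sum-strictly-zero n xs)) (trans (h 0) (sum-strictly-zero n ys))
  go : ∀ i xs ys → (∀ r → sum (map (strictly n r) xs) ≡ sum (map (strictly n r) ys)) → count i xs ≡ count i ys
  go zero    xs ys h = zeros xs ys h
  go (suc i) xs ys h = trans (count-predecessors i xs)
      (trans (go i (predecessors xs) (predecessors ys) h′) (sym (count-predecessors i ys)))
    where
    h′ : ∀ r → sum (map (strictly n r) (predecessors xs)) ≡ sum (map (strictly n r) (predecessors ys))
    h′ r = +-cancelˡ-≡ (count 0 xs * weakly n (suc r)) _ _
        (trans (sym (sum-strictly-suc n r xs)) (trans (h (suc r))
      (trans (sum-strictly-suc n r ys)
          (cong (λ c → c * weakly n (suc r) + sum (map (strictly n r) (predecessors ys)))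
          (sym (zeros xs ys h))))))

infix 4 _⊑_
-- Lexicographic order. A residue may be repeated only where the key does not fall, so an increasing
-- sequence of pairs has strict increases of the residue at the descents of the keys.
_⊑_ : ℕ × ℕ → ℕ × ℕ → Set
(c , κ) ⊑ (c′ , κ′) = c < c′ ⊎ (c ≡ c′ × κ ≤ κ′)

⊑-trans : ∀ {x y z} → x ⊑ y → y ⊑ z → x ⊑ z
⊑-trans (inj₁ p)       (inj₁ q)       = inj₁ (<-trans p q)
⊑-trans (inj₁ p)       (inj₂ (refl , _)) = inj₁ p
⊑-trans (inj₂ (refl , _)) (inj₁ q)    = inj₁ q
⊑-trans (inj₂ (refl , p)) (inj₂ (refl , q)) = inj₂ (refl , ≤-trans p q)

⊑-antisym : ∀ {c κ c′ κ′} → (c , κ) ⊑ (c′ , κ′) → (c′ , κ′) ⊑ (c , κ) → κ ≡ κ′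
⊑-antisym (inj₁ p) (inj₁ q) = contradiction q (<-asym p)
⊑-antisym (inj₁ p) (inj₂ (refl , _)) = contradiction p (n≮n _)
⊑-antisym (inj₂ (refl , _)) (inj₁ q) = contradiction q (n≮n _)
⊑-antisym (inj₂ (_ , p)) (inj₂ (_ , q)) = ≤-antisym p q

⊑⇒≤ : ∀ {c κ c′ κ′} → (c , κ) ⊑ (c′ , κ′) → c ≤ c′
⊑⇒≤ (inj₁ p)          = <⇒≤ p
⊑⇒≤ (inj₂ (refl , _)) = ≤-refl

IsChain : ∀ {n} → ℕ → ℕ → ℕ → Vec ℕ n → Vec ℕ n → Set
IsChain lo hi κ₀ []       []       = ⊤
IsChain lo hi κ₀ (κ ∷ ks) (c ∷ cs) = (lo , κ₀) ⊑ (c , κ) × c ≤ hi × IsChain c hi κ ks cs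

isChain-lower : ∀ {n lo hi κ₀} (ks cs : Vec ℕ n) → IsChain lo hi κ₀ ks cs → ∀ i → (lo , κ₀) ⊑
    (lookup cs i , lookup ks i)
isChain-lower (κ ∷ ks) (c ∷ cs) (p , _ , _) zero    = p
isChain-lower (κ ∷ ks) (c ∷ cs) (p , _ , r) (suc i) = ⊑-trans p (isChain-lower ks cs r i)

isChain-upper : ∀ {n lo hi κ₀} (ks cs : Vec ℕ n) → IsChain lo hi κ₀ ks cs → ∀ i → lookup cs i ≤ hi
isChain-upper (κ ∷ ks) (c ∷ cs) (_ , q , _) zero    = q
isChain-upper (κ ∷ ks) (c ∷ cs) (_ , _ , r) (suc i) = isChain-upper ks cs r i

isChain-sorted : ∀ {n lo hi κ₀} (ks cs : Vec ℕ n) → IsChain lo hi κ₀ ks cs →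
  ∀ {i j} → i Fin.< j → (lookup cs i , lookup ks i) ⊑ (lookup cs j , lookup ks j)
isChain-sorted (κ ∷ ks) (c ∷ cs) (_ , _ , r) {zero}  {suc j} _         = isChain-lower ks cs r j
isChain-sorted (κ ∷ ks) (c ∷ cs) (_ , _ , r) {suc i} {suc j} (s≤s i<j) = isChain-sorted ks cs r i<j

sorted⇒isChain : ∀ {n lo hi κ₀} (ks cs : Vec ℕ n) →
  (∀ i → (lo , κ₀) ⊑ (lookup cs i , lookup ks i)) → (∀ i → lookup cs i ≤ hi) →
  (∀ {i j} → i Fin.< j → (lookup cs i , lookup ks i) ⊑ (lookup cs j , lookup ks j)) → IsChain lo hi κ₀ ks cs
sorted⇒isChain []       []       l u s = tt
sorted⇒isChain (κ ∷ ks) (c ∷ cs) l u s =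
  l zero , u zero , sorted⇒isChain ks cs (λ i → s {zero} {suc i} (s≤s z≤n)) (u ∘ suc) (λ i<j → s (s≤s i<j))

-- The weakly increasing sequences in {lo,…,lo+r} that increase strictly wherever the keys
-- κ₀ ∷ ks descend.
chains : ∀ {n} → ℕ → ℕ → ℕ → Vec ℕ n → List (Vec ℕ n)
chainsFrom : ∀ {n} → ℕ → ℕ → ℕ → Vec ℕ n → List (Vec ℕ (suc n))
chains lo r κ₀ [] = [ [] ]
chains lo r κ₀ (κ ∷ ks) with κ <? κ₀ | r
... | no  _ | r     = chainsFrom lo r κ ks
... | yes _ | zero  = []
... | yes _ | suc r = chainsFrom (suc lo) r κ ks
chainsFrom lo zero    κ ks = map (lo ∷_) (chains lo zero κ ks)
chainsFrom lo (suc r) κ ks = map (lo ∷_) (chains lo (suc r) κ ks) ++ chainsFrom (suc lo) r κ ks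

open Descents {A = ℕ} (λ κ → κ) using () renaming
    (desFrom to keyDescents; step-down to key-down; step-up to key-up)

length-chains : ∀ {n} lo r κ₀ (ks : Vec ℕ n) → length (chains lo r κ₀ ks) ≡ strictly n r
    (keyDescents κ₀ (toList ks))
length-chainsFrom : ∀ {n} lo r κ (ks : Vec ℕ n) → length (chainsFrom lo r κ ks) ≡ strictly (suc n) r
    (keyDescents κ (toList ks))
length-chains lo r κ₀ [] = refl
length-chains lo r κ₀ (κ ∷ ks) with κ <? κ₀ | r
... | no κ≮κ₀ | r     rewrite key-up (≮⇒≥ κ≮κ₀) = length-chainsFrom lo r κ ks
... | yes κ<κ₀ | zero  rewrite key-down κ<κ₀ = refl
... | yes κ<κ₀ | suc r rewrite key-down κ<κ₀ = length-chainsFrom (suc lo) r κ ks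
length-chainsFrom {n} lo zero κ ks = trans (length-map (lo ∷_) (chains lo zero κ ks))
    (trans (length-chains lo zero κ ks) (base (keyDescents κ (toList ks))))
  where
  base : ∀ i → strictly n 0 i ≡ strictly (suc n) 0 i
  base zero    = refl
  base (suc i) = refl
length-chainsFrom {n} lo (suc r) κ ks = trans (length-++ (map (lo ∷_) (chains lo (suc r) κ ks)))
  (trans (cong₂ _+_ (trans (length-map (lo ∷_) (chains lo (suc r) κ ks)) (length-chains lo (suc r) κ ks))
      (length-chainsFrom (suc lo) r κ ks))
         (strictly-pascal n r (keyDescents κ (toList ks))))

∈-chains⁻ : ∀ {n} lo r κ₀ (ks : Vec ℕ n) {cs} → cs ∈ chains lo r κ₀ ks → IsChain lo (lo + r) κ₀ ks cs
∈-chainsFrom⁻ : ∀ {n} lo r κ (ks : Vec ℕ n) {c cs} → (c ∷ cs) ∈ chainsFrom lo r κ ks →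
  lo ≤ c × c ≤ lo + r × IsChain c (lo + r) κ ks cs
∈-chains⁻ lo r κ₀ [] (here refl) = tt
∈-chains⁻ lo r κ₀ (κ ∷ ks) {c ∷ cs} p with κ <? κ₀ | r
... | no κ≮κ₀ | r with ∈-chainsFrom⁻ lo r κ ks p
... | lo≤c , c≤hi , q = lower , c≤hi , q
  where
  lower : (lo , κ₀) ⊑ (c , κ)
  lower with m≤n⇒m<n∨m≡n lo≤c
  ... | inj₁ lo<c = inj₁ lo<c
  ... | inj₂ lo≡c = inj₂ (lo≡c , ≮⇒≥ κ≮κ₀)
∈-chains⁻ lo r κ₀ (κ ∷ ks) {c ∷ cs} () | yes κ<κ₀ | zero
∈-chains⁻ lo _ κ₀ (κ ∷ ks) {c ∷ cs} p | yes κ<κ₀ | suc r with ∈-chainsFrom⁻ (suc lo) r κ ks p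
... | lo<c , c≤hi , q rewrite +-suc lo r = inj₁ lo<c , c≤hi , q
∈-chainsFrom⁻ lo zero κ ks p with ∈-map⁻ (lo ∷_) p
... | cs , cs∈ , refl = ≤-refl , m≤m+n lo 0 , ∈-chains⁻ lo 0 κ ks cs∈
∈-chainsFrom⁻ lo (suc r) κ ks p with ∈-++⁻ (map (lo ∷_) (chains lo (suc r) κ ks)) p
... | inj₁ q with ∈-map⁻ (lo ∷_) q
... | cs , cs∈ , refl = ≤-refl , m≤m+n lo (suc r) , ∈-chains⁻ lo (suc r) κ ks cs∈
∈-chainsFrom⁻ lo (suc r) κ ks p | inj₂ q with ∈-chainsFrom⁻ (suc lo) r κ ks q
... | lo<c , c≤hi , q′ rewrite +-suc lo r = <⇒≤ lo<c , c≤hi , q′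

∈-chains⁺ : ∀ {n} lo r κ₀ (ks : Vec ℕ n) {cs} → IsChain lo (lo + r) κ₀ ks cs → cs ∈ chains lo r κ₀ ks
∈-chainsFrom⁺ : ∀ {n} lo r κ (ks : Vec ℕ n) {c cs} → lo ≤ c → c ≤ lo + r → IsChain c (lo + r) κ ks cs →
  (c ∷ cs) ∈ chainsFrom lo r κ ks
∈-chains⁺ lo r κ₀ [] {[]} tt = here refl
∈-chains⁺ lo r κ₀ (κ ∷ ks) {c ∷ cs} (p , c≤hi , q) with κ <? κ₀ | r
... | no _ | r = ∈-chainsFrom⁺ lo r κ ks (⊑⇒≤ p) c≤hi q
... | yes κ<κ₀ | zero rewrite +-identityʳ lo with p
... | inj₁ lo<c = contradiction c≤hi (<⇒≱ lo<c)
... | inj₂ (_ , κ₀≤κ) = contradiction κ₀≤κ (<⇒≱ κ<κ₀)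
∈-chains⁺ lo _ κ₀ (κ ∷ ks) {c ∷ cs} (p , c≤hi , q) | yes κ<κ₀ | suc r rewrite +-suc lo r with p
... | inj₁ lo<c = ∈-chainsFrom⁺ (suc lo) r κ ks lo<c c≤hi q
... | inj₂ (_ , κ₀≤κ) = contradiction κ₀≤κ (<⇒≱ κ<κ₀)
∈-chainsFrom⁺ lo zero κ ks {c} lo≤c c≤hi q with ≤-antisym lo≤c (≤-trans c≤hi (≤-reflexive (+-identityʳ lo)))
... | refl = ∈-map⁺ (lo ∷_) (∈-chains⁺ lo zero κ ks q)
∈-chainsFrom⁺ lo (suc r) κ ks {c} lo≤c c≤hi q with m≤n⇒m<n∨m≡n lo≤c
... | inj₂ refl = ∈-++⁺ˡ (∈-map⁺ (lo ∷_) (∈-chains⁺ lo (suc r) κ ks q))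
... | inj₁ lo<c rewrite +-suc lo r = ∈-++⁺ʳ _ (∈-chainsFrom⁺ (suc lo) r κ ks lo<c c≤hi q)

chains-unique : ∀ {n} lo r κ₀ (ks : Vec ℕ n) → Unique (chains lo r κ₀ ks)
chainsFrom-unique : ∀ {n} lo r κ (ks : Vec ℕ n) → Unique (chainsFrom lo r κ ks)
chains-unique lo r κ₀ [] = [] ∷ []
chains-unique lo r κ₀ (κ ∷ ks) with κ <? κ₀ | r
... | no  _ | r     = chainsFrom-unique lo r κ ks
... | yes _ | zero  = []
... | yes _ | suc r = chainsFrom-unique (suc lo) r κ ks
chainsFrom-unique lo zero    κ ks = Unique.map⁺ Vec.∷-injectiveʳ (chains-unique lo zero κ ks)
chainsFrom-unique lo (suc r) κ ks =
  Unique.++⁺ (Unique.map⁺ Vec.∷-injectiveʳ (chains-unique lo (suc r) κ ks))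
      (chainsFrom-unique (suc lo) r κ ks) disjoint
  where
  disjoint : ∀ {v} → ¬ (v ∈ map (lo ∷_) (chains lo (suc r) κ ks) × v ∈ chainsFrom (suc lo) r κ ks)
  disjoint (p , q) with ∈-map⁻ (lo ∷_) p
  ... | _ , _ , refl = n≮n lo (proj₁ (∈-chainsFrom⁻ (suc lo) r κ ks q))

length-concatMap : ∀ {A B : Set} (f : A → List B) {h : A → ℕ} → (∀ x → length (f x) ≡ h x) →
  ∀ xs → length (concatMap f xs) ≡ sum (map h xs)
length-concatMap f e []       = refl
length-concatMap f e (x ∷ xs) = trans (length-++ (f x)) (cong₂ _+_ (e x) (length-concatMap f e xs))

lookup-ext : ∀ {n} {u v : Vec ℕ n} → (∀ a → lookup u a ≡ lookup v a) → u ≡ v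
lookup-ext e = trans (sym (tabulate∘lookup _)) (trans (Vec.tabulate-cong e) (tabulate∘lookup _))

-- The points K·d + c, where c is a chain of residues compatible with τ.
module Points {n : ℕ} (L : List (Permutation′ n)) (L-distinct : AllPairs (λ σ τ → ¬ σ ≈ τ) L)
              (K k κ₀ : ℕ) (κ d : Permutation′ n → Fin n → ℕ) where

  keys : Permutation′ n → Vec ℕ n
  keys τ = tabulate (λ i → κ τ (τ ⟨$⟩ˡ i))

  record Valid (τ : Permutation′ n) (c : Fin n → ℕ) : Set where
    field
      lower  : ∀ a → (0 , κ₀) ⊑ (c a , κ τ a)
      upper  : ∀ a → c a ≤ k
      sorted : ∀ {a b} → τ ⟨$⟩ʳ a Fin.< τ ⟨$⟩ʳ b → (c a , κ τ a) ⊑ (c b , κ τ b)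

  point : Permutation′ n → Vec ℕ n → Vec ℕ n
  point τ cs = tabulate (λ a → K * d τ a + lookup cs (τ ⟨$⟩ʳ a))

  fibre : Permutation′ n → List (Vec ℕ n)
  fibre τ = map (point τ) (chains 0 k κ₀ (keys τ))

  points : List (Vec ℕ n)
  points = concatMap fibre L

  length-points : length points ≡ sum (map (λ τ → strictly n k (keyDescents κ₀ (toList (keys τ)))) L)
  length-points = length-concatMap fibre
      (λ τ → trans (length-map (point τ) (chains 0 k κ₀ (keys τ))) (length-chains 0 k κ₀ (keys τ))) L

  private
    lookup-keys : ∀ τ a → lookup (keys τ) (τ ⟨$⟩ʳ a) ≡ κ τ a
    lookup-keys τ a = trans (lookup∘tabulate _ (τ ⟨$⟩ʳ a)) (cong (κ τ) (inverseˡ τ))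

  isChain⇒valid : ∀ τ {cs} → IsChain 0 k κ₀ (keys τ) cs → Valid τ (λ a → lookup cs (τ ⟨$⟩ʳ a))
  isChain⇒valid τ {cs} p = record
    { lower  = λ a → subst (λ x → (0 , κ₀) ⊑ (_ , x)) (lookup-keys τ a) (isChain-lower (keys τ) cs p (τ ⟨$⟩ʳ a))
    ; upper  = λ a → isChain-upper (keys τ) cs p (τ ⟨$⟩ʳ a)
    ; sorted = λ {a} {b} a<b → subst₂ (λ x y → (_ , x) ⊑ (_ , y)) (lookup-keys τ a) (lookup-keys τ b)
        (isChain-sorted (keys τ) cs p a<b)
    }

  valid⇒isChain : ∀ τ {c} → Valid τ c → IsChain 0 k κ₀ (keys τ) (tabulate (λ i → c (τ ⟨$⟩ˡ i)))
  valid⇒isChain τ {c} v = sorted⇒isChain (keys τ) cs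
    (λ i → subst₂ (λ x y → (0 , κ₀) ⊑ (x , y)) (sym (lookup∘tabulate _ i)) (sym (lookup∘tabulate _ i))
        (lower (τ ⟨$⟩ˡ i)))
    (λ i → subst (_≤ k) (sym (lookup∘tabulate _ i)) (upper (τ ⟨$⟩ˡ i)))
    (λ {i} {j} i<j → subst₂ _⊑_ (cong₂ _,_ (sym (lookup∘tabulate _ i)) (sym (lookup∘tabulate _ i)))
                                (cong₂ _,_ (sym (lookup∘tabulate _ j)) (sym (lookup∘tabulate _ j)))
                                (sorted (subst₂ Fin._<_ (sym (inverseʳ τ)) (sym (inverseʳ τ)) i<j)))
    where
    open Valid v
    cs = tabulate (λ i → c (τ ⟨$⟩ˡ i))

  ∈-points⁻ : ∀ {v} → v ∈ points → ∃ λ τ → ∃ λ c → τ ∈ L × Valid τ c × (∀ a → lookup v a ≡ K * d τ a + c a)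
  ∈-points⁻ v∈ with find (∈-concatMap⁻ fibre {xs = L} v∈)
  ... | τ , τ∈ , v∈′ with ∈-map⁻ (point τ) v∈′
  ... | cs , cs∈ , refl = τ , (λ a → lookup cs (τ ⟨$⟩ʳ a)) , τ∈ , isChain⇒valid τ
      (∈-chains⁻ 0 k κ₀ (keys τ) cs∈) , lookup∘tabulate _

  ∈-points⁺ : ∀ {v τ c} → τ ∈ L → Valid τ c → (∀ a → lookup v a ≡ K * d τ a + c a) → v ∈ points
  ∈-points⁺ {v} {τ} {c} τ∈ valid e = ∈-concatMap⁺ fibre (lose τ∈ (subst (_∈ fibre τ) (sym v≡)
    (∈-map⁺ (point τ) (∈-chains⁺ 0 k κ₀ (keys τ) (valid⇒isChain τ valid)))))
    where
    v≡ : v ≡ point τ (tabulate (λ i → c (τ ⟨$⟩ˡ i)))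
    v≡ = lookup-ext λ a → trans (e a) (trans (cong (λ x → K * d τ a + x)
      (sym (trans (lookup∘tabulate _ (τ ⟨$⟩ʳ a)) (cong c (inverseˡ τ))))) (sym (lookup∘tabulate _ a)))

  -- By `recover`, a point determines the pairs of residue and key. The keys are distinct, so the
  -- lexicographic order of these pairs is strict and determines the permutation.
  points-unique : (∀ τ {a b} → κ τ a ≡ κ τ b → a ≡ b) →
    (∀ {σ τ c c′} → Valid σ c → Valid τ c′ → (∀ a → K * d σ a + c a ≡ K * d τ a + c′ a) → ∀ a → c a ≡ c′ a ×
        κ σ a ≡ κ τ a) →
    Unique points
  points-unique κ-injective recover = Unique.concat⁺
    (All.map⁺ (All.universal (λ τ → Unique.map⁺ (point-injective τ) (chains-unique 0 k κ₀ (keys τ))) L))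
    (AllPairs.map⁺ (AllPairs.map disjoint L-distinct))
    where
    point-injective : ∀ τ {cs cs′} → point τ cs ≡ point τ cs′ → cs ≡ cs′
    point-injective τ {cs} {cs′} e = lookup-ext λ i → subst (λ j → lookup cs j ≡ lookup cs′ j) (inverseʳ τ)
      (+-cancelˡ-≡ (K * d τ (τ ⟨$⟩ˡ i)) _ _ (trans (sym (lookup∘tabulate _ (τ ⟨$⟩ˡ i)))
        (trans (cong (λ v → lookup v (τ ⟨$⟩ˡ i)) e) (lookup∘tabulate _ (τ ⟨$⟩ˡ i)))))
    disjoint : ∀ {σ τ} → ¬ σ ≈ τ → ∀ {v} → ¬ (v ∈ fibre σ × v ∈ fibre τ)
    disjoint {σ} {τ} σ≉τ (p , q) with ∈-map⁻ (point σ) p | ∈-map⁻ (point τ) q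
    ... | cs , cs∈ , refl | cs′ , cs∈′ , e = σ≉τ (sameOrder⇒≈ σ τ order)
      where
      vσ = isChain⇒valid σ (∈-chains⁻ 0 k κ₀ (keys σ) cs∈)
      vτ = isChain⇒valid τ (∈-chains⁻ 0 k κ₀ (keys τ) cs∈′)
      same = recover vσ vτ λ a → trans (sym (lookup∘tabulate _ a))
          (trans (cong (λ v → lookup v a) e) (lookup∘tabulate _ a))
      order : ∀ {a b} → τ ⟨$⟩ʳ a Fin.< τ ⟨$⟩ʳ b → σ ⟨$⟩ʳ a Fin.< σ ⟨$⟩ʳ b
      order {a} {b} a<b with Fin.<-cmp (σ ⟨$⟩ʳ a) (σ ⟨$⟩ʳ b)
      ... | tri< p _ _ = p
      ... | tri≈ _ e _ = contradiction (cong (λ x → toℕ (τ ⟨$⟩ʳ x)) (permute-injective σ e)) (<⇒≢ a<b)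
      ... | tri> _ _ b<a = contradiction (cong (λ x → toℕ (τ ⟨$⟩ʳ x)) (κ-injective τ
              (⊑-antisym (Valid.sorted vτ a<b) (subst₂ _⊑_ (pair b) (pair a) (Valid.sorted vσ b<a))))) (<⇒≢ a<b)
        where
        pair : ∀ a → _ ≡ _
        pair a = cong₂ _,_ (proj₁ (same a)) (proj₂ (same a))

-- Ranked posets and descent levels

odd : ℕ → Bool
odd zero    = false
odd (suc m) = not (odd m)

bit : Bool → ℕ
bit false = 0
bit true  = 1

half-suc : ∀ m → ⌊ suc m /2⌋ ≡ ⌊ m /2⌋ + bit (odd m)
half-suc zero          = refl
half-suc (suc zero)    = refl
half-suc (suc (suc m)) with odd m | half-suc m
... | false | e = cong suc e
... | true  | e = cong suc e

module Encoding (N : ℕ) where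

  -- The lexicographic order on the pairs (p , x) with x ≤ N is the order of their codes.
  encode : ℕ → ℕ → ℕ
  encode p x = x + p * suc N

  encode-< : ∀ {p q x y} → x ≤ N → p < q → encode p x < encode q y
  encode-< {p} {q} {x} {y} x≤N p<q = begin-strict
    x + p * suc N     <⟨ +-monoˡ-< (p * suc N) (s≤s x≤N) ⟩
    suc N + p * suc N ≤⟨ *-monoˡ-≤ (suc N) p<q ⟩
    q * suc N         ≤⟨ m≤n+m (q * suc N) y ⟩
    y + q * suc N     ∎
    where open ≤-Reasoning

  encode-≤⁻ : ∀ {p q x y} → y ≤ N → encode p x ≤ encode q y → p < q ⊎ (p ≡ q × x ≤ y)
  encode-≤⁻ {p} {q} {x} {y} y≤N le with <-cmp p q
  ... | tri< p<q _ _  = inj₁ p<q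
  ... | tri≈ _ refl _ = inj₂ (refl , +-cancelʳ-≤ (p * suc N) x y le)
  ... | tri> _ _ q<p  = contradiction le (<⇒≱ (encode-< y≤N q<p))

  encode-<⁻ : ∀ {p q x y} → y ≤ N → encode p x < encode q y → p < q ⊎ (p ≡ q × x < y)
  encode-<⁻ {p} {q} {x} {y} y≤N lt with <-cmp p q
  ... | tri< p<q _ _  = inj₁ p<q
  ... | tri≈ _ refl _ = inj₂ (refl , +-cancelʳ-< (p * suc N) x y lt)
  ... | tri> _ _ q<p  = contradiction lt (<-asym (encode-< y≤N q<p))

  encode-injective : ∀ {p q x y} → x ≤ N → y ≤ N → encode p x ≡ encode q y → p ≡ q × x ≡ y
  encode-injective {p} {q} {x} {y} x≤N y≤N e with <-cmp p q
  ... | tri< p<q _ _  = contradiction e (<⇒≢ (encode-< x≤N p<q))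
  ... | tri≈ _ refl _ = refl , +-cancelʳ-≡ (p * suc N) x y e
  ... | tri> _ _ q<p  = contradiction (sym e) (<⇒≢ (encode-< y≤N q<p))

  encode-≤ : ∀ {p B x} → p ≤ B → x ≤ N → encode p x ≤ N + B * suc N
  encode-≤ p≤B x≤N = +-mono-≤ x≤N (*-monoˡ-≤ (suc N) p≤B)

module Poset {n : ℕ} (P : NaturallyLabeledPoset n) (ranked : Order.Ranked (_≼̌_ P)) where

  V : Set
  V = P̌ P

  private
    _≼_ = _≼̌_ P
    module ≼ = DPO P

  []-injective : ∀ {a b : Fin n} → [ a ]₋ ≡ [ b ]₋ → a ≡ b
  []-injective refl = refl

  open Order _≼_ using (_≺_; _⋖_; SaturatedChain; IsMaximalChain) public

  ≺-≼-trans : ∀ {a b c} → a ≺ b → b ≼ c → a ≺ c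
  ≺-≼-trans (a≼b , a≢b) b≼c = ≼.trans a≼b b≼c , λ { refl → a≢b (≼.antisym a≼b b≼c) }

  vertices : ∀ {a b} → SaturatedChain a b → List V
  vertices {a} ε       = [ a ]
  vertices {a} (_ ◅ C) = a ∷ vertices C

  start∈vertices : ∀ {a b} (C : SaturatedChain a b) → a ∈ vertices C
  start∈vertices ε       = here refl
  start∈vertices (_ ◅ C) = here refl

  chain⇒≼ : ∀ {a b} → SaturatedChain a b → a ≼ b
  chain⇒≼ ε                    = ≼.refl
  chain⇒≼ (((a≼c , _) , _) ◅ C) = ≼.trans a≼c (chain⇒≼ C)

  vertices-interval : ∀ {a b} (C : SaturatedChain a b) → All (λ c → a ≼ c × c ≼ b) (vertices C)
  vertices-interval ε = (≼.refl , ≼.refl) ∷ []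
  vertices-interval C@(((a≼c , _) , _) ◅ C′) =
    (≼.refl , chain⇒≼ C) ∷ All.map (λ (c≼x , x≼b) → ≼.trans a≼c c≼x , x≼b) (vertices-interval C′)

  vertices-increasing : ∀ {a b} (C : SaturatedChain a b) → AllPairs _≺_ (vertices C)
  vertices-increasing ε = [] ∷ []
  vertices-increasing ((a≺c , _) ◅ C) =
    All.map (λ (c≼x , _) → ≺-≼-trans a≺c c≼x) (vertices-interval C) ∷ vertices-increasing C

  vertices-maximal : ∀ {a b} (C : SaturatedChain a b) x → a ≼ x → x ≼ b →
    All (λ c → x ≼ c ⊎ c ≼ x) (vertices C) → x ∈ vertices C
  vertices-maximal ε x a≼x x≼b _ = here (≼.antisym x≼b a≼x)
  vertices-maximal (_◅_ {a} {c} a⋖c C) x a≼x x≼b (_ ∷ ps) with All.lookup ps (start∈vertices C) | x ≼.≟ a | x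
      ≼.≟ c
  ... | inj₂ c≼x | _ | _ = there (vertices-maximal C x c≼x x≼b ps)
  ... | inj₁ _ | yes x≡a | _ = here x≡a
  ... | inj₁ _ | no _ | yes refl = there (start∈vertices C)
  ... | inj₁ x≼c | no x≢a | no x≢c = contradiction ((a≼x , x≢a ∘ sym) , (x≼c , x≢c)) (proj₂ a⋖c x)

  -- Makes `Ranked`, which is stated for lists of elements of an interval, applicable to saturated
  -- chains.
  vertices-isMaximalChain : ∀ {a b} (C : SaturatedChain a b) → IsMaximalChain a b (vertices C)
  vertices-isMaximalChain C = record
    { increasing = vertices-increasing C
    ; inInterval = vertices-interval C
    ; maximal    = vertices-maximal C
    }

  weight : (V → V → ℕ) → ∀ {a b} → SaturatedChain a b → ℕ
  weight w ε                   = 0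
  weight w (_◅_ {a} {b} _ C) = w a b + weight w C

  weight-◅◅ : ∀ w {a b c} (C : SaturatedChain a b) (D : SaturatedChain b c) → weight w (C ◅◅ D) ≡ weight w C
      + weight w D
  weight-◅◅ w ε D = refl
  weight-◅◅ w (_◅_ {a} {b} _ C) D = trans (cong (w a b +_) (weight-◅◅ w C D)) (sym (+-assoc (w a b) _ _))

  length-vertices : ∀ {a b} (C : SaturatedChain a b) → length (vertices C) ≡ suc (weight (λ _ _ → 1) C)
  length-vertices ε       = refl
  length-vertices (_ ◅ C) = cong suc (length-vertices C)

  rank : V → ℕ
  rank a = weight (λ _ _ → 1) (someChain P a)

  -- Two saturated chains from 0̂ to `b` are compared: the chosen one, and the chosen one to `a`
  -- prolonged by the cover.
  rank-cover : ∀ {a b} → a ⋖ b → rank b ≡ suc (rank a)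
  rank-cover {a} {b} a⋖b = suc-injective (trans (sym (length-vertices C)) (trans
    (ranked ⊥₋ b (vertices C) (vertices D) (vertices-isMaximalChain C) (vertices-isMaximalChain D))
    (trans (length-vertices D) (cong suc (trans (weight-◅◅ _ (someChain P a) (a⋖b ◅ ε)) (+-comm (rank a) 1))))))
    where
    C = someChain P b
    D = someChain P a ◅◅ (a⋖b ◅ ε)

  cover-induction : (Q : V → Set) → Q ⊥₋ → (∀ {a b} → a ⋖ b → Q a → Q b) → ∀ a → Q a
  cover-induction Q base step a = go (someChain P a) base
    where
    go : ∀ {a b} → SaturatedChain a b → Q a → Q b
    go ε         q = q
    go (a⋖c ◅ C) q = go C (step a⋖c q)

  -- The local form of descent-compatibility: the descents along covers are the increments of a
  -- potential. Such a potential is unique up to its value at 0̂.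
  IsLevel : Permutation′ n → (V → ℕ) → Set
  IsLevel τ d = ∀ {a b} → a ⋖ b → d b ≡ d a + descent P τ a b

  isLevel-des : ∀ {τ d} → IsLevel τ d → ∀ {a b} (C : SaturatedChain a b) → d b ≡ d a + des P τ C
  isLevel-des {τ} {d} lev {a} ε = sym (+-identityʳ (d a))
  isLevel-des {τ} {d} lev {a} (_◅_ {j = c} a⋖c C) =
    trans (isLevel-des {d = d} lev C) (trans (cong (_+ des P τ C) (lev a⋖c)) (+-assoc (d a) _ _))

  isLevel⇒descentCompatible : ∀ {τ d} → IsLevel τ d → DescentCompatible P τ
  isLevel⇒descentCompatible {τ} {d} lev a C D =
    +-cancelˡ-≡ (d ⊥₋) _ _ (trans (sym (isLevel-des {d = d} lev C)) (isLevel-des {d = d} lev D))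

  isLevel⇒desAt : ∀ {τ d} → d ⊥₋ ≡ 0 → IsLevel τ d → ∀ a → d a ≡ desAt P τ a
  isLevel⇒desAt {τ} {d} d⊥ lev a = trans (isLevel-des {d = d} lev (someChain P a)) (cong (_+ desAt P τ a) d⊥)

  des≡weight : ∀ {τ a b} (C : SaturatedChain a b) → des P τ C ≡ weight (descent P τ) C
  des≡weight ε = refl
  des≡weight {τ} (_◅_ {a} {c} _ C) = cong (descent P τ a c +_) (des≡weight C)

  desAt-isLevel : ∀ {τ} → DescentCompatible P τ → IsLevel τ (desAt P τ)
  desAt-isLevel {τ} dc {a} {⊥₋} (a≺⊥ , _) = contradiction (label-mono P a≺⊥) λ ()
  desAt-isLevel {τ} dc {a} {[ b ]₋} a⋖b = begin
    des P τ (someChain P [ b ]₋)        ≡⟨ dc b (someChain P [ b ]₋) (someChain P a ◅◅ (a⋖b ◅ ε)) ⟩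
    des P τ (someChain P a ◅◅ (a⋖b ◅ ε)) ≡⟨ des≡weight (someChain P a ◅◅ (a⋖b ◅ ε)) ⟩
    weight w (someChain P a ◅◅ (a⋖b ◅ ε)) ≡⟨ weight-◅◅ w (someChain P a) (a⋖b ◅ ε) ⟩
    weight w (someChain P a) + (w a [ b ]₋ + 0)
        ≡⟨ cong₂ _+_ (sym (des≡weight (someChain P a))) (+-identityʳ _) ⟩
    desAt P τ a + w a [ b ]₋ ∎
    where
    open ≡-Reasoning
    w = descent P τ

  descent-down : ∀ τ {a b} → value P τ b < value P τ a → descent P τ a b ≡ 1
  descent-down τ {a} {b} lt rewrite dec-true (value P τ b <? value P τ a) lt = refl

  descent-up : ∀ τ {a b} → value P τ a < value P τ b → descent P τ a b ≡ 0
  descent-up τ {a} {b} lt rewrite dec-false (value P τ b <? value P τ a) (<-asym lt) = refl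

  descent≤1 : ∀ τ a b → descent P τ a b ≤ 1
  descent≤1 τ a b with does (value P τ b <? value P τ a)
  ... | true  = ≤-refl
  ... | false = z≤n

  value-injective : ∀ τ {a b} → value P τ a ≡ value P τ b → a ≡ b
  value-injective τ {⊥₋} {⊥₋} e = refl
  value-injective τ {[ a ]₋} {[ b ]₋} e = cong [_]₋ (permute-injective τ (Fin.toℕ-injective (suc-injective e)))

  label-injective : ∀ {a b} → label P a ≡ label P b → a ≡ b
  label-injective {⊥₋} {⊥₋} e = refl
  label-injective {[ a ]₋} {[ b ]₋} e = cong [_]₋ (Fin.toℕ-injective (suc-injective e))

  cover⇒≢ : ∀ {a b} → a ⋖ b → a ≢ b
  cover⇒≢ ((_ , a≢b) , _) = a≢b

  -- Labels grow at every step of a chain, so there are at most that many descents. The bound keeps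
  -- `n ∸ desAt P τ a` from being truncated in `levelKey`.
  desAt≤label : ∀ τ a → desAt P τ a ≤ label P a
  desAt≤label τ a = subst (_≤ label P a) (+-identityʳ _) (go (someChain P a))
    where
    go : ∀ {a b} (C : SaturatedChain a b) → des P τ C + label P a ≤ label P b
    go ε = ≤-refl
    go {a} {b} (_◅_ {j = c} a⋖c C) = begin
      descent P τ a c + des P τ C + label P
          a   ≤⟨ +-monoˡ-≤ (label P a) (+-monoˡ-≤ (des P τ C) (descent≤1 τ a c)) ⟩
      suc (des P τ C + label P a)               ≡⟨ +-suc (des P τ C) (label P a) ⟨
      des P τ C + suc (label P a)               ≤⟨ +-monoʳ-≤ (des P τ C) (label-mono P (proj₁ a⋖c)) ⟩
      des P τ C + label P c                     ≤⟨ go C ⟩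
      label P b                                 ∎
      where open ≤-Reasoning

  open Encoding n public

  -- Along the word of τ, the descents of levelKey are the Lipschitz descents.
  levelKey : Permutation′ n → V → ℕ
  levelKey τ a = encode (n ∸ desAt P τ a) (label P a)

  colour : V → Bool
  colour a = odd (rank a)

  colour-cover : ∀ {a b} → a ⋖ b → colour b ≡ not (colour a)
  colour-cover a⋖b = cong odd (rank-cover a⋖b)

  colourKey : V → ℕ
  colourKey a = encode (bit (colour a)) (label P a)

  colourKey-injective : ∀ {a b} → colourKey a ≡ colourKey b → a ≡ b
  colourKey-injective {a} {b} e = label-injective
      (proj₂ (encode-injective {bit (colour a)} {bit (colour b)} (label≤n P a) (label≤n P b) e))

  levelKey-injective : ∀ τ {a b} → levelKey τ a ≡ levelKey τ b → a ≡ b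
  levelKey-injective τ {a} {b} e = label-injective
      (proj₂ (encode-injective {n ∸ desAt P τ a} {n ∸ desAt P τ b} (label≤n P a) (label≤n P b) e))

  desAt≤n : ∀ τ a → desAt P τ a ≤ n
  desAt≤n τ a = ≤-trans (desAt≤label τ a) (label≤n P a)

-- Division with remainder

-- Division with remainder in {1,…,k} instead of {0,…,k-1}; only 0 has remainder 0.
upperDivision : ∀ k f → (k ≡ 0 → f ≡ 0) → ∃ λ d → ∃ λ c → f ≡ k * d + c × c ≤ k × (c ≡ 0 → d ≡ 0)
upperDivision k       zero    h = 0 , 0 , sym (trans (+-identityʳ _) (*-zeroʳ k)) , z≤n , λ _ → refl
upperDivision zero    (suc f) h = contradiction (h refl) λ ()
upperDivision (suc k) (suc f) h = f / suc k , suc (f % suc k) , division , m%n<n f (suc k) , λ ()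
  where
  division : suc f ≡ suc k * (f / suc k) + suc (f % suc k)
  division = trans (cong suc (trans (m≡m%n+[m/n]*n f (suc k))
      (trans (+-comm (f % suc k) _) (cong (_+ f % suc k) (*-comm (f / suc k) (suc k))))))
                   (sym (+-suc _ _))

module _ {k : ℕ} where

  k*[1+d] : ∀ d → k * suc d ≡ k * d + k
  k*[1+d] d = trans (*-suc k d) (+-comm k (k * d))

  module _ {d d′ c c′ : ℕ} (c≤k : c ≤ k) (c′-zero : c′ ≡ 0 → d′ ≡ 0) where

    -- The value can fail to grow with the quotient only if `c′` is 0, and remainder 0 is reserved
    -- for quotient 0.
    upper-<⇒≱ : d < d′ → ¬ (k * d′ + c′ ≤ k * d + c)
    upper-<⇒≱ d<d′ le = contradiction (subst (d <_) (c′-zero c′≡0) d<d′) λ ()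
      where
      c′≡0 : c′ ≡ 0
      c′≡0 = n≤0⇒n≡0 (+-cancelˡ-≤ (k * d′) c′ 0 (begin
        k * d′ + c′  ≤⟨ le ⟩
        k * d + c    ≤⟨ +-monoʳ-≤ (k * d) c≤k ⟩
        k * d + k    ≡⟨ k*[1+d] d ⟨
        k * suc d    ≤⟨ *-monoʳ-≤ k d<d′ ⟩
        k * d′       ≡⟨ +-identityʳ (k * d′) ⟨
        k * d′ + 0   ∎))
        where open ≤-Reasoning

  upperDivision-unique : ∀ {d d′ c c′} → c ≤ k → c′ ≤ k → (c ≡ 0 → d ≡ 0) → (c′ ≡ 0 → d′ ≡ 0) →
    k * d + c ≡ k * d′ + c′ → d ≡ d′ × c ≡ c′
  upperDivision-unique {d} {d′} {c} {c′} c≤k c′≤k z z′ e with <-cmp d d′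
  ... | tri< d<d′ _ _ = contradiction (≤-reflexive (sym e)) (upper-<⇒≱ c≤k z′ d<d′)
  ... | tri≈ _ refl _ = refl , +-cancelˡ-≡ (k * d) c c′ e
  ... | tri> _ _ d′<d = contradiction (≤-reflexive e) (upper-<⇒≱ c′≤k z d′<d)

  -- The increments 0 and k both leave the remainder unchanged, so the alternatives differ at c = c′
  -- only in the quotient. There `levelKey`, which decreases with the level, has to decide the
  -- order.
  upperDivision-step : ∀ {d d′ c c′} → c ≤ k → c′ ≤ k → (c ≡ 0 → d ≡ 0) → (c′ ≡ 0 → d′ ≡ 0) →
    k * d + c ≤ k * d′ + c′ → k * d′ + c′ ≤ k * d + c + k → (d′ ≡ d × c ≤ c′) ⊎ (d′ ≡ suc d × c′ ≤ c)
  upperDivision-step {d} {d′} {c} {c′} c≤k c′≤k z z′ le le′ with <-cmp d d′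
  ... | tri> _ _ d′<d = contradiction le (upper-<⇒≱ c′≤k z d′<d)
  ... | tri≈ _ refl _ = inj₁ (refl , +-cancelˡ-≤ (k * d) c c′ le)
  ... | tri< d<d′ _ _ with m≤n⇒m<n∨m≡n d<d′
  ... | inj₁ 1+d<d′ = contradiction le″ (upper-<⇒≱ c≤k z′ 1+d<d′)
    where
    le″ : k * d′ + c′ ≤ k * suc d + c
    le″ = ≤-trans le′ (≤-reflexive (trans (+-assoc (k * d) c k) (trans (cong (k * d +_) (+-comm c k))
      (trans (sym (+-assoc (k * d) k c)) (cong (_+ c) (sym (k*[1+d] d)))))))
  ... | inj₂ refl = inj₂ (refl , +-cancelˡ-≤ (k * suc d) c′ c
      (≤-trans le′ (≤-reflexive (trans (+-assoc (k * d) c k) (trans (cong (k * d +_) (+-comm c k))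
      (trans (sym (+-assoc (k * d) k c)) (cong (_+ c) (sym (k*[1+d] d)))))))))

  module _ {d d′ c c′ : ℕ} (c≤k : c ≤ k) where

    division-< : d < d′ → suc k * d + c < suc k * d′ + c′
    division-< d<d′ = begin-strict
      suc k * d + c          <⟨ +-monoʳ-< (suc k * d) (s≤s c≤k) ⟩
      suc k * d + suc k      ≡⟨ +-comm (suc k * d) (suc k) ⟩
      suc k + suc k * d      ≡⟨ *-suc (suc k) d ⟨
      suc k * suc d          ≤⟨ *-monoʳ-≤ (suc k) d<d′ ⟩
      suc k * d′             ≤⟨ m≤m+n (suc k * d′) c′ ⟩
      suc k * d′ + c′        ∎
      where open ≤-Reasoning

  division-unique : ∀ {d d′ c c′} → c ≤ k → c′ ≤ k → suc k * d + c ≡ suc k * d′ + c′ → c ≡ c′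
  division-unique {d} {d′} {c} {c′} c≤k c′≤k e with <-cmp d d′
  ... | tri< d<d′ _ _ = contradiction e (<⇒≢ (division-< c≤k d<d′))
  ... | tri≈ _ refl _ = +-cancelˡ-≡ (suc k * d) c c′ e
  ... | tri> _ _ d′<d = contradiction (sym e) (<⇒≢ (division-< c′≤k d′<d))

  -- The admissible increments β,...,k+β form a complete system of residues modulo k+1. Hence the
  -- conditions on the remainders in the two cases exclude each other, and no tie is left to the
  -- quotients.
  division-step : ∀ {d d′ c c′ β} → c ≤ k → c′ ≤ k → β ≤ 1 →
    suc k * d + c + β ≤ suc k * d′ + c′ → suc k * d′ + c′ ≤ suc k * d + c + k + β →
    (d′ ≡ d × c + β ≤ c′) ⊎ (d′ ≡ suc d × suc c′ ≤ c + β)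
  division-step {d} {d′} {c} {c′} {β} c≤k c′≤k β≤1 le le′ with <-cmp d d′
  ... | tri> _ _ d′<d = contradiction (≤-trans (m≤m+n _ β) le) (<⇒≱ (division-< c′≤k d′<d))
  ... | tri≈ _ refl _ = inj₁ (refl , +-cancelˡ-≤ (suc k * d) (c + β) c′
      (≤-trans (≤-reflexive (sym (+-assoc (suc k * d) c β))) le))
  ... | tri< d<d′ _ _ with m≤n⇒m<n∨m≡n d<d′
  ... | inj₁ 1+d<d′ = contradiction (≤-trans le′ le″) (<⇒≱ (division-< c≤k 1+d<d′))
    where
    open ≤-Reasoning
    le″ : suc k * d + c + k + β ≤ suc k * suc d + c
    le″ = begin
      suc k * d + c + k + β     ≡⟨ +-assoc (suc k * d + c) k β ⟩
      suc k * d + c + (k + β)   ≤⟨ +-monoʳ-≤ (suc k * d + c)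
          (≤-trans (+-monoʳ-≤ k β≤1) (≤-reflexive (+-comm k 1))) ⟩
      suc k * d + c + suc k     ≡⟨ +-comm (suc k * d + c) (suc k) ⟩
      suc k + (suc k * d + c)   ≡⟨ +-assoc (suc k) (suc k * d) c ⟨
      suc k + suc k * d + c     ≡⟨ cong (_+ c) (*-suc (suc k) d) ⟨
      suc k * suc d + c         ∎
  ... | inj₂ refl = inj₂ (refl , +-cancelˡ-≤ (suc k * d + k) (suc c′) (c + β) (begin
      suc k * d + k + suc c′     ≡⟨ +-suc (suc k * d + k) c′ ⟩
      suc (suc k * d + k + c′)   ≡⟨ cong (_+ c′)
          (trans (sym (+-suc (suc k * d) k)) (+-comm (suc k * d) (suc k))) ⟩
      suc k + suc k * d + c′     ≡⟨ cong (_+ c′) (*-suc (suc k) d) ⟨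
      suc k * suc d + c′         ≤⟨ le′ ⟩
      suc k * d + c + k + β      ≡⟨ cong (_+ β)
          (trans (+-assoc (suc k * d) c k)
          (trans (cong (suc k * d +_) (+-comm c k)) (sym (+-assoc (suc k * d) k c)))) ⟩
      suc k * d + k + c + β      ≡⟨ +-assoc (suc k * d + k) c β ⟩
      suc k * d + k + (c + β)    ∎))
    where open ≤-Reasoning

-- Lattice points of the dilated Lipschitz polytope

module Equidistribution {n : ℕ} (P : NaturallyLabeledPoset n) (ranked : Order.Ranked (_≼̌_ P)) where

  open Poset P ranked

  DC-distinct : AllPairs (λ σ τ → ¬ σ ≈ τ) (DC P)
  DC-distinct = AllPairs.filter⁺ (descentCompatible? P) (permutations-distinct n)

  DC⇒compatible : ∀ {τ} → τ ∈ DC P → DescentCompatible P τ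
  DC⇒compatible τ∈ = proj₂ (∈-filter⁻ (descentCompatible? P) {xs = permutations n} τ∈)

  infix 4 _⊏_
  _⊏_ : ℕ × ℕ → ℕ × ℕ → Set
  (c , κ) ⊏ (c′ , κ′) = c < c′ ⊎ (c ≡ c′ × κ < κ′)

  ⊏⇒⋣ : ∀ {x y} → x ⊏ y → ¬ (y ⊑ x)
  ⊏⇒⋣ (inj₁ p)          (inj₁ q)          = <-asym p q
  ⊏⇒⋣ (inj₁ p)          (inj₂ (refl , _)) = n≮n _ p
  ⊏⇒⋣ (inj₂ (refl , _)) (inj₁ q)          = n≮n _ q
  ⊏⇒⋣ (inj₂ (refl , p)) (inj₂ (_ , q))    = <⇒≱ p q

  Ordered : Permutation′ n → (V → ℕ) → (V → ℕ) → Set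
  Ordered τ c κ = ∀ {x y} → value P τ x < value P τ y → (c x , κ x) ⊑ (c y , κ y)

  ordered⁻ : ∀ {τ c κ} → Ordered τ c κ → ∀ {x y} → x ≢ y → (c x , κ x) ⊏ (c y , κ y) → value P τ x < value P τ y
  ordered⁻ {τ} ord {x} {y} x≢y lt with <-cmp (value P τ x) (value P τ y)
  ... | tri< p _ _ = p
  ... | tri≈ _ e _ = contradiction (value-injective τ e) x≢y
  ... | tri> _ _ q = contradiction (ord q) (⊏⇒⋣ lt)

  module _ (c κ : V → ℕ) {M : ℕ} (κ≤M : ∀ x → κ x ≤ M) (κ-injective : ∀ {x y} → κ x ≡ κ y → x ≡ y)
           (bottom : ∀ a → (c ⊥₋ , κ ⊥₋) ⊑ (c [ a ]₋ , κ [ a ]₋)) where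
    private
      module E = Encoding M

      code : Fin n → ℕ
      code a = E.encode (c [ a ]₋) (κ [ a ]₋)

      code-injective : ∀ {a b} → code a ≡ code b → a ≡ b
      code-injective {a} {b} e = []-injective
          (κ-injective (proj₂ (E.encode-injective {c [ a ]₋} {c [ b ]₋} (κ≤M _) (κ≤M _) e)))

    -- Only the elements of `Fin n` are sorted, as 0̂ has value 0 under every permutation; `bottom`
    -- makes this agree with the order of the pairs.
    sortingPermutationᵥ : ∃ λ σ → σ ∈ permutations n × Ordered σ c κ
    sortingPermutationᵥ with sortingPermutation code code-injective
    ... | σ , σ∈ , mono = σ , σ∈ , ordered
      where
      ordered : Ordered σ c κ
      ordered {x}      {⊥₋}     ()
      ordered {⊥₋}     {[ b ]₋} _ = bottom b
      ordered {[ a ]₋} {[ b ]₋} (s≤s a<b) with <-cmp (code a) (code b)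
      ... | tri< p _ _ with E.encode-<⁻ {c [ a ]₋} {c [ b ]₋} (κ≤M [ b ]₋) p
      ... | inj₁ q = inj₁ q
      ... | inj₂ (e , q) = inj₂ (e , <⇒≤ q)
      ordered {[ a ]₋} {[ b ]₋} (s≤s a<b) | tri≈ _ e _ = contradiction
          (cong (λ i → toℕ (σ ⟨$⟩ʳ i)) (code-injective e)) (<⇒≢ a<b)
      ordered {[ a ]₋} {[ b ]₋} (s≤s a<b) | tri> _ _ q = contradiction (mono q) (<-asym a<b)

  extend : (Fin n → ℕ) → V → ℕ
  extend f ⊥₋     = 0
  extend f [ a ]₋ = f a

  module LatticePoints (K k κ₀ : ℕ) (κ : Permutation′ n → V → ℕ) (κ-⊥ : ∀ τ → κ τ ⊥₋ ≡ κ₀) where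

    open Points (DC P) DC-distinct K k κ₀ (λ τ a → κ τ [ a ]₋) (λ τ a → desAt P τ [ a ]₋) public

    record Decomposition (f : V → ℕ) : Set where
      field
        τ       : Permutation′ n
        τ∈DC    : τ ∈ DC P
        c       : V → ℕ
        c-⊥     : c ⊥₋ ≡ 0
        c≤k     : ∀ x → c x ≤ k
        ordered : Ordered τ c (κ τ)
        f≡      : ∀ x → f x ≡ K * desAt P τ x + c x

    valid⇒ordered : ∀ {τ c} → Valid τ c → Ordered τ (extend c) (κ τ)
    valid⇒ordered v {x}      {⊥₋}     ()
    valid⇒ordered {τ} v {⊥₋} {[ b ]₋} _ = subst (λ z → (0 , z) ⊑ _) (sym (κ-⊥ τ)) (Valid.lower v b)
    valid⇒ordered v {[ a ]₋} {[ b ]₋} (s≤s a<b) = Valid.sorted v a<b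

    points⇒decomposition : ∀ {v} → v ∈ points → Decomposition (extend (lookup v))
    points⇒decomposition v∈ with ∈-points⁻ v∈
    ... | τ , c , τ∈ , valid , e = record
      { τ       = τ
      ; τ∈DC    = τ∈
      ; c       = extend c
      ; c-⊥     = refl
      ; c≤k     = λ { ⊥₋ → z≤n ; [ a ]₋ → Valid.upper valid a }
      ; ordered = valid⇒ordered valid
      ; f≡      = λ { ⊥₋ → sym (trans (+-identityʳ (K * 0)) (*-zeroʳ K)) ; [ a ]₋ → e a }
      }

    decomposition⇒points : ∀ {v} → Decomposition (extend (lookup v)) → v ∈ points
    decomposition⇒points {v} D = ∈-points⁺ {τ = τ} {c = λ a → c [ a ]₋} τ∈DC (record
      { lower  = λ a → subst₂ (λ x y → (x , y) ⊑ (c [ a ]₋ , κ τ [ a ]₋)) c-⊥ (κ-⊥ τ)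
          (ordered {⊥₋} {[ a ]₋} (s≤s z≤n))
      ; upper  = λ a → c≤k [ a ]₋
      ; sorted = λ a<b → ordered (s≤s a<b)
      }) (λ a → f≡ [ a ]₋)
      where open Decomposition D

  module _ (k : ℕ) where

    -- The moduli k and k+1 differ, but both families use the residues 0,...,k. Their fibres are
    -- therefore counted by the same function `strictly n k`.
    module X = LatticePoints k k (encode n 0) levelKey (λ _ → refl)
    module Y = LatticePoints (suc k) k 0 (λ _ → colourKey) (λ _ → refl)

    X-unique : Unique X.points
    X-unique = X.points-unique (λ τ e → []-injective (levelKey-injective τ e)) recover
      where
      -- The key of 0̂ has the largest possible first component n. While the residue is still 0 the
      -- key may not fall, so the level must be 0; this is the convention of `upperDivision`.
      level-zero : ∀ {τ c} → X.Valid τ c → ∀ a → c a ≡ 0 → desAt P τ [ a ]₋ ≡ 0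
      level-zero {τ} v a e with X.Valid.lower v a
      ... | inj₁ 0<c = contradiction (sym e) (<⇒≢ 0<c)
      ... | inj₂ (_ , le) with encode-≤⁻ {n} {n ∸ desAt P τ [ a ]₋} (label≤n P [ a ]₋) le
      ... | inj₁ lt = contradiction (m∸n≤m n (desAt P τ [ a ]₋)) (<⇒≱ lt)
      ... | inj₂ (e′ , _) = trans (sym (m∸[m∸n]≡n (desAt≤n τ [ a ]₋))) (trans (cong (n ∸_) (sym e′)) (n∸n≡0 n))
      recover : ∀ {σ τ c c′} → X.Valid σ c → X.Valid τ c′ →
        (∀ a → k * desAt P σ [ a ]₋ + c a ≡ k * desAt P τ [ a ]₋ + c′ a) → ∀ a → c a ≡ c′ a × levelKey σ [ a
            ]₋ ≡ levelKey τ [ a ]₋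
      recover v v′ e a with upperDivision-unique (X.Valid.upper v a) (X.Valid.upper v′ a) (level-zero v a)
          (level-zero v′ a) (e a)
      ... | d≡ , c≡ = c≡ , cong (λ d → encode (n ∸ d) (label P [ a ]₋)) d≡

    Y-unique : Unique Y.points
    Y-unique = Y.points-unique (λ τ e → []-injective (colourKey-injective e))
      (λ v v′ e a → division-unique {d = _} {d′ = _} (Y.Valid.upper v a) (Y.Valid.upper v′ a) (e a) , refl)

    Lipschitz : (V → ℕ) → Set
    Lipschitz f = ∀ {a b} → a ⋖ b → f a ≤ f b × f b ≤ f a + k

    -- The translate of a Lipschitz function by ⌊rank/2⌋.
    Shifted : (V → ℕ) → Set
    Shifted f = ∀ {a b} → a ⋖ b → f a + bit (colour a) ≤ f b × f b ≤ f a + k + bit (colour a)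

    X⇒Lipschitz : ∀ {f} → X.Decomposition f → Lipschitz f
    X⇒Lipschitz {f} D {a} {b} a⋖b rewrite X.Decomposition.f≡ D a | X.Decomposition.f≡ D b | desAt-isLevel
        (DC⇒compatible (X.Decomposition.τ∈DC D)) a⋖b
      with <-cmp (value P (X.Decomposition.τ D) a) (value P (X.Decomposition.τ D) b)
    ... | tri< lt _ _ rewrite descent-up (X.Decomposition.τ D) lt | +-identityʳ
        (desAt P (X.Decomposition.τ D) a) =
      +-monoʳ-≤ (k * d) (⊑⇒≤ (ordered lt)) , ≤-trans (+-monoʳ-≤ (k * d) (c≤k b))
          (+-monoˡ-≤ k (m≤m+n (k * d) (c a)))
      where
      open X.Decomposition D
      d = desAt P τ a
    ... | tri≈ _ e _ = contradiction (value-injective (X.Decomposition.τ D) e) (cover⇒≢ a⋖b)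
    ... | tri> _ _ gt rewrite descent-down (X.Decomposition.τ D) gt | +-comm
        (desAt P (X.Decomposition.τ D) a) 1 | k*[1+d] {k} (desAt P (X.Decomposition.τ D) a) =
      ≤-trans (+-monoʳ-≤ (k * d) (c≤k a)) (m≤m+n (k * d + k) (c b)) ,
      ≤-trans (+-monoʳ-≤ (k * d + k) (⊑⇒≤ (ordered gt)))
          (≤-reflexive (trans (+-assoc (k * d) k (c a))
          (trans (cong (k * d +_) (+-comm k (c a))) (sym (+-assoc (k * d) (c a) k)))))
      where
      open X.Decomposition D
      d = desAt P τ a

    module FromLipschitz {f : V → ℕ} (f⊥ : f ⊥₋ ≡ 0) (lip : Lipschitz f) where

      -- For k = 0 the bounds make `f` constant along covers. This supplies the side condition of
      -- `upperDivision`.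
      zero-k : k ≡ 0 → ∀ x → f x ≡ 0
      zero-k refl = cover-induction (λ x → f x ≡ 0) f⊥ λ {a} {b} a⋖b e →
        n≤0⇒n≡0 (≤-trans (proj₂ (lip a⋖b)) (≤-reflexive (trans (+-identityʳ (f a)) e)))

      division = λ x → upperDivision k (f x) (λ e → zero-k e x)

      d c κ : V → ℕ
      d x = proj₁ (division x)
      c x = proj₁ (proj₂ (division x))
      κ x = encode (n ∸ d x) (label P x)

      f≡ : ∀ x → f x ≡ k * d x + c x
      f≡ x = proj₁ (proj₂ (proj₂ (division x)))

      c≤k : ∀ x → c x ≤ k
      c≤k x = proj₁ (proj₂ (proj₂ (proj₂ (division x))))

      c-zero : ∀ x → c x ≡ 0 → d x ≡ 0
      c-zero x = proj₂ (proj₂ (proj₂ (proj₂ (division x))))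

      c-⊥ : c ⊥₋ ≡ 0
      c-⊥ = m+n≡0⇒n≡0 (k * d ⊥₋) (trans (sym (f≡ ⊥₋)) f⊥)

      d-⊥ : d ⊥₋ ≡ 0
      d-⊥ = c-zero ⊥₋ c-⊥

      step : ∀ {a b} → a ⋖ b → (d b ≡ d a × c a ≤ c b) ⊎ (d b ≡ suc (d a) × c b ≤ c a)
      step {a} {b} a⋖b = upperDivision-step (c≤k a) (c≤k b) (c-zero a) (c-zero b)
        (subst₂ _≤_ (f≡ a) (f≡ b) (proj₁ (lip a⋖b)))
        (subst₂ (λ x y → x ≤ y + k) (f≡ b) (f≡ a) (proj₂ (lip a⋖b)))

      -- Wanted before `d` is identified with `desAt`: the sorting by `κ` that produces σ already
      -- relies on `n ∸ d x` falling strictly as the quotient rises.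
      d≤label : ∀ x → d x ≤ label P x
      d≤label = cover-induction (λ x → d x ≤ label P x) (≤-reflexive d-⊥) λ {a} {b} a⋖b le →
        ≤-trans (d≤suc (step a⋖b)) (≤-trans (s≤s le) (label-mono P (proj₁ a⋖b)))
        where
        d≤suc : ∀ {a b} → (d b ≡ d a × c a ≤ c b) ⊎ (d b ≡ suc (d a) × c b ≤ c a) → d b ≤ suc (d a)
        d≤suc (inj₁ (e , _)) = m≤n⇒m≤1+n (≤-reflexive e)
        d≤suc (inj₂ (e , _)) = ≤-reflexive e

      bottom : ∀ a → (c ⊥₋ , κ ⊥₋) ⊑ (c [ a ]₋ , κ [ a ]₋)
      bottom a with m≤n⇒m<n∨m≡n (z≤n {c [ a ]₋})
      ... | inj₁ 0<c = inj₁ (subst (_< c [ a ]₋) (sym c-⊥) 0<c)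
      ... | inj₂ 0≡c = inj₂ (trans c-⊥ 0≡c , subst₂ (λ p q → encode (n ∸ p) 0 ≤ encode (n ∸ q) (label P [ a ]₋))
              (sym d-⊥) (sym (c-zero [ a ]₋ (sym 0≡c))) (+-monoˡ-≤ (n * suc n) z≤n))

      sorting = sortingPermutationᵥ c κ (λ x → encode-≤ (m∸n≤m n (d x)) (label≤n P x))
        (λ {x} {y} e → label-injective
            (proj₂ (encode-injective {n ∸ d x} {n ∸ d y} (label≤n P x) (label≤n P y) e))) bottom

      σ = proj₁ sorting

      ordered : Ordered σ c κ
      ordered = proj₂ (proj₂ sorting)

      level : IsLevel σ d
      level {a} {b} a⋖b with step a⋖b
      ... | inj₁ (e , ca≤cb) = trans e
          (sym (trans (cong (d a +_) (descent-up σ (ordered⁻ {σ} {c} {κ} ordered (cover⇒≢ a⋖b) lt)))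
          (+-identityʳ (d a))))
        where
        lt : (c a , κ a) ⊏ (c b , κ b)
        lt with m≤n⇒m<n∨m≡n ca≤cb
        ... | inj₁ c< = inj₁ c<
        -- Equal remainders and equal quotients: the labels decide, and by natural labelling `a`
        -- comes first.
        ... | inj₂ c≡ = inj₂ (c≡ , subst (λ p → κ a < encode (n ∸ p) (label P b)) (sym e)
            (+-monoˡ-< ((n ∸ d a) * suc n) (label-mono P (proj₁ a⋖b))))
      ... | inj₂ (e , cb≤ca) = trans e
          (sym (trans (cong (d a +_) (descent-down σ (ordered⁻ {σ} {c} {κ} ordered (cover⇒≢ a⋖b ∘ sym) lt)))
          (+-comm (d a) 1)))
        where
        lt : (c b , κ b) ⊏ (c a , κ a)
        lt with m≤n⇒m<n∨m≡n cb≤ca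
        ... | inj₁ c< = inj₁ c<
        -- Equal remainders with a raised quotient: the higher level has the smaller key, so `b`
        -- comes first, which makes the cover a descent.
        ... | inj₂ c≡ = inj₂ (c≡ , encode-< (label≤n P b)
            (∸-monoʳ-< (≤-reflexive (sym e)) (≤-trans (d≤label b) (label≤n P b))))

      decomposition : X.Decomposition f
      decomposition = record
        { τ       = σ
        ; τ∈DC    = ∈-filter⁺ (descentCompatible? P) (proj₁ (proj₂ sorting))
            (isLevel⇒descentCompatible {d = d} level)
        ; c       = c
        ; c-⊥     = c-⊥
        ; c≤k     = c≤k
        ; ordered = λ {x} {y} lt → subst₂ (λ p q → (c x , p) ⊑ (c y , q)) (κ≡ x) (κ≡ y) (ordered lt)
        ; f≡      = λ x → trans (f≡ x) (cong (λ p → k * p + c x) (isLevel⇒desAt {d = d} d-⊥ level x))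
        }
        where
        κ≡ : ∀ x → κ x ≡ levelKey σ x
        κ≡ x = cong (λ p → encode (n ∸ p) (label P x)) (isLevel⇒desAt {d = d} d-⊥ level x)

    bit≤1 : ∀ γ → bit γ ≤ 1
    bit≤1 true  = ≤-refl
    bit≤1 false = z≤n

    colourKey-up : ∀ {a b} → a ⋖ b → colour a ≡ false → colourKey a < colourKey b
    colourKey-up {a} {b} a⋖b e = encode-< (label≤n P a)
        (subst₂ (λ p q → bit p < bit q) (sym e) (sym (trans (colour-cover a⋖b) (cong not e))) ≤-refl)

    colourKey-down : ∀ {a b} → a ⋖ b → colour a ≡ true → colourKey b < colourKey a
    colourKey-down {a} {b} a⋖b e = encode-< (label≤n P b)
        (subst₂ (λ p q → bit p < bit q) (sym (trans (colour-cover a⋖b) (cong not e))) (sym e) ≤-refl)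

    colour-cases : ∀ a → colour a ≡ false ⊎ colour a ≡ true
    colour-cases a with colour a
    ... | false = inj₁ refl
    ... | true  = inj₂ refl

    module _ (c : V → ℕ) {a b : V} (a⋖b : a ⋖ b) where
      private
        low : colour a ≡ false → c a + bit (colour a) ≡ c a
        low e = trans (cong (λ γ → c a + bit γ) e) (+-identityʳ (c a))

        high : colour a ≡ true → c a + bit (colour a) ≡ suc (c a)
        high e = trans (cong (λ γ → c a + bit γ) e) (+-comm (c a) 1)

      -- From an even rank the key rises along the cover and equal residues are allowed; from an odd
      -- rank it falls and the residue has to grow. The parity bit is exactly this difference.
      ⊑⇒gap : (c a , colourKey a) ⊑ (c b , colourKey b) → c a + bit (colour a) ≤ c b
      ⊑⇒gap p with colour-cases a | p
      ... | inj₁ e | p            = ≤-trans (≤-reflexive (low e)) (⊑⇒≤ p)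
      ... | inj₂ e | inj₁ q       = ≤-trans (≤-reflexive (high e)) q
      ... | inj₂ e | inj₂ (_ , q) = contradiction q (<⇒≱ (colourKey-down a⋖b e))

      ⊒⇒gap : (c b , colourKey b) ⊑ (c a , colourKey a) → suc (c b) ≤ c a + bit (colour a)
      ⊒⇒gap p with colour-cases a | p
      ... | inj₂ e | p            = ≤-trans (s≤s (⊑⇒≤ p)) (≤-reflexive (sym (high e)))
      ... | inj₁ e | inj₁ q       = ≤-trans q (≤-reflexive (sym (low e)))
      ... | inj₁ e | inj₂ (_ , q) = contradiction q (<⇒≱ (colourKey-up a⋖b e))

      gap⇒⊏ : c a + bit (colour a) ≤ c b → (c a , colourKey a) ⊏ (c b , colourKey b)
      gap⇒⊏ le with colour-cases a
      ... | inj₂ e = inj₁ (≤-trans (≤-reflexive (sym (high e))) le)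
      ... | inj₁ e with m≤n⇒m<n∨m≡n (≤-trans (≤-reflexive (sym (low e))) le)
      ... | inj₁ q = inj₁ q
      ... | inj₂ q = inj₂ (q , colourKey-up a⋖b e)

      gap⇒⊐ : suc (c b) ≤ c a + bit (colour a) → (c b , colourKey b) ⊏ (c a , colourKey a)
      gap⇒⊐ le with colour-cases a
      ... | inj₁ e = inj₁ (≤-trans le (≤-reflexive (low e)))
      ... | inj₂ e with m≤n⇒m<n∨m≡n (s≤s⁻¹ (≤-trans le (≤-reflexive (high e))))
      ... | inj₁ q = inj₁ q
      ... | inj₂ q = inj₂ (q , colourKey-down a⋖b e)

    Y⇒Shifted : ∀ {f} → Y.Decomposition f → Shifted f
    Y⇒Shifted {f} D {a} {b} a⋖b = subst₂ (λ x y → x + bit (colour a) ≤ y × y ≤ x + k + bit (colour a))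
        (sym (f≡ a)) (sym f≡b) (bounds (<-cmp (value P τ a) (value P τ b)))
      where
      open Y.Decomposition D
      d = desAt P τ a
      β = bit (colour a)
      f≡b : f b ≡ suc k * (d + descent P τ a b) + c b
      f≡b = trans (f≡ b) (cong (λ m → suc k * m + c b) (desAt-isLevel (DC⇒compatible τ∈DC) a⋖b))
      bounds : Tri (value P τ a < value P τ b) (value P τ a ≡ value P τ b) (value P τ b < value P τ a) →
        suc k * d + c a + β ≤ suc k * (d + descent P τ a b) + c b ×
        suc k * (d + descent P τ a b) + c b ≤ suc k * d + c a + k + β
      bounds (tri≈ _ e _) = contradiction (value-injective τ e) (cover⇒≢ a⋖b)
      bounds (tri< lt _ _) rewrite descent-up τ lt | +-identityʳ d =
        ≤-trans (≤-reflexive (+-assoc (suc k * d) (c a) β)) (+-monoʳ-≤ (suc k * d) (⊑⇒gap c a⋖b (ordered lt))) ,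
        ≤-trans (+-mono-≤ (m≤m+n (suc k * d) (c a)) (c≤k b)) (m≤m+n (suc k * d + c a + k) β)
      bounds (tri> _ _ gt) = subst (λ m → suc k * d + c a + β ≤ m + c b × m + c b ≤ suc k * d + c a + k + β)
          (sym (trans (cong (suc k *_) (trans (cong (d +_) (descent-down τ gt)) (+-comm d 1)))
              (*-suc (suc k) d)))
          (lower , upper)
        where
        open ≤-Reasoning
        lower : suc k * d + c a + β ≤ suc k + suc k * d + c b
        lower = begin
          suc k * d + c a + β    ≤⟨ +-mono-≤ (+-monoʳ-≤ (suc k * d) (c≤k a)) (bit≤1 (colour a)) ⟩
          suc k * d + k + 1      ≡⟨ trans (+-assoc (suc k * d) k 1)
              (trans (cong (suc k * d +_) (+-comm k 1)) (+-comm (suc k * d) (suc k))) ⟩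
          suc k + suc k * d      ≤⟨ m≤m+n _ (c b) ⟩
          suc k + suc k * d + c b ∎
        upper : suc k + suc k * d + c b ≤ suc k * d + c a + k + β
        upper = begin
          suc k + suc k * d + c b     ≡⟨ cong (λ m → suc m + c b) (+-comm k (suc k * d)) ⟩
          suc (suc k * d + k + c b)   ≡⟨ +-suc (suc k * d + k) (c b) ⟨
          suc k * d + k + suc (c b)   ≤⟨ +-monoʳ-≤ (suc k * d + k) (⊒⇒gap c a⋖b (ordered gt)) ⟩
          suc k * d + k + (c a + β)   ≡⟨ +-assoc (suc k * d + k) (c a) β ⟨
          suc k * d + k + c a + β     ≡⟨ cong (_+ β)
              (trans (+-assoc (suc k * d) k (c a))
              (trans (cong (suc k * d +_) (+-comm k (c a))) (sym (+-assoc (suc k * d) (c a) k)))) ⟩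
          suc k * d + c a + k + β     ∎

    module FromShifted {f : V → ℕ} (f⊥ : f ⊥₋ ≡ 0) (shifted : Shifted f) where

      d c : V → ℕ
      d x = f x / suc k
      c x = f x % suc k

      f≡ : ∀ x → f x ≡ suc k * d x + c x
      f≡ x = trans (m≡m%n+[m/n]*n (f x) (suc k)) (trans (+-comm (c x) _) (cong (_+ c x) (*-comm (d x) (suc k))))

      c≤k : ∀ x → c x ≤ k
      c≤k x = s≤s⁻¹ (m%n<n (f x) (suc k))

      d-⊥ : d ⊥₋ ≡ 0
      d-⊥ = cong (_/ suc k) f⊥

      c-⊥ : c ⊥₋ ≡ 0
      c-⊥ = cong (_% suc k) f⊥

      step : ∀ {a b} → a ⋖ b →
        (d b ≡ d a × c a + bit (colour a) ≤ c b) ⊎ (d b ≡ suc (d a) × suc (c b) ≤ c a + bit (colour a))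
      step {a} {b} a⋖b = division-step (c≤k a) (c≤k b) (bit≤1 (colour a))
        (subst₂ (λ x y → x + bit (colour a) ≤ y) (f≡ a) (f≡ b) (proj₁ (shifted a⋖b)))
        (subst₂ (λ x y → y ≤ x + k + bit (colour a)) (f≡ a) (f≡ b) (proj₂ (shifted a⋖b)))

      bottom : ∀ a → (c ⊥₋ , colourKey ⊥₋) ⊑ (c [ a ]₋ , colourKey [ a ]₋)
      bottom a with m≤n⇒m<n∨m≡n (z≤n {c [ a ]₋})
      ... | inj₁ 0<c = inj₁ (subst (_< c [ a ]₋) (sym c-⊥) 0<c)
      ... | inj₂ 0≡c = inj₂ (trans c-⊥ 0≡c , z≤n)

      sorting = sortingPermutationᵥ c colourKey (λ x → encode-≤ (bit≤1 (colour x)) (label≤n P x))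
          colourKey-injective bottom

      σ = proj₁ sorting

      ordered : Ordered σ c colourKey
      ordered = proj₂ (proj₂ sorting)

      level : IsLevel σ d
      level {a} {b} a⋖b with step a⋖b
      ... | inj₁ (e , gap) = trans e
          (sym (trans (cong (d a +_) (descent-up σ
          (ordered⁻ {σ} {c} {colourKey} ordered (cover⇒≢ a⋖b) (gap⇒⊏ c a⋖b gap)))) (+-identityʳ (d a))))
      ... | inj₂ (e , gap) = trans e
          (sym (trans (cong (d a +_) (descent-down σ
          (ordered⁻ {σ} {c} {colourKey} ordered (cover⇒≢ a⋖b ∘ sym) (gap⇒⊐ c a⋖b gap)))) (+-comm (d a) 1)))

      decomposition : Y.Decomposition f
      decomposition = record
        { τ       = σ
        ; τ∈DC    = ∈-filter⁺ (descentCompatible? P) (proj₁ (proj₂ sorting))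
            (isLevel⇒descentCompatible {d = d} level)
        ; c       = c
        ; c-⊥     = c-⊥
        ; c≤k     = c≤k
        ; ordered = ordered
        ; f≡      = λ x → trans (f≡ x) (cong (λ p → suc k * p + c x) (isLevel⇒desAt {d = d} d-⊥ level x))
        }

    half : V → ℕ
    half x = ⌊ rank x /2⌋

    half-cover : ∀ {a b} → a ⋖ b → half b ≡ half a + bit (colour a)
    half-cover {a} a⋖b = trans (cong ⌊_/2⌋ (rank-cover a⋖b)) (half-suc (rank a))

    -- Both sides start at or above 0 and `half` grows along a cover only by the increment forced on
    -- `f`. It ensures that `shiftDown` never truncates.
    half≤ : ∀ {f} → Shifted f → ∀ x → half x ≤ f x
    half≤ {f} sh = cover-induction (λ x → half x ≤ f x) z≤n λ {a} a⋖b le →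
      ≤-trans (≤-reflexive (half-cover a⋖b)) (≤-trans (+-monoˡ-≤ (bit (colour a)) le) (proj₁ (sh a⋖b)))

    private
      exchange : ∀ x y z → x + y + z ≡ x + z + y
      exchange x y z = trans (+-assoc x y z) (trans (cong (x +_) (+-comm y z)) (sym (+-assoc x z y)))

    Lipschitz⇒Shifted : ∀ {f} → Lipschitz f → Shifted (λ x → f x + half x)
    Lipschitz⇒Shifted {f} lip {a} {b} a⋖b rewrite half-cover a⋖b =
      ≤-trans (≤-reflexive (+-assoc (f a) (half a) β)) (+-monoˡ-≤ (half a + β) (proj₁ (lip a⋖b))) ,
      ≤-trans (+-monoˡ-≤ (half a + β) (proj₂ (lip a⋖b)))
          (≤-reflexive (trans (sym (+-assoc (f a + k) (half a) β)) (cong (_+ β) (exchange (f a) k (half a)))))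
      where β = bit (colour a)

    Shifted⇒Lipschitz : ∀ {f} → Shifted (λ x → f x + half x) → Lipschitz f
    Shifted⇒Lipschitz {f} sh {a} {b} a⋖b with sh a⋖b
    ... | p , q rewrite half-cover a⋖b =
      +-cancelʳ-≤ (half a + β) (f a) (f b) (≤-trans (≤-reflexive (sym (+-assoc (f a) (half a) β))) p) ,
      +-cancelʳ-≤ (half a + β) (f b) (f a + k)
          (≤-trans q (≤-reflexive (sym (trans (sym (+-assoc (f a + k) (half a) β))
          (cong (_+ β) (exchange (f a) k (half a)))))))
      where β = bit (colour a)

    shiftUp shiftDown : Vec ℕ n → Vec ℕ n
    shiftUp   v = tabulate (λ a → lookup v a + half [ a ]₋)
    shiftDown v = tabulate (λ a → lookup v a ∸ half [ a ]₋)

    extend-shiftUp : ∀ v x → extend (lookup v) x + half x ≡ extend (lookup (shiftUp v)) x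
    extend-shiftUp v ⊥₋     = refl
    extend-shiftUp v [ a ]₋ = sym (lookup∘tabulate _ a)

    shiftUp-injective : ∀ {u v} → shiftUp u ≡ shiftUp v → u ≡ v
    shiftUp-injective {u} {v} e = lookup-ext λ a → +-cancelʳ-≡ (half [ a ]₋) _ _
      (trans (sym (lookup∘tabulate _ a)) (trans (cong (λ w → lookup w a) e) (lookup∘tabulate _ a)))

    Shifted-resp : ∀ f g → (∀ x → f x ≡ g x) → Shifted f → Shifted g
    Shifted-resp f g e sh {a} {b} a⋖b =
      subst₂ (λ x y → x + bit (colour a) ≤ y × y ≤ x + k + bit (colour a)) (e a) (e b) (sh a⋖b)

    X⇒Y : ∀ {v} → v ∈ X.points → shiftUp v ∈ Y.points
    X⇒Y {v} v∈ = Y.decomposition⇒points {shiftUp v}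
        (FromShifted.decomposition {f = extend (lookup (shiftUp v))} refl
      (Shifted-resp (λ x → extend (lookup v) x + half x) (extend (lookup (shiftUp v))) (extend-shiftUp v)
        (Lipschitz⇒Shifted {extend (lookup v)}
            (X⇒Lipschitz {extend (lookup v)} (X.points⇒decomposition {v} v∈)))))

    module _ {v} (v∈ : v ∈ Y.points) where
      private
        sh : Shifted (extend (lookup v))
        sh = Y⇒Shifted {extend (lookup v)} (Y.points⇒decomposition {v} v∈)

        restore : ∀ x → extend (lookup (shiftDown v)) x + half x ≡ extend (lookup v) x
        restore ⊥₋     = refl
        restore [ a ]₋ = trans (cong (_+ half [ a ]₋) (lookup∘tabulate _ a))
            (m∸n+n≡m (half≤ {extend (lookup v)} sh [ a ]₋))

      Y⇒X : shiftDown v ∈ X.points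
      Y⇒X = X.decomposition⇒points {shiftDown v}
          (FromLipschitz.decomposition {f = extend (lookup (shiftDown v))} refl
        (Shifted⇒Lipschitz {extend (lookup (shiftDown v))}
          (Shifted-resp (extend (lookup v)) (λ x → extend (lookup (shiftDown v)) x + half x) (sym ∘ restore)
              sh)))

      shiftUp-shiftDown : shiftUp (shiftDown v) ≡ v
      shiftUp-shiftDown = lookup-ext (λ a → trans (sym (extend-shiftUp (shiftDown v) [ a ]₋)) (restore [ a ]₋))

    lengths-agree : length X.points ≡ length Y.points
    lengths-agree = trans (sym (length-map shiftUp X.points))
        (↭-length (unique∧⇔⇒↭ (Unique.map⁺ shiftUp-injective X-unique) Y-unique to from))
      where
      to : ∀ {v} → v ∈ map shiftUp X.points → v ∈ Y.points
      to v∈ with ∈-map⁻ shiftUp v∈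
      ... | u , u∈ , refl = X⇒Y u∈
      from : ∀ {v} → v ∈ Y.points → v ∈ map shiftUp X.points
      from v∈ = subst (_∈ map shiftUp X.points) (shiftUp-shiftDown v∈) (∈-map⁺ shiftUp (Y⇒X v∈))

  levelDescents colourDescents : Permutation′ n → ℕ
  levelDescents  τ = keyDescents (encode n 0) (toList (tabulate (λ i → levelKey τ [ τ ⟨$⟩ˡ i ]₋)))
  colourDescents τ = keyDescents 0 (toList (tabulate (λ i → colourKey [ τ ⟨$⟩ˡ i ]₋)))

  equidistributed : ∀ i → count i (map levelDescents (DC P)) ≡ count i (map colourDescents (DC P))
  equidistributed = sums-determine-counts n (map levelDescents (DC P)) (map colourDescents (DC P)) sums-agree
    where
    open ≡-Reasoning
    sums-agree : ∀ k → sum (map (strictly n k) (map levelDescents (DC P))) ≡ sum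
        (map (strictly n k) (map colourDescents (DC P)))
    sums-agree k = begin
      sum (map (strictly n k) (map levelDescents (DC P)))   ≡⟨ cong sum
          (map-∘ {g = strictly n k} {f = levelDescents} (DC P)) ⟨
      sum (map (λ τ → strictly n k (levelDescents τ)) (DC P)) ≡⟨ X.length-points k ⟨
      length (X.points k)                                   ≡⟨ lengths-agree k ⟩
      length (Y.points k)                                   ≡⟨ Y.length-points k ⟩
      sum (map (λ τ → strictly n k (colourDescents τ)) (DC P))
          ≡⟨ cong sum (map-∘ {g = strictly n k} {f = colourDescents} (DC P)) ⟩
      sum (map (strictly n k) (map colourDescents (DC P)))  ∎

-- Words of descent-compatible permutations

module _ {A : Set} where

  predecessor : ∀ {m} → A → (Fin m → A) → Fin m → A
  predecessor x f zero    = x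
  predecessor x f (suc i) = predecessor (f zero) (f ∘ suc) i

  desFrom-tabulate : ∀ (κ : A → ℕ) {m} x (f : Fin m → A) →
    keyDescents (κ x) (toList (tabulate (κ ∘ f))) ≡ Descents.desFrom κ x (List.tabulate f)
  desFrom-tabulate κ {zero}  x f = refl
  desFrom-tabulate κ {suc m} x f = cong (Descents.step κ x (f zero) +_) (desFrom-tabulate κ (f zero) (f ∘ suc))

  desFrom-filter : ∀ (κ : A → ℕ) {m} x (f : Fin m → A) →
    Descents.desFrom κ x (List.tabulate f) ≡
    length (filter (λ (y , z) → κ z <? κ y) (List.tabulate λ i → predecessor x f i , f i))
  desFrom-filter κ {zero}  x f = refl
  desFrom-filter κ {suc m} x f with does (κ (f zero) <? κ x)
  ... | true  = cong suc (desFrom-filter κ (f zero) (f ∘ suc))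
  ... | false = desFrom-filter κ (f zero) (f ∘ suc)

  predecessor-value : ∀ (v : A → ℕ) {m} k x (f : Fin m → A) → v x ≡ k → (∀ i → v (f i) ≡ suc (k + toℕ i)) →
    ∀ i → v (predecessor x f i) ≡ k + toℕ i
  predecessor-value v k x f e h zero    = trans e (sym (+-identityʳ k))
  predecessor-value v k x f e h (suc i) =
    trans (predecessor-value v (suc k) (f zero) (f ∘ suc) (trans (h zero) (cong suc (+-identityʳ k)))
      (λ j → trans (h (suc j)) (cong suc (+-suc k (toℕ j)))) i) (sym (+-suc k (toℕ i)))

module Words {n : ℕ} (P : NaturallyLabeledPoset n) (ranked : Order.Ranked (_≼̌_ P)) where

  open Poset P ranked
  open Equidistribution P ranked using
      (levelDescents; colourDescents; equidistributed; DC-distinct; DC⇒compatible)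

  letter : Permutation′ n → Fin n → V
  letter τ i = [ τ ⟨$⟩ˡ i ]₋

  word : Permutation′ n → List V
  word τ = List.tabulate (letter τ)

  permute⁻¹-injective : ∀ (τ : Permutation′ n) {i j} → τ ⟨$⟩ˡ i ≡ τ ⟨$⟩ˡ j → i ≡ j
  permute⁻¹-injective τ e = trans (sym (inverseʳ τ)) (trans (cong (τ ⟨$⟩ʳ_) e) (inverseʳ τ))

  value-letter : ∀ τ i → value P τ (letter τ i) ≡ suc (toℕ i)
  value-letter τ i = cong (suc ∘ toℕ) (inverseʳ τ)

  adjacent : Permutation′ n → List (V × V)
  adjacent τ = List.tabulate λ i → predecessor ⊥₋ (letter τ) i , letter τ i

  adjacent-unique : ∀ τ → Unique (adjacent τ)
  adjacent-unique τ = Unique.tabulate⁺ (permute⁻¹-injective τ ∘ []-injective ∘ cong proj₂)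

  value-predecessor : ∀ τ i → value P τ (predecessor ⊥₋ (letter τ) i) ≡ toℕ i
  value-predecessor τ = predecessor-value (value P τ) 0 ⊥₋ (letter τ) refl (value-letter τ)

  ∈-adjacent⁻ : ∀ τ {x y} → (x , y) ∈ adjacent τ → suc (value P τ x) ≡ value P τ y
  ∈-adjacent⁻ τ p with ∈-tabulate⁻ p
  ... | i , refl = trans (cong suc (value-predecessor τ i)) (sym (value-letter τ i))

  ∈-adjacent⁺ : ∀ τ {x y} → suc (value P τ x) ≡ value P τ y → (x , y) ∈ adjacent τ
  ∈-adjacent⁺ τ {x} {[ b ]₋} e = subst (_∈ adjacent τ)
    (cong₂ _,_ (value-injective τ (trans (value-predecessor τ i) (suc-injective (sym e))))
        (cong [_]₋ (inverseˡ τ)))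
    (∈-tabulate⁺ i)
    where i = τ ⟨$⟩ʳ b

  elements-unique : Unique (elements P)
  elements-unique = All.map⁺ (All.universal (λ _ ()) (allFin n)) ∷ Unique.map⁺ []-injective (Unique.allFin⁺ n)

  ∈-elements : ∀ x → x ∈ elements P
  ∈-elements ⊥₋     = here refl
  ∈-elements [ a ]₋ = there (∈-map⁺ [_]₋ (∈-allFin a))

  -- Pairs with consecutive values are the adjacent letters of the word begun by 0̂, and subtraction
  -- from n turns a rise of the level into a fall of the key.
  Ldes≡levelDescents : ∀ τ → Ldes P τ ≡ levelDescents τ
  Ldes≡levelDescents τ = trans (↭-length (unique∧⇔⇒↭
      (Unique.filter⁺ (lipschitzDescent? P τ) (Unique.cartesianProduct⁺ elements-unique elements-unique))
      (Unique.filter⁺ descent? (adjacent-unique τ)) to from))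
    (sym (trans (desFrom-tabulate (levelKey τ) ⊥₋ (letter τ)) (desFrom-filter (levelKey τ) ⊥₋ (letter τ))))
    where
    descent? = λ ((x , y) : V × V) → levelKey τ y <? levelKey τ x
    key⇒ : ∀ x y → levelKey τ y < levelKey τ x → desAt P τ x < desAt P τ y ⊎
        (desAt P τ x ≡ desAt P τ y × label P x > label P y)
    key⇒ x y lt with encode-<⁻ {n ∸ desAt P τ y} {n ∸ desAt P τ x} (label≤n P x) lt
    ... | inj₁ q = inj₁ (∸-cancelʳ-< q)
    ... | inj₂ (e , q) = inj₂ (∸-cancelˡ-≡ (desAt≤n τ x) (desAt≤n τ y) (sym e) , q)
    ⇒key : ∀ x y → desAt P τ x < desAt P τ y ⊎ (desAt P τ x ≡ desAt P τ y × label P x > label P y) → levelKey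
        τ y < levelKey τ x
    ⇒key x y (inj₁ q) = encode-< (label≤n P y) (∸-monoʳ-< q (desAt≤n τ y))
    ⇒key x y (inj₂ (e , q)) = subst (λ d → encode (n ∸ d) (label P y) < levelKey τ x) e
        (+-monoˡ-< ((n ∸ desAt P τ x) * suc n) q)
    to : ∀ {p} → p ∈ filter (lipschitzDescent? P τ) (cartesianProduct (elements P) (elements P)) → p ∈ filter
        descent? (adjacent τ)
    to {x , y} p∈ with ∈-filter⁻ (lipschitzDescent? P τ) {xs = cartesianProduct (elements P) (elements P)} p∈
    ... | _ , e , q = ∈-filter⁺ descent? (∈-adjacent⁺ τ e) (⇒key x y q)
    from : ∀ {p} → p ∈ filter descent? (adjacent τ) → p ∈ filter (lipschitzDescent? P τ)
        (cartesianProduct (elements P) (elements P))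
    from {x , y} p∈ with ∈-filter⁻ descent? {xs = adjacent τ} p∈
    ... | p∈′ , q = ∈-filter⁺ (lipschitzDescent? P τ) (∈-cartesianProduct⁺ (∈-elements x) (∈-elements y))
        (∈-adjacent⁻ τ p∈′ , key⇒ x y q)

  colourDescents≡desFrom : ∀ τ → colourDescents τ ≡ Descents.desFrom colourKey ⊥₋ (word τ)
  colourDescents≡desFrom τ = desFrom-tabulate colourKey ⊥₋ (letter τ)

-- Rotation of the cyclic word

module _ {A : Set} where

  Before-tabulate⁻ : ∀ {m} {x y : A} (f : Fin m → A) → Before x y (List.tabulate f) → ∃ λ i → ∃ λ j → i Fin.<
      j × x ≡ f i × y ≡ f j
  Before-tabulate⁻ {suc m} f (here y∈) with ∈-tabulate⁻ y∈
  ... | j , e = zero , suc j , s≤s z≤n , refl , e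
  Before-tabulate⁻ {suc m} f (there p) with Before-tabulate⁻ (f ∘ suc) p
  ... | i , j , i<j , e , e′ = suc i , suc j , s≤s i<j , e , e′

  Before-tabulate⁺ : ∀ {m} (f : Fin m → A) {i j} → i Fin.< j → Before (f i) (f j) (List.tabulate f)
  Before-tabulate⁺ f {zero}  {suc j} _         = here (∈-tabulate⁺ j)
  Before-tabulate⁺ f {suc i} {suc j} (s≤s i<j) = there (Before-tabulate⁺ (f ∘ suc) i<j)

  tabulate-injective : ∀ {m} {f g : Fin m → A} → List.tabulate f ≡ List.tabulate g → ∀ i → f i ≡ g i
  tabulate-injective e zero    = ∷-injectiveˡ e
  tabulate-injective e (suc i) = tabulate-injective (∷-injectiveʳ e) i

  tabulate-unique⁻ : ∀ {m} {f : Fin m → A} → Unique (List.tabulate f) → ∀ {i j} → f i ≡ f j → i ≡ j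
  tabulate-unique⁻ u {zero} {zero} e = refl
  tabulate-unique⁻ (x∉ ∷ u) {zero} {suc j} e = contradiction e (All.lookup x∉ (∈-tabulate⁺ j))
  tabulate-unique⁻ (x∉ ∷ u) {suc i} {zero} e = contradiction (sym e) (All.lookup x∉ (∈-tabulate⁺ i))
  tabulate-unique⁻ (x∉ ∷ u) {suc i} {suc j} e = cong suc (tabulate-unique⁻ u e)

  tabulation : ∀ {m} (xs : List A) → length xs ≡ m → ∃ λ (f : Fin m → A) → List.tabulate f ≡ xs
  tabulation xs refl = List.lookup xs , tabulate-lookup xs

  split-at-unique : ∀ {z : A} {us vs us′ vs′} → z ∉ us → z ∉ us′ → us ++ z ∷ vs ≡ us′ ++ z ∷ vs′ → us ≡ us′ ×
      vs ≡ vs′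
  split-at-unique {us = []}    {us′ = []}     _ _ e = refl , ∷-injectiveʳ e
  split-at-unique {us = []}    {us′ = x ∷ _}  _ z∉ e = contradiction (here (∷-injectiveˡ e)) z∉
  split-at-unique {us = x ∷ _} {us′ = []}     z∉ _ e = contradiction (here (sym (∷-injectiveˡ e))) z∉
  split-at-unique {us = x ∷ us} {us′ = x′ ∷ us′} z∉ z∉′ e with ∷-injectiveˡ e | split-at-unique (z∉ ∘ there)
      (z∉′ ∘ there) (∷-injectiveʳ e)
  ... | refl | refl , e′ = refl , e′

module Rotation {n : ℕ} (P : NaturallyLabeledPoset n) (ranked : Order.Ranked (_≼̌_ P)) where

  open Poset P ranked
  open Equidistribution P ranked using
      (levelDescents; colourDescents; equidistributed; DC-distinct; DC⇒compatible; bit≤1)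
  open Words P ranked

  module ≼ = DPO P

  colour-key : ∀ {x y} → colour x ≡ false → colour y ≡ true → colourKey x < colourKey y
  colour-key {x} {y} e e′ = encode-< (label≤n P x) (subst₂ (λ p q → bit p < bit q) (sym e) (sym e′) ≤-refl)

  open Runs ≼._≟_ colourKey (λ {x} {y} → colourKey-injective {x} {y}) colour (λ {x} {y} → colour-key {x} {y})
  open Descents colourKey
  open DecMembership ≼._≟_ using (_∈?_)

  Low High : V → Set
  Low x  = colour x ≡ false
  High x = colour x ≡ true

  low⇒¬high : ∀ x → Low x → ¬ High x
  low⇒¬high x l h with trans (sym l) h
  ... | ()

  bottom-low : Low ⊥₋
  bottom-low = refl

  -- Splits off the longest suffix of low letters. Cyclically, this suffix belongs to the run of 0̂.
  trailing : List V → List V × List V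
  trailing [] = [] , []
  trailing (x ∷ w) with trailing w | colour x
  ... | [] , us | false = [] , x ∷ us
  ... | [] , us | true  = [ x ] , us
  ... | v ∷ vs , us | _ = x ∷ v ∷ vs , us

  trailing-++ : ∀ w → proj₁ (trailing w) ++ proj₂ (trailing w) ≡ w
  trailing-++ [] = refl
  trailing-++ (x ∷ w) with trailing w | colour x | trailing-++ w
  ... | [] , us | false | e = cong (x ∷_) e
  ... | [] , us | true  | e = cong (x ∷_) e
  ... | v ∷ vs , us | _ | e = cong (x ∷_) e

  trailing⊆ : ∀ w {x} → x ∈ proj₂ (trailing w) → x ∈ w
  trailing⊆ w {x} p = subst (x ∈_) (trailing-++ w) (∈-++⁺ʳ (proj₁ (trailing w)) p)

  trailing-low : ∀ w → All Low (proj₂ (trailing w))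
  trailing-low [] = []
  trailing-low (x ∷ w) with trailing w | colour x in c | trailing-low w
  ... | [] , us | false | l = c ∷ l
  ... | [] , us | true  | l = l
  ... | v ∷ vs , us | _ | l = l

  trailing-endsHigh : ∀ w → proj₁ (trailing w) ≡ [] ⊎ EndsHigh (proj₁ (trailing w))
  trailing-endsHigh [] = inj₁ refl
  trailing-endsHigh (x ∷ w) with trailing w | colour x in c | trailing-endsHigh w
  ... | [] , us | false | _ = inj₁ refl
  ... | [] , us | true  | _ = inj₂ (here c)
  ... | v ∷ vs , us | _ | inj₂ h = inj₂ (there h)

  trailing-all : ∀ {us} → All Low us → trailing us ≡ ([] , us)
  trailing-all [] = refl
  trailing-all (l ∷ ls) rewrite trailing-all ls | l = refl

  trailing-unique : ∀ {vs us} → EndsHigh vs → All Low us → trailing (vs ++ us) ≡ (vs , us)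
  trailing-unique {x ∷ []} {us} (here h) l rewrite trailing-all l | h = refl
  trailing-unique {x ∷ v ∷ vs} (there h) l rewrite trailing-unique h l = refl

  -- The cyclic word is cut so that the run through 0̂ is not split.
  rotate : List V → List V
  rotate w = proj₂ (trailing w) ++ ⊥₋ ∷ proj₁ (trailing w)

  rotate-++ : ∀ {vs us} → EndsHigh vs → All Low us → rotate (vs ++ us) ≡ us ++ ⊥₋ ∷ vs
  rotate-++ h l = cong (λ t → proj₂ t ++ ⊥₋ ∷ proj₁ t) (trailing-unique h l)

  rotate-↭ : ∀ w → rotate w ↭ ⊥₋ ∷ w
  rotate-↭ w = ↭-trans (shift ⊥₋ (proj₂ (trailing w)) (proj₁ (trailing w)))
    (prep ⊥₋ (↭-trans (++-comm (proj₂ (trailing w)) (proj₁ (trailing w))) (↭-reflexive (trailing-++ w))))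

  rotate-injective : ∀ {w w′} → ⊥₋ ∉ w → ⊥₋ ∉ w′ → rotate w ≡ rotate w′ → w ≡ w′
  rotate-injective {w} {w′} ⊥∉ ⊥∉′ e with split-at-unique (⊥∉ ∘ trailing⊆ w) (⊥∉′ ∘ trailing⊆ w′) e
  ... | us≡ , vs≡ = trans (sym (trailing-++ w)) (trans (cong₂ _++_ vs≡ us≡) (trailing-++ w′))

  bottom<letter : ∀ {x} → x ≢ ⊥₋ → colourKey ⊥₋ < colourKey x
  bottom<letter {⊥₋}     ne = contradiction refl ne
  bottom<letter {[ a ]₋} ne = s≤s z≤n

  desFrom-bottom : ∀ x us vs → All (_≢ ⊥₋) (x ∷ us) → desFrom x (us ++ ⊥₋ ∷ vs) ≡ desFrom x us + suc
      (desFrom ⊥₋ vs)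
  desFrom-bottom x []       vs (ne ∷ []) = cong (_+ desFrom ⊥₋ vs) (step-down {x} {⊥₋} (bottom<letter ne))
  desFrom-bottom x (u ∷ us) vs (_ ∷ nes) = trans (cong (step x u +_) (desFrom-bottom u us vs nes))
      (sym (+-assoc (step x u) _ _))

  desFrom-endsHigh : ∀ x vs u us → EndsHigh vs → Low u → desFrom x (vs ++ u ∷ us) ≡ desFrom x vs + suc
      (desFrom u us)
  desFrom-endsHigh x (v ∷ []) u us (here h) l rewrite step-down {v} {u} (colour-key {u} {v} l h) |
      +-identityʳ (step x v) = refl
  desFrom-endsHigh x (v ∷ v′ ∷ vs) u us (there h) l = trans
      (cong (step x v +_) (desFrom-endsHigh v (v′ ∷ vs) u us h l)) (sym (+-assoc (step x v) _ _))

  -- If the low suffix is not empty, rotation loses the descent from the last high letter into it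
  -- and gains the descent from its last letter to 0̂, whose key is the least of all.
  des-rotate : ∀ w → All (_≢ ⊥₋) w → EndsHigh (proj₁ (trailing w)) → descents (rotate w) ≡ desFrom ⊥₋ w
  des-rotate w nes h = trans (go (proj₂ (trailing w)) (trailing-low w)
      (All.tabulate λ {x} x∈ → All.lookup nes (trailing⊆ w x∈)))
                             (cong (desFrom ⊥₋) (trailing-++ w))
    where
    vs = proj₁ (trailing w)
    go : ∀ us → All Low us → All (_≢ ⊥₋) us → descents (us ++ ⊥₋ ∷ vs) ≡ desFrom ⊥₋ (vs ++ us)
    go [] _ _ = cong (desFrom ⊥₋) (sym (++-identityʳ vs))
    go (u ∷ us) (l ∷ _) nes′ = begin
      desFrom u (us ++ ⊥₋ ∷ vs)                ≡⟨ desFrom-bottom u us vs nes′ ⟩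
      desFrom u us + suc (desFrom ⊥₋ vs)       ≡⟨ +-suc (desFrom u us) (desFrom ⊥₋ vs) ⟩
      suc (desFrom u us) + desFrom ⊥₋ vs       ≡⟨ +-comm (suc (desFrom u us)) (desFrom ⊥₋ vs) ⟩
      desFrom ⊥₋ vs + suc (desFrom u us)       ≡⟨ desFrom-endsHigh ⊥₋ vs u us h l ⟨
      desFrom ⊥₋ (vs ++ u ∷ us)                ∎
      where open ≡-Reasoning

  -- `IsLevel` expressed by the order of letters only, so that it also makes sense for words that do
  -- not begin with 0̂.
  Levelled : List V → (V → ℕ) → Set
  Levelled w d = ∀ {a b} → a ⋖ b → (Before a b w → d b ≡ d a) × (Before b a w → d b ≡ suc (d a))

  before⇒value< : ∀ τ {x y} → Before x y (⊥₋ ∷ word τ) → value P τ x < value P τ y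
  before⇒value< τ (here y∈) with ∈-tabulate⁻ y∈
  ... | j , refl = s≤s z≤n
  before⇒value< τ (there p) with Before-tabulate⁻ (letter τ) p
  ... | i , j , i<j , refl , refl = subst₂ _<_ (sym (value-letter τ i)) (sym (value-letter τ j)) (s≤s i<j)

  value<⇒before : ∀ τ {x y} → value P τ x < value P τ y → Before x y (⊥₋ ∷ word τ)
  value<⇒before τ {x}      {⊥₋}     ()
  value<⇒before τ {⊥₋}     {[ b ]₋} _ = here
      (subst (λ c → [ c ]₋ ∈ word τ) (inverseˡ τ) (∈-tabulate⁺ (τ ⟨$⟩ʳ b)))
  value<⇒before τ {[ a ]₋} {[ b ]₋} (s≤s a<b) =
    there (subst₂ (λ c d → Before [ c ]₋ [ d ]₋ (word τ)) (inverseˡ τ) (inverseˡ τ)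
        (Before-tabulate⁺ (letter τ) a<b))

  compatible⇒levelled : ∀ {τ} → DescentCompatible P τ → Levelled (⊥₋ ∷ word τ) (desAt P τ)
  compatible⇒levelled {τ} dc {a} {b} a⋖b =
    (λ p → trans (desAt-isLevel dc a⋖b)
        (trans (cong (desAt P τ a +_) (descent-up τ (before⇒value< τ p))) (+-identityʳ _))) ,
    (λ p → trans (desAt-isLevel dc a⋖b)
        (trans (cong (desAt P τ a +_) (descent-down τ (before⇒value< τ p))) (+-comm _ 1)))

  levelled⇒compatible : ∀ {τ d} → Levelled (⊥₋ ∷ word τ) d → DescentCompatible P τ
  levelled⇒compatible {τ} {d} lev = isLevel⇒descentCompatible {d = d} isLevel
    where
    isLevel : IsLevel τ d
    isLevel {a} {b} a⋖b with <-cmp (value P τ a) (value P τ b)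
    ... | tri< p _ _ = trans (proj₁ (lev a⋖b) (value<⇒before τ p))
        (sym (trans (cong (d a +_) (descent-up τ p)) (+-identityʳ (d a))))
    ... | tri≈ _ e _ = contradiction (value-injective τ e) (cover⇒≢ a⋖b)
    ... | tri> _ _ q = trans (proj₂ (lev a⋖b) (value<⇒before τ q))
        (sym (trans (cong (d a +_) (descent-down τ q)) (+-comm (d a) 1)))

  cover-colours : ∀ {a b} → a ⋖ b → colour a ≢ colour b
  cover-colours {a} {b} a⋖b e with colour a | colour b | colour-cover a⋖b
  cover-colours a⋖b () | false | true  | refl
  cover-colours a⋖b () | true  | false | refl

  -- The ends of a cover have different colours, so their order survives rearrangement inside the
  -- runs.
  levelled-resp : ∀ {d bs cs} → Alternating false bs → Pointwise _↭_ bs cs → Levelled (concat bs) d →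
      Levelled (concat cs) d
  levelled-resp {bs = bs} {cs} alt σs lev a⋖b =
    (λ p → proj₁ (lev a⋖b) (back (cover-colours a⋖b) p)) ,
        (λ p → proj₂ (lev a⋖b) (back (cover-colours a⋖b ∘ sym) p))
    where
    back : ∀ {x y} → colour x ≢ colour y → Before x y (concat cs) → Before x y (concat bs)
    back = Before-resp (alternating-resp alt σs) (Pointwise.symmetric ↭-sym σs)

  inside outside : List V → V → ℕ
  inside  us x = if does (x ∈? us) then 1 else 0
  outside us x = if does (x ∈? us) then 0 else 1

  inside-∈ : ∀ {us x} → x ∈ us → inside us x ≡ 1
  inside-∈ {us} {x} p rewrite dec-true (x ∈? us) p = refl

  inside-∉ : ∀ {us x} → x ∉ us → inside us x ≡ 0
  inside-∉ {us} {x} p rewrite dec-false (x ∈? us) p = refl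

  outside-∈ : ∀ {us x} → x ∈ us → outside us x ≡ 0
  outside-∈ {us} {x} p rewrite dec-true (x ∈? us) p = refl

  outside-∉ : ∀ {us x} → x ∉ us → outside us x ≡ 1
  outside-∉ {us} {x} p rewrite dec-false (x ∈? us) p = refl

  -- Moving a block of low letters across the end of a cyclic word changes their levels by one.
  module _ (ws us : List V) (us-low : All Low us) (disjoint : ∀ {x} → x ∈ us → x ∉ ws) where

    private
      ws⇒∉ : ∀ {x} → x ∈ ws → x ∉ us
      ws⇒∉ x∈ws x∈us = disjoint x∈us x∈ws

      no-cover : ∀ {a b x y} → a ⋖ b → (x ≡ a × y ≡ b) ⊎ (x ≡ b × y ≡ a) → ¬ Before x y us
      no-cover a⋖b (inj₁ (refl , refl)) p = cover-colours a⋖b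
          (trans (All.lookup us-low (proj₁ (Before-∈ p))) (sym (All.lookup us-low (proj₂ (Before-∈ p)))))
      no-cover a⋖b (inj₂ (refl , refl)) p = cover-colours a⋖b
          (trans (All.lookup us-low (proj₂ (Before-∈ p))) (sym (All.lookup us-low (proj₁ (Before-∈ p)))))

    -- No cover has both ends in `us`, since its letters have one colour. Only covers with exactly
    -- one end in `us` are reversed, and raising `us` by one compensates for that.
    levelled-toFront : ∀ {d} → Levelled (ws ++ us) d → Levelled (us ++ ws) (λ x → d x + inside us x)
    levelled-toFront {d} lev {a} {b} a⋖b = up , down
      where
      up : Before a b (us ++ ws) → d b + inside us b ≡ d a + inside us a
      up p with Before-++⁻ us p
      ... | inj₁ q = contradiction q (no-cover a⋖b (inj₁ (refl , refl)))
      ... | inj₂ (inj₁ (a∈ , b∈)) rewrite inside-∈ a∈ | inside-∉ (ws⇒∉ b∈) =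
        trans (+-identityʳ (d b)) (trans (proj₂ (lev a⋖b) (Before-across b∈ a∈)) (+-comm 1 (d a)))
      ... | inj₂ (inj₂ q) rewrite inside-∉ (ws⇒∉ (proj₁ (Before-∈ q))) | inside-∉ (ws⇒∉ (proj₂ (Before-∈ q))) =
        cong (_+ 0) (proj₁ (lev a⋖b) (Before-++⁺ˡ us q))
      down : Before b a (us ++ ws) → d b + inside us b ≡ suc (d a + inside us a)
      down p with Before-++⁻ us p
      ... | inj₁ q = contradiction q (no-cover a⋖b (inj₂ (refl , refl)))
      ... | inj₂ (inj₁ (b∈ , a∈)) rewrite inside-∈ b∈ | inside-∉ (ws⇒∉ a∈) =
        trans (+-comm (d b) 1) (cong suc
            (trans (proj₁ (lev a⋖b) (Before-across a∈ b∈)) (sym (+-identityʳ (d a)))))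
      ... | inj₂ (inj₂ q) rewrite inside-∉ (ws⇒∉ (proj₁ (Before-∈ q))) | inside-∉ (ws⇒∉ (proj₂ (Before-∈ q))) =
        cong (_+ 0) (proj₂ (lev a⋖b) (Before-++⁺ˡ us q))

    -- Raising all letters outside `us` replaces lowering those inside, which avoids subtraction;
    -- only differences of levels matter.
    levelled-toBack : ∀ {d} → Levelled (us ++ ws) d → Levelled (ws ++ us) (λ x → d x + outside us x)
    levelled-toBack {d} lev {a} {b} a⋖b = up , down
      where
      up : Before a b (ws ++ us) → d b + outside us b ≡ d a + outside us a
      up p with Before-++⁻ ws p
      ... | inj₁ q rewrite outside-∉ (ws⇒∉ (proj₁ (Before-∈ q))) | outside-∉ (ws⇒∉ (proj₂ (Before-∈ q))) =
        cong (_+ 1) (proj₁ (lev a⋖b) (Before-++⁺ʳ us q))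
      ... | inj₂ (inj₁ (a∈ , b∈)) rewrite outside-∉ (ws⇒∉ a∈) | outside-∈ b∈ =
        trans (+-identityʳ (d b)) (trans (proj₂ (lev a⋖b) (Before-across b∈ a∈)) (+-comm 1 (d a)))
      ... | inj₂ (inj₂ q) = contradiction q (no-cover a⋖b (inj₁ (refl , refl)))
      down : Before b a (ws ++ us) → d b + outside us b ≡ suc (d a + outside us a)
      down p with Before-++⁻ ws p
      ... | inj₁ q rewrite outside-∉ (ws⇒∉ (proj₁ (Before-∈ q))) | outside-∉ (ws⇒∉ (proj₂ (Before-∈ q))) =
        cong (_+ 1) (proj₂ (lev a⋖b) (Before-++⁺ʳ us q))
      ... | inj₂ (inj₁ (b∈ , a∈)) rewrite outside-∉ (ws⇒∉ b∈) | outside-∈ a∈ =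
        trans (+-comm (d b) 1) (cong suc
            (trans (proj₁ (lev a⋖b) (Before-across a∈ b∈)) (sym (+-identityʳ (d a)))))
      ... | inj₂ (inj₂ q) = contradiction q (no-cover a⋖b (inj₂ (refl , refl)))

  word-unique : ∀ τ → Unique (word τ)
  word-unique τ = Unique.tabulate⁺ (permute⁻¹-injective τ ∘ []-injective)

  word-nonbottom : ∀ τ → All (_≢ ⊥₋) (word τ)
  word-nonbottom τ = All.tabulate⁺ λ i ()

  bottom∉word : ∀ τ → ⊥₋ ∉ word τ
  bottom∉word τ p = All.lookup (word-nonbottom τ) p refl

  bottomWord-unique : ∀ τ → Unique (⊥₋ ∷ word τ)
  bottomWord-unique τ = All.tabulate (λ {x} x∈ e → bottom∉word τ (subst (_∈ word τ) (sym e) x∈)) ∷ word-unique τ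

  word-injective : ∀ {σ τ} → word σ ≡ word τ → σ ≈ τ
  word-injective {σ} {τ} e a = trans
      (cong (σ ⟨$⟩ʳ_) (sym (trans ([]-injective (tabulate-injective e (τ ⟨$⟩ʳ a))) (inverseˡ τ)))) (inverseʳ σ)

  word-surjective : ∀ {τ w} → w ↭ word τ → ∃ λ σ → σ ∈ permutations n × word σ ≡ w
  word-surjective {τ} {w} σ↭ with ↭-map-inv [_]₋
      (↭-trans (↭-reflexive (map-tabulate (τ ⟨$⟩ˡ_) [_]₋)) (↭-sym σ↭))
  ... | ws , refl , ρ with tabulation ws (trans (sym (↭-length ρ)) (length-tabulate (τ ⟨$⟩ˡ_)))
  ... | f , refl with injective⇒permutation f
      (tabulate-unique⁻ (Unique-resp-↭ ρ (Unique.tabulate⁺ (permute⁻¹-injective τ))))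
  -- `f` gives the letter at each position, whereas a permutation gives the position of each letter;
  -- hence the inverse is taken.
  ... | π , π≡ with permutations-complete (Perm.flip π)
  ... | σ , σ∈ , σ≈ = σ , σ∈ , trans (List.tabulate-cong λ i → cong [_]₋ (inverse i))
      (sym (map-tabulate f [_]₋))
    where
    inverse : ∀ i → σ ⟨$⟩ˡ i ≡ f i
    inverse i = trans (cong (σ ⟨$⟩ˡ_)
        (sym (trans (cong (σ ⟨$⟩ʳ_) (sym (π≡ i))) (trans (σ≈ (π ⟨$⟩ʳ i)) (inverseˡ π))))) (inverseˡ σ)

unique-disjoint : ∀ {A : Set} (xs : List A) {ys x} → Unique (xs ++ ys) → x ∈ ys → x ∉ xs
unique-disjoint (z ∷ xs) (z∉ ∷ u) x∈ (here refl) = All.lookup z∉ (∈-++⁺ʳ xs x∈) refl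
unique-disjoint (z ∷ xs) (z∉ ∷ u) x∈ (there p)   = unique-disjoint xs u x∈ p

-- Run classes of descent-compatible words and the γ-positivity of their descents

module Conclusion {n m : ℕ} (n≡1+m : n ≡ suc m) (P : NaturallyLabeledPoset n)
    (ranked : Order.Ranked (_≼̌_ P)) where

  open Poset P ranked
  open Equidistribution P ranked using
      (levelDescents; colourDescents; equidistributed; DC-distinct; DC⇒compatible)
  open Words P ranked
  open Rotation P ranked

  module R = Runs (DPO._≟_ P) colourKey (λ {x} {y} → colourKey-injective {x} {y}) colour
      (λ {x} {y} → colour-key {x} {y})
  open R
  open Descents colourKey

  -- The first step of any chain from 0̂ leads to an element of rank 1. So no word consists of low
  -- letters only, and the part before the low suffix ends high.
  highLetter : ∃ λ (a : Fin n) → High [ a ]₋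
  highLetter with someChain P [ subst Fin (sym n≡1+m) zero ]₋
  ... | _◅_ {j = ⊥₋}     ⊥⋖⊥ _ = contradiction (label-mono P (proj₁ ⊥⋖⊥)) λ ()
  ... | _◅_ {j = [ a ]₋} ⊥⋖a _ = a , colour-cover ⊥⋖a

  word-endsHigh : ∀ τ → EndsHigh (proj₁ (trailing (word τ)))
  word-endsHigh τ with trailing-endsHigh (word τ)
  ... | inj₂ h = h
  ... | inj₁ e = contradiction (proj₂ highLetter)
      (low⇒¬high [ a ]₋ (All.lookup {P = Low} (trailing-low (word τ))
    (subst ([ a ]₋ ∈_) (trans (sym (trailing-++ (word τ))) (cong (_++ proj₂ (trailing (word τ))) e)) a∈word)))
    where
    a = proj₁ highLetter
    a∈word : [ a ]₋ ∈ word τ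
    a∈word = subst (λ b → [ b ]₋ ∈ word τ) (inverseˡ τ) (∈-tabulate⁺ (τ ⟨$⟩ʳ a))

  endsHigh-++ : ∀ us {vs} → EndsHigh vs → EndsHigh (us ++ vs)
  endsHigh-++ []       h = h
  endsHigh-++ (u ∷ us) h = there (endsHigh-++ us h)

  endsHigh-++⁻ : ∀ us {v vs} → EndsHigh (us ++ v ∷ vs) → EndsHigh (v ∷ vs)
  endsHigh-++⁻ []             h         = h
  endsHigh-++⁻ (u ∷ [])       (there h) = h
  endsHigh-++⁻ (u ∷ u′ ∷ us)  (there h) = endsHigh-++⁻ (u′ ∷ us) h

  alternating-endsHigh : ∀ {γ bs} → Alternating γ bs → EndsHigh (concat bs)
  alternating-endsHigh (last {x} {b} ps) = go x b ps
    where
    go : ∀ x b → All High (x ∷ b) → EndsHigh (x ∷ b ++ [])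
    go x []      (h ∷ [])  = here h
    go x (y ∷ b) (_ ∷ ps)  = there (go y b ps)
  alternating-endsHigh (next {x = x} {b} ps p) = endsHigh-++ (x ∷ b) (alternating-endsHigh p)

  rotationRuns : ∀ us vs → All Low us → EndsHigh vs → ∃ λ bs → Alternating false bs × concat bs ≡ us ++ ⊥₋ ∷ vs
  rotationRuns []       vs _       h = runs {⊥₋} {vs} (there h)
  rotationRuns (u ∷ us) vs (l ∷ _) h with runs {u} (endsHigh-++ (u ∷ us) (there {⊥₋} h))
  ... | bs , p , e = bs , subst (λ γ → Alternating γ bs) l p , e

  wordRuns : ∀ τ → ∃ λ bs → Alternating false bs × concat bs ≡ rotate (word τ)
  wordRuns τ = rotationRuns (proj₂ (trailing (word τ))) (proj₁ (trailing (word τ))) (trailing-low (word τ))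
      (word-endsHigh τ)

  rotations : List (List V)
  rotations = map (rotate ∘ word) (DC P)

  rotations-unique : Unique rotations
  rotations-unique = AllPairs.map⁺ (AllPairs.map
    (λ {σ} {τ} σ≉τ e → σ≉τ (word-injective {σ} {τ}
        (rotate-injective {word σ} {word τ} (bottom∉word σ) (bottom∉word τ) e))) DC-distinct)

  rotation-wellFormed : ∀ {u} → u ∈ rotations → ∃ λ bs → Alternating false bs × concat bs ≡ u × Unique u ×
      length u ≡ 2 + m
  rotation-wellFormed u∈ with ∈-map⁻ (rotate ∘ word) u∈
  ... | τ , _ , refl with wordRuns τ
  ... | bs , p , e = bs , p , e ,
    Unique-resp-↭ (↭-sym (rotate-↭ (word τ))) (bottomWord-unique τ) ,
    trans (↭-length (rotate-↭ (word τ))) (cong suc (trans (length-tabulate (letter τ)) n≡1+m))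

  -- Rearrangement may move 0̂ within the first run, and the new word is read off by cutting at its
  -- new place. A level function for it is obtained by moving `us` to the front, rearranging, and
  -- moving `us′` to the back.
  rotations-closed : RunClosed rotations
  rotations-closed {bs = bs} {cs} p σs bs∈ with ∈-map⁻ (rotate ∘ word) bs∈
  ... | τ , τ∈ , e with wordRuns τ
  ... | bs₀ , p₀ , e₀ with alternating-unique p p₀ (trans e (sym e₀))
  ... | refl with ∈-∃++ (∈-resp-↭
      (↭-trans (↭-sym (rotate-↭ (word τ))) (↭-trans (↭-reflexive (sym e)) (concat-↭ σs))) (here refl))
  ... | us′ , vs′ , f = finish (word-surjective {τ} w′↭word)
    where
    us = proj₂ (trailing (word τ))
    vs = proj₁ (trailing (word τ))

    cs↭word : us′ ++ ⊥₋ ∷ vs′ ↭ ⊥₋ ∷ word τ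
    cs↭word = ↭-trans (↭-reflexive (sym f))
        (↭-trans (↭-sym (concat-↭ σs)) (↭-trans (↭-reflexive e) (rotate-↭ (word τ))))

    w′↭word : vs′ ++ us′ ↭ word τ
    w′↭word = ↭-trans (++-comm vs′ us′) (drop-mid us′ [] cs↭word)

    bottom-first : ∀ {x} → High x → ¬ Before x ⊥₋ (rotate (word τ))
    bottom-first {x} h q with Before-++⁻ us q
    ... | inj₁ r = bottom∉word τ (trailing⊆ (word τ) (proj₂ (Before-∈ r)))
    ... | inj₂ (inj₁ (x∈ , _)) = low⇒¬high x (All.lookup {P = Low} (trailing-low (word τ)) x∈) h
    ... | inj₂ (inj₂ (here _)) = low⇒¬high ⊥₋ bottom-low h
    ... | inj₂ (inj₂ (there r)) = bottom∉word τ
        (subst (⊥₋ ∈_) (trailing-++ (word τ)) (∈-++⁺ˡ (proj₂ (Before-∈ r))))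

    -- A high letter in front of 0̂ would have been there before the rearrangement as well, because
    -- its colour differs from that of 0̂; `bottom-first` excludes this.
    us′-low : All Low us′
    us′-low = All.tabulate λ {x} x∈ → low x∈ (colour x) refl
      where
      low : ∀ {x} → x ∈ us′ → ∀ γ → colour x ≡ γ → Low x
      low x∈ false c = c
      low {x} x∈ true c = contradiction
        (subst (Before x ⊥₋) e (Before-resp (alternating-resp p₀ σs) (Pointwise.symmetric ↭-sym σs)
          (λ c′ → low⇒¬high ⊥₋ bottom-low (trans (sym c′) c))
          (subst (Before x ⊥₋) (sym f) (Before-across x∈ (here refl)))))
        (bottom-first c)

    vs′-endsHigh : EndsHigh vs′
    vs′-endsHigh with endsHigh-++⁻ us′ (subst EndsHigh f (alternating-endsHigh (alternating-resp p₀ σs)))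
    ... | here ()
    ... | there h = h

    level rotatedLevel : V → ℕ
    rotatedLevel x = desAt P τ x + inside us x
    level x = rotatedLevel x + outside us′ x

    rotate-levelled : Levelled (rotate (word τ)) rotatedLevel
    rotate-levelled = levelled-toFront (⊥₋ ∷ vs) us (trailing-low (word τ))
      (unique-disjoint (⊥₋ ∷ vs) (subst (λ w → Unique (⊥₋ ∷ w)) (sym (trailing-++ (word τ)))
          (bottomWord-unique τ)))
      (subst (λ w → Levelled (⊥₋ ∷ w) (desAt P τ)) (sym (trailing-++ (word τ)))
          (compatible⇒levelled (DC⇒compatible τ∈)))

    levelled : Levelled (⊥₋ ∷ vs′ ++ us′) level
    levelled = levelled-toBack (⊥₋ ∷ vs′) us′ us′-low
      (unique-disjoint (⊥₋ ∷ vs′) (Unique-resp-↭ (prep ⊥₋ (↭-sym w′↭word)) (bottomWord-unique τ)))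
      (subst (λ w → Levelled w rotatedLevel) f
          (levelled-resp p₀ σs (subst (λ w → Levelled w rotatedLevel) (sym e) rotate-levelled)))

    finish : (∃ λ σ → σ ∈ permutations n × word σ ≡ vs′ ++ us′) → concat cs ∈ rotations
    finish (σ , σ∈ , w≡) = subst (_∈ rotations) rotate≡
        (∈-map⁺ (rotate ∘ word) (∈-filter⁺ (descentCompatible? P) σ∈
      (levelled⇒compatible {d = level} (subst (λ w → Levelled (⊥₋ ∷ w) level) (sym w≡) levelled))))
      where
      rotate≡ : rotate (word σ) ≡ concat cs
      rotate≡ = begin
        rotate (word σ)      ≡⟨ cong rotate w≡ ⟩
        rotate (vs′ ++ us′)  ≡⟨ rotate-++ {vs′} {us′} vs′-endsHigh us′-low ⟩
        us′ ++ ⊥₋ ∷ vs′      ≡⟨ f ⟨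
        concat cs            ∎
        where open ≡-Reasoning

  descents-rotations : map descents rotations ≡ map colourDescents (DC P)
  descents-rotations = trans (sym (map-∘ {g = descents} {f = rotate ∘ word} (DC P))) (map-cong
    (λ τ → trans (des-rotate (word τ) (word-nonbottom τ) (word-endsHigh τ)) (sym (colourDescents≡desFrom τ)))
        (DC P))

  colourDescents-gammaPositive : GammaPositive m (map colourDescents (DC P))
  colourDescents-gammaPositive = subst (GammaPositive m) descents-rotations
    (runClosed-gammaPositive (length rotations) rotations ≤-refl rotations-unique rotations-closed
        rotation-wellFormed)

  count-map : ∀ {A : Set} (f : A → ℕ) i xs → length (filter (λ x → f x ≟ i) xs) ≡ count i (map f xs)
  count-map f i [] = refl
  count-map f i (x ∷ xs) with does (f x ≟ i)
  ... | true  = cong suc (count-map f i xs)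
  ... | false = count-map f i xs

  g≡count : ∀ i → g P i ≡ count i (map colourDescents (DC P))
  g≡count i = trans (count-map (Ldes P) i (DC P))
      (trans (cong (count i) (map-cong Ldes≡levelDescents (DC P))) (equidistributed i))

theorem4p3 : ∀ (n : ℕ) (P : NaturallyLabeledPoset n) →
    Order.Connected (NaturallyLabeledPoset._≼_ P) →
    Order.Ranked (_≼̌_ P) →
    (∀ i → i < n → g P i ≡ g P (n ∸ 1 ∸ i)) ×
    (∀ i → i < (n ∸ 1) / 2 → g P i ≤ g P (suc i))
theorem4p3 zero    P _ _ = (λ i ()) , (λ i ())
theorem4p3 (suc m) P _ ranked = symmetry , growth
  where
  open Conclusion refl P ranked
  symmetry : ∀ i → i < suc m → g P i ≡ g P (m ∸ i)
  symmetry i i<n = trans (g≡count i) (trans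
    (palindromic colourDescents-gammaPositive i (m ∸ i) (m+[n∸m]≡n (s≤s⁻¹ i<n))) (sym (g≡count (m ∸ i))))
  growth : ∀ i → i < m / 2 → g P i ≤ g P (suc i)
  growth i i<m/2 = subst₂ _≤_ (sym (g≡count i)) (sym (g≡count (suc i)))
      (unimodal colourDescents-gammaPositive i (begin
    i + suc i       ≤⟨ n≤1+n (i + suc i) ⟩
    suc i + suc i   ≡⟨ cong (suc i +_) (+-identityʳ (suc i)) ⟨
    2 * suc i       ≡⟨ *-comm 2 (suc i) ⟩
    suc i * 2       ≤⟨ *-monoˡ-≤ 2 i<m/2 ⟩
    m / 2 * 2       ≤⟨ m/n*n≤m m 2 ⟩
    m               ∎))
    where open ≤-Reasoning
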